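{- Let $K$ be a local field with finite residue field of characteristic $p$ and cardinality $q$, and let $e>0$ be an integer with $e\not\equiv0\pmod p$. The set $\mathcal T_{e,1}(K)$ of $K$-isomorphism classes of totally ramified (separable) extensions of $K$ of degree $e$ is in canonical bijection with the set $\mathcal R_e(K)$ of ramified lines in $K^\times/K^{\times e}$, a ramified line $D$ corresponding to the class of $K(\sqrt[e]{D})$. In particular, the cardinality of $\mathcal T_{e,1}(K)$ is $g=\gcd(q-1,e)$.
   Context: A local field is a field complete for a discrete valuation with finite residue field. Let $\bar w:K^\times/K^{\times e}\to\mathbf Z/e\mathbf Z$ be induced by the normalised valuation of $K$. A ramified line in $K^\times/K^{\times e}$ is a subgroup $D$ on which $\bar w$ restricts to an isomorphism $D\to\mathbf Z/e\mathbf Z$. It is generated by the image of a uniformiser $\pi$ of $K$, this image being the unique element of $D$ mapping to $1\in\mathbf Z/e\mathbf Z$, and $K(\sqrt[e]{D})$ denotes $K[T]/(T^e-\pi)$, which up to $K$-isomorphism does not depend on the choice of $\pi$. -}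

module Defs where

open import Level using (Level; _⊔_; suc; 0ℓ)
open import Algebra.Bundles using (CommutativeRing; AbelianGroup; RawGroup; RawRing)
open import Algebra.Morphism.Structures
  using (IsGroupHomomorphism; IsGroupIsomorphism; IsRingMonomorphism; IsRingIsomorphism)
open import Algebra.Morphism.Bundles using (RingHomomorphism)
import Algebra.Construct.NaturalChoice.Min as Min
import Algebra.Definitions.RawMonoid as RawMonoidDefs
import Algebra.Definitions.RawSemiring as RawSemiringDefs
import Algebra.Morphism.RingMonomorphism as RingMono
import Algebra.Properties.CommutativeMonoid.Mult as CMonMult
import Algebra.Properties.CommutativeSemigroup as CSemigroup
import Algebra.Properties.AbelianGroup as AbGroupProps
import Algebra.Properties.Ring as RingProps
import Algebra.Properties.Semiring.Divisibility as SemiringDivisibility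
import Algebra.Morphism.Construct.Composition as Comp
import Algebra.Morphism.Construct.Identity as Id
open import Data.Empty using (⊥-elim)
open import Data.Fin.Base using (Fin)
open import Data.Integer.Base as ℤ using (ℤ; 0ℤ; 1ℤ; +_)
import Data.Integer.Properties as ℤ
open import Data.List.Base using (List; []; _∷_; map)
open import Data.Maybe.Base as Maybe using (Maybe)
open import Data.Maybe.Properties using (just-injective)
open import Data.Nat.Base as ℕ using (ℕ; zero)
import Data.Nat.Divisibility as ℕ
open import Data.Product.Base using (Σ; ∃; ∃-syntax; Σ-syntax; _×_; _,_; proj₁; proj₂)
open import Data.Vec.Functional using (Vector)
open import Function.Base using (_∘_; _on_)
open import Function.Bundles using (Bijection; Equivalence; _⇔_)
open import Relation.Binary.Bundles using (Setoid; TotalOrder)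
open import Relation.Binary.Structures using (IsEquivalence)
import Relation.Binary.Construct.Add.Supremum.NonStrict as Supremum
open import Relation.Binary.PropositionalEquality as ≡ using (_≡_; refl)
import Relation.Binary.Construct.On as On
import Relation.Binary.Reasoning.Setoid as SetoidReasoning
open import Relation.Nullary.Negation.Core using (¬_)
open import Relation.Nullary.Construct.Add.Supremum using (_⁺; [_]; ⊤⁺)
open import Relation.Unary using (Pred; _∈_; _≐_)
open import Relation.Unary.Relation.Binary.Equality using (≐-isEquivalence)

private
  variable
    a b c ℓ p : Level

HasCardinality : Setoid c ℓ → ℕ → Set (c ⊔ ℓ)
HasCardinality S n = Bijection S (≡.setoid (Fin n))

module _ (G : AbelianGroup c ℓ) where
  open AbelianGroup G renaming (refl to ≈-refl; sym to ≈-sym; trans to ≈-trans)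
  open CMonMult commutativeMonoid renaming (_×_ to _·_)
  open CSemigroup commutativeSemigroup using (interchange)
  open SetoidReasoning setoid

  -- n · z is z ∙ ⋯ ∙ z, the n-th power in multiplicative notation.
  infix 4 _≈_mod-powers_
  _≈_mod-powers_ : Carrier → Carrier → ℕ → Set (c ⊔ ℓ)
  x ≈ y mod-powers n = ∃[ z ] x ≈ y ∙ (n · z)

  private
    module _ (n : ℕ) where
      pw-ε : n · ε ≈ ε
      pw-ε = go n
        where
        go : ∀ m → m · ε ≈ ε
        go zero      = ≈-refl
        go (ℕ.suc m) = ≈-trans (identityˡ _) (go m)

      pw-⁻¹ : ∀ z → n · (z ⁻¹) ≈ (n · z) ⁻¹
      pw-⁻¹ z = uniqueˡ-⁻¹ _ _ (≈-trans (≈-sym (×-distrib-+ (z ⁻¹) z n))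
        (≈-trans (×-congʳ n (inverseˡ z)) pw-ε))

      fromEq : ∀ {x y} → x ≈ y → x ≈ y mod-powers n
      fromEq x≈y = ε , ≈-trans x≈y (≈-sym (≈-trans (∙-congˡ pw-ε) (identityʳ _)))

      symm : ∀ {x y} → x ≈ y mod-powers n → y ≈ x mod-powers n
      symm {x} {y} (z , e) = z ⁻¹ , ≈-sym (begin
        x ∙ (n · (z ⁻¹))           ≈⟨ ∙-cong e (pw-⁻¹ z) ⟩
        y ∙ (n · z) ∙ (n · z) ⁻¹ ≈⟨ assoc _ _ _ ⟩
        y ∙ ((n · z) ∙ (n · z) ⁻¹) ≈⟨ ∙-congˡ (inverseʳ _) ⟩
        y ∙ ε                    ≈⟨ identityʳ y ⟩
        y                        ∎)

      tran : ∀ {x y w} → x ≈ y mod-powers n → y ≈ w mod-powers n → x ≈ w mod-powers n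
      tran {x} {y} {w} (z , e) (z′ , e′) = z′ ∙ z , (begin
        x                         ≈⟨ e ⟩
        y ∙ (n · z)               ≈⟨ ∙-congʳ e′ ⟩
        w ∙ (n · z′) ∙ (n · z)    ≈⟨ assoc _ _ _ ⟩
        w ∙ ((n · z′) ∙ (n · z))  ≈⟨ ∙-congˡ (×-distrib-+ z′ z n) ⟨
        w ∙ (n · (z′ ∙ z))        ∎)

      mul : ∀ {x y u v} → x ≈ y mod-powers n → u ≈ v mod-powers n →
            x ∙ u ≈ y ∙ v mod-powers n
      mul {x} {y} {u} {v} (z , e) (z′ , e′) = z ∙ z′ , (begin
        x ∙ u                          ≈⟨ ∙-cong e e′ ⟩
        (y ∙ (n · z)) ∙ (v ∙ (n · z′)) ≈⟨ interchange _ _ _ _ ⟩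
        (y ∙ v) ∙ ((n · z) ∙ (n · z′)) ≈⟨ ∙-congˡ (×-distrib-+ z z′ n) ⟨
        (y ∙ v) ∙ (n · (z ∙ z′))       ∎)

      inv : ∀ {x y} → x ≈ y mod-powers n → x ⁻¹ ≈ y ⁻¹ mod-powers n
      inv {x} {y} (z , e) = z ⁻¹ , (begin
        x ⁻¹                 ≈⟨ ⁻¹-cong e ⟩
        (y ∙ (n · z)) ⁻¹     ≈⟨ AbGroupProps.⁻¹-∙-comm G y (n · z) ⟨
        y ⁻¹ ∙ (n · z) ⁻¹    ≈⟨ ∙-congˡ (pw-⁻¹ z) ⟨
        y ⁻¹ ∙ (n · (z ⁻¹))    ∎)

  infixl 7 _/powers_
  _/powers_ : ℕ → AbelianGroup c (c ⊔ ℓ)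
  _/powers_ n = record
    { Carrier = Carrier
    ; _≈_     = λ x y → x ≈ y mod-powers n
    ; _∙_     = _∙_
    ; ε       = ε
    ; _⁻¹     = _⁻¹
    ; isAbelianGroup = record
      { isGroup = record
        { isMonoid = record
          { isSemigroup = record
            { isMagma = record
              { isEquivalence = record
                { refl = fromEq n ≈-refl ; sym = symm n ; trans = tran n }
              ; ∙-cong = mul n
              }
            ; assoc = λ x y z → fromEq n (assoc x y z)
            }
          ; identity = (λ x → fromEq n (identityˡ x)) , (λ x → fromEq n (identityʳ x))
          }
        ; inverse = (λ x → fromEq n (inverseˡ x)) , (λ x → fromEq n (inverseʳ x))
        ; ⁻¹-cong = inv n
        }
      ; comm = λ x y → fromEq n (comm x y)
      }
    }

-- In the additive group ℤ the n-th powers are the multiples of n.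
ℤ/_ℤ : ℕ → AbelianGroup 0ℓ 0ℓ
ℤ/ n ℤ = ℤ.+-0-abelianGroup /powers n

/powers-homomorphism :
  (G : AbelianGroup a b) (H : AbelianGroup c ℓ) (n : ℕ) →
  let module G = AbelianGroup G ; module H = AbelianGroup H in
  {f : G.Carrier → H.Carrier} →
  IsGroupHomomorphism G.rawGroup H.rawGroup f →
  IsGroupHomomorphism (AbelianGroup.rawGroup (G /powers n))
                      (AbelianGroup.rawGroup (H /powers n)) f
/powers-homomorphism G H n {f} f-hom = record
  { isMonoidHomomorphism = record
    { isMagmaHomomorphism = record
      { isRelHomomorphism = record
        { cong = λ { {x} {y} (z , e) → f z ,
            H.trans (F.⟦⟧-cong e) (H.trans (F.homo _ _) (H.∙-congˡ (pw n z))) } }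
      ; homo = λ x y → reflexive (F.homo x y)
      }
    ; ε-homo = reflexive F.ε-homo
    }
  ; ⁻¹-homo = λ x → reflexive (F.⁻¹-homo x)
  }
  where
  module G = AbelianGroup G
  module H = AbelianGroup H
  module F = IsGroupHomomorphism f-hom
  open RawMonoidDefs G.rawMonoid using () renaming (_×_ to _·G_)
  open RawMonoidDefs H.rawMonoid using () renaming (_×_ to _·H_)
  pw : ∀ m z → f (m ·G z) H.≈ (m ·H f z)
  pw zero      z = F.ε-homo
  pw (ℕ.suc m) z = H.trans (F.homo _ _) (H.∙-congˡ (pw m z))
  reflexive : ∀ {x y} → x H.≈ y → AbelianGroup._≈_ (H /powers n) x y
  reflexive {x} {y} e = H.ε , H.trans e
    (H.sym (H.trans (H.∙-congˡ (pw-ε n)) (H.identityʳ y)))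
    where
    pw-ε : ∀ m → (m ·H H.ε) H.≈ H.ε
    pw-ε zero      = H.refl
    pw-ε (ℕ.suc m) = H.trans (H.identityˡ _) (pw-ε m)

record Subgroup (G : AbelianGroup c ℓ) (p : Level) : Set (c ⊔ ℓ ⊔ suc p) where
  open AbelianGroup G
  field
    Member   : Pred Carrier p
    resp     : ∀ {x y} → x ≈ y → x ∈ Member → y ∈ Member
    ε-closed : ε ∈ Member
    ∙-closed : ∀ {x y} → x ∈ Member → y ∈ Member → (x ∙ y) ∈ Member
    ⁻¹-closed : ∀ {x} → x ∈ Member → (x ⁻¹) ∈ Member

  memberGroup : RawGroup (c ⊔ p) ℓ
  memberGroup = record
    { Carrier = ∃ Member
    ; _≈_     = _≈_ on proj₁
    ; _∙_     = λ { (x , x∈) (y , y∈) → x ∙ y , ∙-closed x∈ y∈ }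
    ; ε       = ε , ε-closed
    ; _⁻¹     = λ { (x , x∈) → x ⁻¹ , ⁻¹-closed x∈ }
    }

HasCharacteristic : CommutativeRing c ℓ → ℕ → Set ℓ
HasCharacteristic R n = ∀ m → (m · 1# ≈ 0#) ⇔ (n ℕ.∣ m)
  where
  open CommutativeRing R
  open RawSemiringDefs (RawRing.rawSemiring rawRing) using () renaming (_×_ to _·_)

record IsField (R : CommutativeRing c ℓ) : Set (c ⊔ ℓ) where
  open CommutativeRing R
  field
    1≉0     : ¬ (1# ≈ 0#)
    inverse : ∀ x → ¬ (x ≈ 0#) → ∃[ y ] x * y ≈ 1#

record Ideal (R : CommutativeRing c ℓ) (p : Level) : Set (c ⊔ ℓ ⊔ suc p) where
  open CommutativeRing R
  field
    Member   : Pred Carrier p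
    resp     : ∀ {x y} → x ≈ y → x ∈ Member → y ∈ Member
    0-closed : 0# ∈ Member
    +-closed : ∀ {x y} → x ∈ Member → y ∈ Member → (x + y) ∈ Member
    *-closed : ∀ r {x} → x ∈ Member → (r * x) ∈ Member

module _ (R : CommutativeRing c ℓ) (I : Ideal R p) where
  open CommutativeRing R renaming (refl to ≈-refl; sym to ≈-sym; trans to ≈-trans)
  open Ideal I
  open RingProps ring
  open CSemigroup +-commutativeSemigroup using (interchange)
  open SetoidReasoning setoid

  private
    infix 4 _∼_
    _∼_ : Carrier → Carrier → Set p
    x ∼ y = (x - y) ∈ Member

    neg-closed : ∀ {x} → x ∈ Member → (- x) ∈ Member
    neg-closed {x} x∈ = resp (-1*x≈-x x) (*-closed (- 1#) x∈)

    fromEq : ∀ {x y} → x ≈ y → x ∼ y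
    fromEq x≈y = resp (≈-sym (≈-trans (+-congʳ x≈y) (-‿inverseʳ _))) 0-closed

    symm : ∀ {x y} → x ∼ y → y ∼ x
    symm {x} {y} xy = resp
      (begin
        - (x - y)       ≈⟨ -‿+-comm x (- y) ⟨
        - x + - (- y)   ≈⟨ +-congˡ (-‿involutive y) ⟩
        - x + y         ≈⟨ +-comm _ _ ⟩
        y - x           ∎)
      (neg-closed xy)

    tran : ∀ {x y z} → x ∼ y → y ∼ z → x ∼ z
    tran {x} {y} {z} xy yz = resp
      (begin
        (x - y) + (y - z)   ≈⟨ +-assoc x (- y) (y - z) ⟩
        x + (- y + (y - z)) ≈⟨ +-congˡ (+-assoc (- y) y (- z)) ⟨
        x + ((- y + y) - z) ≈⟨ +-congˡ (+-congʳ (-‿inverseˡ y)) ⟩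
        x + (0# - z)        ≈⟨ +-congˡ (+-identityˡ _) ⟩
        x - z               ∎)
      (+-closed xy yz)

    add : ∀ {x y u v} → x ∼ y → u ∼ v → (x + u) ∼ (y + v)
    add {x} {y} {u} {v} xy uv = resp
      (≈-trans (interchange x (- y) u (- v)) (+-congˡ (-‿+-comm y v)))
      (+-closed xy uv)

    neg : ∀ {x y} → x ∼ y → (- x) ∼ (- y)
    neg {x} {y} xy = resp (≈-sym (-‿+-comm x (- y))) (neg-closed xy)

    mulˡ : ∀ r {x y} → x ∼ y → (r * x) ∼ (r * y)
    mulˡ r {x} {y} xy = resp
      (≈-trans (distribˡ r x (- y)) (+-congˡ (≈-sym (-‿distribʳ-* r y))))
      (*-closed r xy)

    mul : ∀ {x y u v} → x ∼ y → u ∼ v → (x * u) ∼ (y * v)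
    mul {x} {y} {u} {v} xy uv =
      tran (mulˡ x uv) (tran (fromEq (*-comm x v)) (tran (mulˡ v xy) (fromEq (*-comm v y))))

  _/ᴵ_ : CommutativeRing c p
  _/ᴵ_ = record
    { Carrier = Carrier
    ; _≈_ = _∼_
    ; _+_ = _+_
    ; _*_ = _*_
    ; -_  = -_
    ; 0#  = 0#
    ; 1#  = 1#
    ; isCommutativeRing = record
      { isRing = record
        { +-isAbelianGroup = record
          { isGroup = record
            { isMonoid = record
              { isSemigroup = record
                { isMagma = record
                  { isEquivalence = record
                    { refl = fromEq ≈-refl ; sym = symm ; trans = tran }
                  ; ∙-cong = add
                  }
                ; assoc = λ x y z → fromEq (+-assoc x y z)
                }
              ; identity = (λ x → fromEq (+-identityˡ x)) , (λ x → fromEq (+-identityʳ x))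
              }
            ; inverse = (λ x → fromEq (-‿inverseˡ x)) , (λ x → fromEq (-‿inverseʳ x))
            ; ⁻¹-cong = neg
            }
          ; comm = λ x y → fromEq (+-comm x y)
          }
        ; *-cong = mul
        ; *-assoc = λ x y z → fromEq (*-assoc x y z)
        ; *-identity = (λ x → fromEq (*-identityˡ x)) , (λ x → fromEq (*-identityʳ x))
        ; distrib = (λ x y z → fromEq (distribˡ x y z)) , (λ x y z → fromEq (distribʳ x y z))
        }
      ; *-comm = λ x y → fromEq (*-comm x y)
      }
    }

module _ (R : CommutativeRing c ℓ) where
  open CommutativeRing R renaming (refl to ≈-refl; sym to ≈-sym; trans to ≈-trans)
  open SemiringDivisibility semiring using (_∣_; _,_)

  -- f ∣ x unfolds to ∃ q. q * f ≈ x.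
  principalIdeal : Carrier → Ideal R (c ⊔ ℓ)
  principalIdeal f = record
    { Member   = f ∣_
    ; resp     = λ { x≈y (q , e) → q , ≈-trans e x≈y }
    ; 0-closed = 0# , zeroˡ f
    ; +-closed = λ { (q , e) (q′ , e′) → q + q′ , ≈-trans (distribʳ f q q′) (+-cong e e′) }
    ; *-closed = λ { r (q , e) → r * q , ≈-trans (*-assoc r q f) (*-congˡ e) }
    }

record Algebra (R : CommutativeRing c ℓ) (a b : Level) : Set (c ⊔ ℓ ⊔ suc (a ⊔ b)) where
  field
    ring      : CommutativeRing a b
    structure : RingHomomorphism (CommutativeRing.rawRing R) (CommutativeRing.rawRing ring)

  open CommutativeRing ring public hiding (ring)

  ι : CommutativeRing.Carrier R → Carrier
  ι = RingHomomorphism.⟦_⟧ structure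

module _ {R : CommutativeRing c ℓ} where

  infix 4 _≅_
  record _≅_ {a b a′ b′} (A : Algebra R a b) (B : Algebra R a′ b′) :
             Set (c ⊔ a ⊔ b ⊔ a′ ⊔ b′) where
    private
      module A = Algebra A
      module B = Algebra B
    field
      to                : A.Carrier → B.Carrier
      isRingIsomorphism : IsRingIsomorphism (CommutativeRing.rawRing A.ring)
                                            (CommutativeRing.rawRing B.ring) to
      to-ι              : ∀ x → to (A.ι x) B.≈ B.ι x

  record IsBasis {a b} (A : Algebra R a b) {n : ℕ} (v : Vector (Algebra.Carrier A) n) :
                 Set (c ⊔ ℓ ⊔ a ⊔ b) where
    open Algebra A using (_≈_; _*_; ι; 0#; rawRing)
    open RawSemiringDefs (RawRing.rawSemiring rawRing) using (sum)
    private module R = CommutativeRing R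
    field
      spanning    : ∀ x → Σ[ k ∈ Vector R.Carrier n ] x ≈ sum (λ i → ι (k i) * v i)
      independent : ∀ (k : Vector R.Carrier n) →
                    sum (λ i → ι (k i) * v i) ≈ 0# → ∀ i → k i R.≈ R.0#

  HasDegree : ∀ {a b} → Algebra R a b → ℕ → Set (c ⊔ ℓ ⊔ a ⊔ b)
  HasDegree A n = Σ[ v ∈ Vector (Algebra.Carrier A) n ] IsBasis A v

  ≅-refl : ∀ {a b} {A : Algebra R a b} → A ≅ A
  ≅-refl {A = A} = record
    { to                = λ x → x
    ; isRingIsomorphism = Id.isRingIsomorphism A.rawRing A.refl
    ; to-ι              = λ _ → A.refl
    }
    where module A = Algebra A

  ≅-trans : ∀ {a b a′ b′ a″ b″} {A : Algebra R a b} {B : Algebra R a′ b′}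
            {C : Algebra R a″ b″} → A ≅ B → B ≅ C → A ≅ C
  ≅-trans {C = C} f g = record
    { to                = g.to ∘ f.to
    ; isRingIsomorphism = Comp.isRingIsomorphism C.trans f.isRingIsomorphism g.isRingIsomorphism
    ; to-ι              = λ x → C.trans (G.⟦⟧-cong (f.to-ι x)) (g.to-ι x)
    }
    where
    module C = Algebra C
    module f = _≅_ f
    module g = _≅_ g
    module G = IsRingIsomorphism g.isRingIsomorphism

  ≅-sym : ∀ {a b a′ b′} {A : Algebra R a b} {B : Algebra R a′ b′} → A ≅ B → B ≅ A
  ≅-sym {A = A} {B = B} f = record
    { to = g
    ; isRingIsomorphism = record
      { isRingMonomorphism = record
        { isRingHomomorphism = record
          { isSemiringHomomorphism = record
            { isNearSemiringHomomorphism = record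
              { +-isMonoidHomomorphism = record
                { isMagmaHomomorphism = record
                  { isRelHomomorphism = record { cong = g-cong }
                  ; homo = λ x y → inj (B.trans (fg _)
                      (B.sym (B.trans (F.+-homo _ _) (B.+-cong (fg x) (fg y)))))
                  }
                ; ε-homo = inj (B.trans (fg _) (B.sym F.0#-homo))
                }
              ; *-homo = λ x y → inj (B.trans (fg _)
                  (B.sym (B.trans (F.*-homo _ _) (B.*-cong (fg x) (fg y)))))
              }
            ; 1#-homo = inj (B.trans (fg _) (B.sym F.1#-homo))
            }
          ; -‿homo = λ x → inj (B.trans (fg _)
              (B.sym (B.trans (F.-‿homo _) (B.-‿cong (fg x)))))
          }
        ; injective = λ e → B.trans (B.sym (fg _)) (B.trans (F.⟦⟧-cong e) (fg _))
        }
      ; surjective = λ x → f.to x , λ e → A.trans (g-cong e) (inj (fg _))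
      }
    ; to-ι = λ x → inj (B.trans (fg _) (B.sym (f.to-ι x)))
    }
    where
    module A = Algebra A
    module B = Algebra B
    module f = _≅_ f
    module F = IsRingIsomorphism f.isRingIsomorphism
    inj : ∀ {x y} → f.to x B.≈ f.to y → x A.≈ y
    inj = F.injective
    g : B.Carrier → A.Carrier
    g y = proj₁ (F.surjective y)
    fg : ∀ y → f.to (g y) B.≈ y
    fg y = proj₂ (F.surjective y) A.refl
    g-cong : ∀ {x y} → x B.≈ y → g x A.≈ g y
    g-cong e = inj (B.trans (fg _) (B.trans e (B.sym (fg _))))

module Polynomial (R : CommutativeRing c ℓ) where
  open CommutativeRing R renaming (refl to ≈-refl; sym to ≈-sym; trans to ≈-trans)
  open RingProps ring using (-0#≈0#)
  open CSemigroup +-commutativeSemigroup using (interchange)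

  -- a₀ ∷ a₁ ∷ ⋯ is a₀ + a₁T + ⋯; trailing zeros are allowed.
  Poly : Set c
  Poly = List Carrier

  coeff : Poly → ℕ → Carrier
  coeff []       _         = 0#
  coeff (a ∷ _)  zero      = a
  coeff (_ ∷ as) (ℕ.suc n) = coeff as n

  infix 4 _≋_
  record _≋_ (f g : Poly) : Set ℓ where
    constructor mk≋
    field coeff-≈ : ∀ n → coeff f n ≈ coeff g n
  open _≋_ public

  infixl 6 _⊕_
  _⊕_ : Poly → Poly → Poly
  []       ⊕ g        = g
  (a ∷ f)  ⊕ []       = a ∷ f
  (a ∷ f)  ⊕ (b ∷ g)  = (a + b) ∷ (f ⊕ g)

  scale : Carrier → Poly → Poly
  scale a = map (a *_)

  ⊖_ : Poly → Poly
  ⊖_ = map (-_)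

  infixl 7 _⊗_
  _⊗_ : Poly → Poly → Poly
  []      ⊗ g = []
  (a ∷ f) ⊗ g = scale a g ⊕ (0# ∷ f ⊗ g)

  const : Carrier → Poly
  const a = a ∷ []

  T : Poly
  T = 0# ∷ 1# ∷ []

  private
    ⊕-coeff : ∀ f g n → coeff (f ⊕ g) n ≈ coeff f n + coeff g n
    ⊕-coeff []      g       n         = ≈-sym (+-identityˡ _)
    ⊕-coeff (a ∷ f) []      n         = ≈-sym (+-identityʳ _)
    ⊕-coeff (a ∷ f) (b ∷ g) zero      = ≈-refl
    ⊕-coeff (a ∷ f) (b ∷ g) (ℕ.suc n) = ⊕-coeff f g n

    ⊖-coeff : ∀ f n → coeff (⊖ f) n ≈ - coeff f n
    ⊖-coeff []      n         = ≈-sym -0#≈0#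
    ⊖-coeff (a ∷ f) zero      = ≈-refl
    ⊖-coeff (a ∷ f) (ℕ.suc n) = ⊖-coeff f n

    scale-coeff : ∀ a f n → coeff (scale a f) n ≈ a * coeff f n
    scale-coeff a []      n         = ≈-sym (zeroʳ a)
    scale-coeff a (b ∷ f) zero      = ≈-refl
    scale-coeff a (b ∷ f) (ℕ.suc n) = scale-coeff a f n

    ≋-isEquivalence : IsEquivalence _≋_
    ≋-isEquivalence = record
      { refl  = mk≋ λ _ → ≈-refl
      ; sym   = λ e → mk≋ λ n → ≈-sym (coeff-≈ e n)
      ; trans = λ e e′ → mk≋ λ n → ≈-trans (coeff-≈ e n) (coeff-≈ e′ n)
      }

    ⊕-cong : ∀ {f g h k} → f ≋ g → h ≋ k → (f ⊕ h) ≋ (g ⊕ k)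
    ⊕-cong {f} {g} {h} {k} e e′ = mk≋ λ n → ≈-trans (⊕-coeff f h n)
      (≈-trans (+-cong (coeff-≈ e n) (coeff-≈ e′ n)) (≈-sym (⊕-coeff g k n)))

    ⊕-assoc : ∀ f g h → ((f ⊕ g) ⊕ h) ≋ (f ⊕ (g ⊕ h))
    ⊕-assoc f g h = mk≋ λ n → ≈-trans (⊕-coeff (f ⊕ g) h n)
      (≈-trans (+-congʳ (⊕-coeff f g n)) (≈-trans (+-assoc _ _ _)
      (≈-sym (≈-trans (⊕-coeff f (g ⊕ h) n) (+-congˡ (⊕-coeff g h n))))))

    ⊕-comm : ∀ f g → (f ⊕ g) ≋ (g ⊕ f)
    ⊕-comm f g = mk≋ λ n → ≈-trans (⊕-coeff f g n)
      (≈-trans (+-comm _ _) (≈-sym (⊕-coeff g f n)))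

    ⊕-identityʳ : ∀ f → (f ⊕ []) ≋ f
    ⊕-identityʳ f = mk≋ λ n → ≈-trans (⊕-coeff f [] n) (+-identityʳ _)

    ⊕-inverseʳ : ∀ f → (f ⊕ (⊖ f)) ≋ []
    ⊕-inverseʳ f = mk≋ λ n → ≈-trans (⊕-coeff f (⊖ f) n)
      (≈-trans (+-congˡ (⊖-coeff f n)) (-‿inverseʳ _))

    ⊖-cong : ∀ {f g} → f ≋ g → (⊖ f) ≋ (⊖ g)
    ⊖-cong {f} {g} e = mk≋ λ n → ≈-trans (⊖-coeff f n)
      (≈-trans (-‿cong (coeff-≈ e n)) (≈-sym (⊖-coeff g n)))

    module ≋ = IsEquivalence ≋-isEquivalence

    +-poly : AbelianGroup c ℓ
    +-poly = record
      { Carrier = Poly ; _≈_ = _≋_ ; _∙_ = _⊕_ ; ε = [] ; _⁻¹ = ⊖_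
      ; isAbelianGroup = record
        { isGroup = record
          { isMonoid = record
            { isSemigroup = record
              { isMagma = record { isEquivalence = ≋-isEquivalence ; ∙-cong = ⊕-cong }
              ; assoc = ⊕-assoc
              }
            ; identity = (λ _ → ≋.refl) , ⊕-identityʳ
            }
          ; inverse = (λ f → ≋.trans (⊕-comm (⊖ f) f) (⊕-inverseʳ f)) , ⊕-inverseʳ
          ; ⁻¹-cong = ⊖-cong
          }
        ; comm = ⊕-comm
        }
      }

    module P = AbelianGroup +-poly
    module PC = CSemigroup P.commutativeSemigroup

    ∷-cong : ∀ {a b f g} → a ≈ b → f ≋ g → (a ∷ f) ≋ (b ∷ g)
    ∷-cong e e′ = mk≋ λ { zero → e ; (ℕ.suc n) → coeff-≈ e′ n }

    shift-[] : (0# ∷ []) ≋ []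
    shift-[] = mk≋ λ { zero → ≈-refl ; (ℕ.suc n) → ≈-refl }

    shift-⊕ : ∀ f g → (0# ∷ (f ⊕ g)) ≋ ((0# ∷ f) ⊕ (0# ∷ g))
    shift-⊕ f g = ∷-cong (≈-sym (+-identityʳ 0#)) ≋.refl

    scale-cong : ∀ {a b f g} → a ≈ b → f ≋ g → scale a f ≋ scale b g
    scale-cong {a} {b} {f} {g} e e′ = mk≋ λ n → ≈-trans (scale-coeff a f n)
      (≈-trans (*-cong e (coeff-≈ e′ n)) (≈-sym (scale-coeff b g n)))

    scale-⊕ : ∀ a f g → scale a (f ⊕ g) ≋ (scale a f ⊕ scale a g)
    scale-⊕ a f g = mk≋ λ n → ≈-trans (scale-coeff a (f ⊕ g) n)
      (≈-trans (*-congˡ (⊕-coeff f g n)) (≈-trans (distribˡ a _ _)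
      (≈-sym (≈-trans (⊕-coeff (scale a f) (scale a g) n)
        (+-cong (scale-coeff a f n) (scale-coeff a g n))))))

    scale-0 : ∀ f → scale 0# f ≋ []
    scale-0 f = mk≋ λ n → ≈-trans (scale-coeff 0# f n) (zeroˡ _)

    scale-1 : ∀ f → scale 1# f ≋ f
    scale-1 f = mk≋ λ n → ≈-trans (scale-coeff 1# f n) (*-identityˡ _)

    scale-scale : ∀ a b f → scale (a * b) f ≋ scale a (scale b f)
    scale-scale a b f = mk≋ λ n → ≈-trans (scale-coeff (a * b) f n)
      (≈-trans (*-assoc a b _) (≈-sym (≈-trans (scale-coeff a (scale b f) n)
        (*-congˡ (scale-coeff b f n)))))

    ⊗-congˡ : ∀ f {g h} → g ≋ h → (f ⊗ g) ≋ (f ⊗ h)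
    ⊗-congˡ []      e = ≋.refl
    ⊗-congˡ (a ∷ f) e = ⊕-cong (scale-cong ≈-refl e) (∷-cong ≈-refl (⊗-congˡ f e))

    ⊗-zeroʳ : ∀ f → (f ⊗ []) ≋ []
    ⊗-zeroʳ []      = ≋.refl
    ⊗-zeroʳ (a ∷ f) = ≋.trans (∷-cong ≈-refl (⊗-zeroʳ f)) shift-[]

    ⊗-∷ : ∀ f b g → (f ⊗ (b ∷ g)) ≋ (scale b f ⊕ (0# ∷ f ⊗ g))
    ⊗-∷ []      b g = ≋.sym shift-[]
    ⊗-∷ (a ∷ f) b g = ∷-cong (+-congʳ (*-comm a b))
      (≋.trans (⊕-cong ≋.refl (⊗-∷ f b g))
               (PC.x∙yz≈y∙xz (scale a g) (scale b f) (0# ∷ f ⊗ g)))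

    ⊗-comm : ∀ f g → (f ⊗ g) ≋ (g ⊗ f)
    ⊗-comm []      g = ≋.sym (⊗-zeroʳ g)
    ⊗-comm (a ∷ f) g = ≋.trans
      (⊕-cong ≋.refl (∷-cong ≈-refl (⊗-comm f g))) (≋.sym (⊗-∷ g a f))

    ⊗-cong : ∀ {f g h k} → f ≋ g → h ≋ k → (f ⊗ h) ≋ (g ⊗ k)
    ⊗-cong {f} {g} {h} {k} e e′ = ≋.trans (⊗-congˡ f e′)
      (≋.trans (⊗-comm f k) (≋.trans (⊗-congˡ k e) (⊗-comm k g)))

    ⊗-distribˡ : ∀ f g h → (f ⊗ (g ⊕ h)) ≋ ((f ⊗ g) ⊕ (f ⊗ h))
    ⊗-distribˡ []      g h = ≋.refl
    ⊗-distribˡ (a ∷ f) g h = ≋.trans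
      (⊕-cong (scale-⊕ a g h)
        (≋.trans (∷-cong ≈-refl (⊗-distribˡ f g h)) (shift-⊕ (f ⊗ g) (f ⊗ h))))
      (PC.interchange (scale a g) (scale a h) (0# ∷ f ⊗ g) (0# ∷ f ⊗ h))

    ⊗-distribʳ : ∀ f g h → ((g ⊕ h) ⊗ f) ≋ ((g ⊗ f) ⊕ (h ⊗ f))
    ⊗-distribʳ f g h = ≋.trans (⊗-comm (g ⊕ h) f)
      (≋.trans (⊗-distribˡ f g h) (⊕-cong (⊗-comm f g) (⊗-comm f h)))

    scale-⊗ : ∀ a f g → (scale a f ⊗ g) ≋ scale a (f ⊗ g)
    scale-⊗ a []      g = ≋.refl
    scale-⊗ a (b ∷ f) g = ≋.trans
      (⊕-cong (scale-scale a b g) (∷-cong (≈-sym (zeroʳ a)) (scale-⊗ a f g)))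
      (≋.sym (scale-⊕ a (scale b g) (0# ∷ f ⊗ g)))

    ⊗-assoc : ∀ f g h → ((f ⊗ g) ⊗ h) ≋ (f ⊗ (g ⊗ h))
    ⊗-assoc []      g h = ≋.refl
    ⊗-assoc (a ∷ f) g h = ≋.trans (⊗-distribʳ h (scale a g) (0# ∷ f ⊗ g))
      (⊕-cong (scale-⊗ a g h)
        (≋.trans (⊕-cong (scale-0 h) ≋.refl) (∷-cong ≈-refl (⊗-assoc f g h))))

    ⊗-identityˡ : ∀ f → (const 1# ⊗ f) ≋ f
    ⊗-identityˡ f = ≋.trans (⊕-cong (scale-1 f) shift-[]) (⊕-identityʳ f)

  polynomialRing : CommutativeRing c ℓ
  polynomialRing = record
    { Carrier = Poly
    ; _≈_ = _≋_
    ; _+_ = _⊕_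
    ; _*_ = _⊗_
    ; -_  = ⊖_
    ; 0#  = []
    ; 1#  = const 1#
    ; isCommutativeRing = record
      { isRing = record
        { +-isAbelianGroup = P.isAbelianGroup
        ; *-cong = ⊗-cong
        ; *-assoc = ⊗-assoc
        ; *-identity = ⊗-identityˡ , (λ f → ≋.trans (⊗-comm f (const 1#)) (⊗-identityˡ f))
        ; distrib = ⊗-distribˡ , ⊗-distribʳ
        }
      ; *-comm = ⊗-comm
      }
    }

  open RawSemiringDefs (RawRing.rawSemiring (CommutativeRing.rawRing polynomialRing)) public
    using (_^_; _∣_; Coprime)

  -- (a + T g)′ = g + T g′
  derivative : Poly → Poly
  derivative []      = []
  derivative (a ∷ g) = g ⊕ (0# ∷ derivative g)

  IsMonic : Poly → Set ℓ
  IsMonic f = ∃[ d ] coeff f d ≈ 1# × (∀ n → d ℕ.< n → coeff f n ≈ 0#)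

  IsSeparablePolynomial : Poly → Set (c ⊔ ℓ)
  IsSeparablePolynomial f = Coprime f (derivative f)

  evaluate : ∀ {a b} (A : Algebra R a b) → Poly → Algebra.Carrier A → Algebra.Carrier A
  evaluate A []      x = Algebra.0# A
  evaluate A (a ∷ f) x = ι a +ᴬ (x *ᴬ evaluate A f x)
    where open Algebra A using (ι) renaming (_+_ to _+ᴬ_; _*_ to _*ᴬ_)

  record IsMinimalPolynomial {a b} (A : Algebra R a b) (x : Algebra.Carrier A) (f : Poly) :
                             Set (c ⊔ ℓ ⊔ b) where
    open Algebra A using () renaming (_≈_ to _≈ᴬ_; 0# to 0ᴬ)
    field
      monic   : IsMonic f
      root    : evaluate A f x ≈ᴬ 0ᴬ
      minimal : ∀ g → evaluate A g x ≈ᴬ 0ᴬ → f ∣ g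

  IsSeparable : ∀ {a b} → Algebra R a b → Set (c ⊔ ℓ ⊔ a ⊔ b)
  IsSeparable A = ∀ x → ∃[ f ] IsMinimalPolynomial A x f × IsSeparablePolynomial f

  adjoinRoot : Poly → Algebra R c (c ⊔ ℓ)
  adjoinRoot f = record
    { ring      = polynomialRing /ᴵ principalIdeal polynomialRing f
    ; structure = record
      { ⟦_⟧ = const
      ; isRingHomomorphism = record
        { isSemiringHomomorphism = record
          { isNearSemiringHomomorphism = record
            { +-isMonoidHomomorphism = record
              { isMagmaHomomorphism = record
                { isRelHomomorphism = record { cong = λ e → up (∷-cong e (≋.refl {[]})) }
                ; homo = λ a b → up (≋.refl {const (a + b)})
                }
              ; ε-homo = up {const 0#} {[]} shift-[]
              }
            ; *-homo = λ a b → up {const (a * b)} {const a ⊗ const b}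
                (∷-cong (≈-sym (+-identityʳ (a * b))) ≋.refl)
            }
          ; 1#-homo = up (≋.refl {const 1#})
          }
        ; -‿homo = λ a → up (≋.refl {const (- a)})
        }
      }
    }
    where
    I = principalIdeal polynomialRing f
    up : ∀ {g h} → g ≋ h → CommutativeRing._≈_ (polynomialRing /ᴵ I) g h
    up {g} {h} e = Ideal.resp I {[]} {g ⊕ (⊖ h)}
      (≋.sym (≋.trans (⊕-cong e ≋.refl) (⊕-inverseʳ h))) (Ideal.0-closed I)

ℤ∞ : Set
ℤ∞ = ℤ ⁺

open Supremum ℤ._≤_ public using (_≤⁺_)

ℤ∞-totalOrder : TotalOrder 0ℓ 0ℓ 0ℓ
ℤ∞-totalOrder = record
  { isTotalOrder = Supremum.≤⁺-isTotalOrder-≡ ℤ._≤_ ℤ.≤-isTotalOrder }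

open Min ℤ∞-totalOrder public using () renaming (_⊓_ to _⊓∞_)
private module ≤∞ = TotalOrder ℤ∞-totalOrder

infixl 6 _+∞_
_+∞_ : ℤ∞ → ℤ∞ → ℤ∞
_+∞_ = Maybe.zipWith ℤ._+_

-- Normalised: the value group is all of ℤ.  Since v takes values in
-- ℤ ∪ {∞} and v x is ∞ exactly for x ≈ 0, equality with 0 is decidable;
-- this is the classical notion, read literally.
record DiscreteValuation (R : CommutativeRing c ℓ) : Set (c ⊔ ℓ) where
  open CommutativeRing R
  field
    v      : Carrier → ℤ∞
    v-cong : ∀ {x y} → x ≈ y → v x ≡ v y
    v-∞    : ∀ x → (v x ≡ ⊤⁺) ⇔ (x ≈ 0#)
    v-*    : ∀ x y → v (x * y) ≡ v x +∞ v y
    v-+    : ∀ x y → (v x ⊓∞ v y) ≤⁺ v (x + y)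
    onto   : ∀ n → ∃[ x ] v x ≡ [ n ]

record DiscretelyValuedField c ℓ : Set (suc (c ⊔ ℓ)) where
  field
    ring      : CommutativeRing c ℓ
    isField   : IsField ring
    valuation : DiscreteValuation ring

  open CommutativeRing ring public hiding (ring)
  open IsField isField public
  open DiscreteValuation valuation public

module _ (K : DiscretelyValuedField c ℓ) where
  open DiscretelyValuedField K renaming (refl to ≈-refl; sym to ≈-sym; trans to ≈-trans)
  open RingProps (CommutativeRing.ring ring)
  private
    module M = Min ℤ∞-totalOrder
    module S = Supremum ℤ._≤_
    finite : ∀ {m : ℤ∞} → ¬ (m ≡ ⊤⁺) → ∃[ n ] m ≡ [ n ]
    finite {[ n ]} _  = n , refl
    finite {⊤⁺}    ne = ⊥-elim (ne refl)

    v0 : v 0# ≡ ⊤⁺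
    v0 = Equivalence.from (v-∞ 0#) ≈-refl

    v-finite : ∀ {x} → ¬ (x ≈ 0#) → ∃[ n ] v x ≡ [ n ]
    v-finite {x} x≉0 = finite (x≉0 ∘ Equivalence.to (v-∞ x))

    v≡[]⇒≉0 : ∀ {x n} → v x ≡ [ n ] → ¬ (x ≈ 0#)
    v≡[]⇒≉0 {x} e x≈0 with () ← ≡.trans (≡.sym e) (Equivalence.from (v-∞ x) x≈0)

    v1 : v 1# ≡ [ 0ℤ ]
    v1 with n , e ← v-finite 1≉0 = ≡.trans e (≡.cong [_] (AbGroupProps.∙-cancelˡ ℤ.+-0-abelianGroup n n 0ℤ
      (just-injective (≡.trans (≡.sym (≡.trans (≡.sym (v-cong (*-identityˡ 1#)))
        (≡.trans (v-* 1# 1#) (≡.cong₂ _+∞_ e e))))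
        (≡.trans e (≡.cong [_] (≡.sym (ℤ.+-identityʳ n))))))))

    -1*-1 : - 1# * - 1# ≈ 1#
    -1*-1 = ≈-trans (-1*x≈-x (- 1#)) (-‿involutive 1#)

    double : ∀ n → n ℤ.+ n ≡ 0ℤ → n ≡ 0ℤ
    double (+ zero)       _ = refl
    double (+ ℕ.suc n)    ()
    double (ℤ.-[1+ n ])   ()

    v-1 : v (- 1#) ≡ [ 0ℤ ]
    v-1 with v (- 1#) | v-* (- 1#) (- 1#)
    ... | [ n ] | e = ≡.cong [_] (double n (just-injective
                        (≡.trans (≡.sym e) (≡.trans (v-cong -1*-1) v1))))
    ... | ⊤⁺    | e with () ← ≡.trans (≡.sym e) (≡.trans (v-cong -1*-1) v1)

    [0]+∞ : ∀ m → [ 0ℤ ] +∞ m ≡ m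
    [0]+∞ [ n ] = ≡.cong [_] (ℤ.+-identityˡ n)
    [0]+∞ ⊤⁺    = refl

    v-neg : ∀ x → v (- x) ≡ v x
    v-neg x = ≡.trans (v-cong (≈-sym (-1*x≈-x x)))
      (≡.trans (v-* (- 1#) x) (≡.trans (≡.cong (_+∞ v x) v-1) ([0]+∞ (v x))))

    ≤-+ : ∀ {k x y} → k ≤⁺ v x → k ≤⁺ v y → k ≤⁺ v (x + y)
    ≤-+ {k} {x} {y} p q = ≤∞.trans (M.⊓-glb p q) (v-+ x y)

    +∞-mono : ∀ {i j m n} → [ i ] ≤⁺ m → [ j ] ≤⁺ n → [ i ℤ.+ j ] ≤⁺ m +∞ n
    +∞-mono S.[ p ]    S.[ q ]     = S.[ ℤ.+-mono-≤ p q ]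
    +∞-mono S.[ p ]    (_ S.≤⊤⁺)   = _ S.≤⊤⁺
    +∞-mono (_ S.≤⊤⁺)  _           = _ S.≤⊤⁺

    ≤-* : ∀ {i j x y} → [ i ] ≤⁺ v x → [ j ] ≤⁺ v y → [ i ℤ.+ j ] ≤⁺ v (x * y)
    ≤-* {x = x} {y} p q = ≤∞.trans (+∞-mono p q) (≤∞.reflexive (≡.sym (v-* x y)))

    ≤-resp : ∀ {k x y} → x ≈ y → k ≤⁺ v x → k ≤⁺ v y
    ≤-resp e p = ≤∞.trans p (≤∞.reflexive (v-cong e))

  integerRing : CommutativeRing c ℓ
  integerRing = record
    { Carrier = ∃[ x ] [ 0ℤ ] ≤⁺ v x
    ; _≈_ = _≈_ on proj₁
    ; _+_ = λ { (x , p) (y , q) → x + y , ≤-+ p q }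
    ; _*_ = λ { (x , p) (y , q) → x * y , ≤-* p q }
    ; -_  = λ { (x , p) → - x , ≤∞.trans p (≤∞.reflexive (≡.sym (v-neg x))) }
    ; 0#  = 0# , ≤∞.trans (_ S.≤⊤⁺) (≤∞.reflexive (≡.sym v0))
    ; 1#  = 1# , ≤∞.reflexive (≡.sym v1)
    ; isCommutativeRing = RingMono.isCommutativeRing inclusion isCommutativeRing
    }
    where
    inclusion : IsRingMonomorphism _ rawRing proj₁
    inclusion = record
      { isRingHomomorphism = record
        { isSemiringHomomorphism = record
          { isNearSemiringHomomorphism = record
            { +-isMonoidHomomorphism = record
              { isMagmaHomomorphism = record
                { isRelHomomorphism = record { cong = λ e → e }
                ; homo = λ _ _ → ≈-refl
                }
              ; ε-homo = ≈-refl
              }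
            ; *-homo = λ _ _ → ≈-refl
            }
          ; 1#-homo = ≈-refl
          }
        ; -‿homo = λ _ → ≈-refl
        }
      ; injective = λ e → e
      }

  maximalIdeal : Ideal integerRing 0ℓ
  maximalIdeal = record
    { Member   = λ (x , _) → [ 1ℤ ] ≤⁺ v x
    ; resp     = ≤-resp
    ; 0-closed = ≤∞.trans (_ S.≤⊤⁺) (≤∞.reflexive (≡.sym v0))
    ; +-closed = ≤-+
    ; *-closed = λ (_ , p) q → ≤-* p q
    }

  residueField : CommutativeRing c 0ℓ
  residueField = integerRing /ᴵ maximalIdeal

  IsCauchy : (ℕ → Carrier) → Set
  IsCauchy s = ∀ (N : ℤ) → ∃[ M ] ∀ m n → M ℕ.≤ m → M ℕ.≤ n → [ N ] ≤⁺ v (s m - s n)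

  ConvergesTo : (ℕ → Carrier) → Carrier → Set
  ConvergesTo s x = ∀ (N : ℤ) → ∃[ M ] ∀ n → M ℕ.≤ n → [ N ] ≤⁺ v (s n - x)

  IsComplete : Set c
  IsComplete = ∀ s → IsCauchy s → ∃[ x ] ConvergesTo s x

  private
    *-nonzero : ∀ {x y} → ¬ (x ≈ 0#) → ¬ (y ≈ 0#) → ¬ (x * y ≈ 0#)
    *-nonzero {x} {y} x≉0 y≉0 xy≈0 with x⁻¹ , xx⁻¹≈1 ← inverse x x≉0 =
      y≉0 (≈-trans (≈-sym (*-identityˡ y)) (≈-trans (*-congʳ (≈-sym xx⁻¹≈1))
        (≈-trans (*-congʳ (*-comm x x⁻¹)) (≈-trans (*-assoc x⁻¹ x y)
        (≈-trans (*-congˡ xy≈0) (zeroʳ x⁻¹))))))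

    inverse-nonzero : ∀ {x y} → x * y ≈ 1# → ¬ (y ≈ 0#)
    inverse-nonzero {x} e y≈0 = 1≉0 (≈-trans (≈-sym e) (≈-trans (*-congˡ y≈0) (zeroʳ x)))

    inverse-unique : ∀ {x x′ y y′} → x ≈ x′ → x * y ≈ 1# → x′ * y′ ≈ 1# → y ≈ y′
    inverse-unique {x} {x′} {y} {y′} e p q =
      ≈-trans (≈-sym (*-identityʳ y)) (≈-trans (*-congˡ (≈-sym q))
        (≈-trans (≈-sym (*-assoc y x′ y′)) (≈-trans (*-congʳ (*-comm y x′))
        (≈-trans (*-congʳ (≈-trans (*-congʳ (≈-sym e)) p)) (*-identityˡ y′)))))

  unitGroup : AbelianGroup (c ⊔ ℓ) ℓ
  unitGroup = record
    { Carrier = ∃[ x ] ¬ (x ≈ 0#)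
    ; _≈_ = _≈_ on proj₁
    ; _∙_ = λ { (x , p) (y , q) → x * y , *-nonzero p q }
    ; ε   = 1# , 1≉0
    ; _⁻¹ = λ { (x , p) → proj₁ (inverse x p) , inverse-nonzero (proj₂ (inverse x p)) }
    ; isAbelianGroup = record
      { isGroup = record
        { isMonoid = record
          { isSemigroup = record
            { isMagma = record
              { isEquivalence = record { refl = ≈-refl ; sym = ≈-sym ; trans = ≈-trans }
              ; ∙-cong = *-cong
              }
            ; assoc = λ _ _ _ → *-assoc _ _ _
            }
          ; identity = (λ _ → *-identityˡ _) , (λ _ → *-identityʳ _)
          }
        ; inverse = (λ (x , p) → ≈-trans (*-comm _ _) (proj₂ (inverse x p)))
                  , (λ (x , p) → proj₂ (inverse x p))
        ; ⁻¹-cong = λ { {x , p} {y , q} e →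
            inverse-unique e (proj₂ (inverse x p)) (proj₂ (inverse y q)) }
        }
      ; comm = λ _ _ → *-comm _ _
      }
    }

  private module K^× = AbelianGroup unitGroup

  ord : K^×.Carrier → ℤ
  ord (x , x≉0) = proj₁ (v-finite x≉0)

  v≡ord : ∀ u → v (proj₁ u) ≡ [ ord u ]
  v≡ord (x , x≉0) = proj₂ (v-finite x≉0)

  private
    ord-unique : ∀ u {n} → v (proj₁ u) ≡ [ n ] → ord u ≡ n
    ord-unique u e = just-injective (≡.trans (≡.sym (v≡ord u)) e)

    ord-∙ : ∀ u w → ord (u K^×.∙ w) ≡ ord u ℤ.+ ord w
    ord-∙ u w = ord-unique (u K^×.∙ w)
      (≡.trans (v-* (proj₁ u) (proj₁ w)) (≡.cong₂ _+∞_ (v≡ord u) (v≡ord w)))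

    ord-cong : ∀ {u w} → u K^×.≈ w → ord u ≡ ord w
    ord-cong {u} {w} e = ord-unique u (≡.trans (v-cong e) (v≡ord w))

    ord-ε : ord K^×.ε ≡ 0ℤ
    ord-ε = ord-unique K^×.ε v1

  ord-isGroupHomomorphism :
    IsGroupHomomorphism K^×.rawGroup (AbelianGroup.rawGroup ℤ.+-0-abelianGroup) ord
  ord-isGroupHomomorphism = record
    { isMonoidHomomorphism = record
      { isMagmaHomomorphism = record
        { isRelHomomorphism = record { cong = λ {u} {w} → ord-cong {u} {w} }
        ; homo = ord-∙
        }
      ; ε-homo = ord-ε
      }
    ; ⁻¹-homo = λ u → AbelianGroup.uniqueˡ-⁻¹ ℤ.+-0-abelianGroup _ _
        (≡.trans (≡.sym (ord-∙ (u K^×.⁻¹) u))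
          (≡.trans (ord-cong {(u K^×.⁻¹) K^×.∙ u} {K^×.ε} (K^×.inverseˡ u)) ord-ε))
    }

  module _ (e : ℕ) where

    K^×/K^×ᵉ : AbelianGroup (c ⊔ ℓ) (c ⊔ ℓ)
    K^×/K^×ᵉ = unitGroup /powers e

    w̄ : AbelianGroup.Carrier K^×/K^×ᵉ → AbelianGroup.Carrier (ℤ/ e ℤ)
    w̄ = ord

    w̄-isGroupHomomorphism : IsGroupHomomorphism
      (AbelianGroup.rawGroup K^×/K^×ᵉ) (AbelianGroup.rawGroup (ℤ/ e ℤ)) w̄
    w̄-isGroupHomomorphism =
      /powers-homomorphism unitGroup ℤ.+-0-abelianGroup e ord-isGroupHomomorphism

    -- w̄ is well defined modulo e-th powers and a homomorphism by the lemma
    -- above; only its restriction being bijective is a genuine condition.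
    record RamifiedLine : Set (suc (c ⊔ ℓ)) where
      field
        subgroup       : Subgroup K^×/K^×ᵉ (c ⊔ ℓ)
      open Subgroup subgroup public
      field
        w̄-isomorphism  : IsGroupIsomorphism memberGroup
                           (AbelianGroup.rawGroup (ℤ/ e ℤ)) (w̄ ∘ proj₁)

    ramifiedLines : Setoid (suc (c ⊔ ℓ)) (c ⊔ ℓ)
    ramifiedLines = record
      { Carrier       = RamifiedLine
      ; _≈_           = _≐_ on RamifiedLine.Member
      ; isEquivalence = On.isEquivalence RamifiedLine.Member ≐-isEquivalence
      }

    record UniformiserIn (D : RamifiedLine) : Set (c ⊔ ℓ) where
      field
        π       : K^×.Carrier
        v-π     : v (proj₁ π) ≡ [ 1ℤ ]
        π∈D     : π ∈ RamifiedLine.Member D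

    -- Every ramified line contains the class of a uniformiser, so that
    -- quantifying over UniformiserIn D is never vacuous.
    uniformiserIn : ∀ D → UniformiserIn D
    uniformiserIn D = record
      { π   = x K^×.∙ tᵉ
      ; v-π = ≡.trans (v≡ord (x K^×.∙ tᵉ)) (≡.cong [_] ord-π)
      ; π∈D = RamifiedLine.resp D (K.sym {x K^×.∙ tᵉ} {x} (t , K^×.refl {x K^×.∙ tᵉ})) x∈D
      }
      where
      module K = AbelianGroup K^×/K^×ᵉ
      open RawMonoidDefs K^×.rawMonoid using () renaming (_×_ to _·K_)
      open RawMonoidDefs (AbelianGroup.rawMonoid ℤ.+-0-abelianGroup) using ()
        renaming (_×_ to _·Z_)
      open CMonMult (AbelianGroup.commutativeMonoid ℤ.+-0-abelianGroup)
        using (×-distrib-+)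
      hit = IsGroupIsomorphism.surjective (RamifiedLine.w̄-isomorphism D) 1ℤ
      x   = proj₁ (proj₁ hit)
      x∈D = proj₂ (proj₁ hit)
      ord-x : AbelianGroup._≈_ (ℤ/ e ℤ) (ord x) 1ℤ
      ord-x = proj₂ hit {proj₁ hit} (K.refl {x})
      k = proj₁ ord-x
      t₀ = onto (ℤ.- k)
      t : K^×.Carrier
      t = proj₁ t₀ , v≡[]⇒≉0 (proj₂ t₀)
      tᵉ = e ·K t
      ord-power : ∀ m → ord (m ·K t) ≡ m ·Z (ord t)
      ord-power zero      = ord-ε
      ord-power (ℕ.suc m) = ≡.trans (ord-∙ t (m ·K t)) (≡.cong (λ z → ord t ℤ.+ z) (ord-power m))
      ·Z-0 : ∀ m → m ·Z 0ℤ ≡ 0ℤ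
      ·Z-0 zero      = refl
      ·Z-0 (ℕ.suc m) = ≡.trans (ℤ.+-identityˡ _) (·Z-0 m)
      ord-π : ord (x K^×.∙ tᵉ) ≡ 1ℤ
      ord-π = begin
        ord (x K^×.∙ tᵉ)                         ≡⟨ ord-∙ x tᵉ ⟩
        ord x ℤ.+ ord tᵉ                         ≡⟨ ≡.cong₂ ℤ._+_ (proj₂ ord-x) (ord-power e) ⟩
        1ℤ ℤ.+ (e ·Z k) ℤ.+ (e ·Z ord t)         ≡⟨ ℤ.+-assoc 1ℤ (e ·Z k) _ ⟩
        1ℤ ℤ.+ ((e ·Z k) ℤ.+ (e ·Z ord t))       ≡⟨ ≡.cong (λ z → 1ℤ ℤ.+ z) (×-distrib-+ k (ord t) e) ⟨
        1ℤ ℤ.+ (e ·Z (k ℤ.+ ord t))              ≡⟨ ≡.cong (λ z → 1ℤ ℤ.+ (e ·Z (k ℤ.+ z))) (ord-unique t (proj₂ t₀)) ⟩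
        1ℤ ℤ.+ (e ·Z (k ℤ.+ ℤ.- k))              ≡⟨ ≡.cong (λ z → 1ℤ ℤ.+ (e ·Z z)) (ℤ.+-inverseʳ k) ⟩
        1ℤ ℤ.+ (e ·Z 0ℤ)                         ≡⟨ ≡.cong (λ z → 1ℤ ℤ.+ z) (·Z-0 e) ⟩
        1ℤ                                       ∎
        where open ≡.≡-Reasoning

    radicalAlgebra : Carrier → Algebra ring c (c ⊔ ℓ)
    radicalAlgebra x = adjoinRoot ((T ^ e) ⊕ (⊖ const x))
      where open Polynomial ring

    -- For normalised v and w, w ∘ ι ≡ n · v says that w extends v up to
    -- equivalence and that v has index n in the value group of w.
    HasRamificationIndex : ∀ {a b} → Algebra ring a b → ℕ → Set (c ⊔ a ⊔ b)
    HasRamificationIndex L n = Σ[ w ∈ DiscreteValuation (Algebra.ring L) ]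
      ∀ x → DiscreteValuation.v w (Algebra.ι L x) ≡ Maybe.map (+ n ℤ.*_) (v x)

    -- Totally ramified: the ramification index equals the degree.
    record TotallyRamifiedExtension : Set (suc (c ⊔ ℓ)) where
      field
        algebra         : Algebra ring c (c ⊔ ℓ)
        algebra-isField : IsField (Algebra.ring algebra)
        separable       : Polynomial.IsSeparable ring algebra
        degree          : HasDegree algebra e
        ramification    : HasRamificationIndex algebra e

    totallyRamifiedExtensions : Setoid (suc (c ⊔ ℓ)) (c ⊔ ℓ)
    totallyRamifiedExtensions = record
      { Carrier       = TotallyRamifiedExtension
      ; _≈_           = _≅_ on TotallyRamifiedExtension.algebra
      ; isEquivalence = record { refl = ≅-refl ; sym = ≅-sym ; trans = ≅-trans }
      }

record LocalField c ℓ : Set (suc (c ⊔ ℓ)) where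
  field
    valuedField    : DiscretelyValuedField c ℓ
    complete       : IsComplete valuedField
    residue-finite : ∃[ q ] HasCardinality (CommutativeRing.setoid (residueField valuedField)) q

{-# OPTIONS --safe #-}
-- A totally ramified extension L of degree e has the residue field of K, so for uniformisers λ of L and π₀ of K
-- one has λ^e = π₀ c z with c a unit of K and z a 1-unit of L.  As e is a unit, Newton iteration makes z an e-th
-- power, and L = K(μ) with μ^e = π for the uniformiser π = π₀ c; here L is complete because the coordinates of
-- its elements in the basis μ^i are controlled by the valuation.  If L contains e-th roots of two uniformisers
-- of K, then up to an element of K their quotient is a 1-unit of L whose e-th power lies in K, hence is an e-th
-- power in K; so L determines π modulo K^×ᵉ, that is, a ramified line.
-- Conversely w(Σ xᵢ Tⁱ) = min (e v(xᵢ) + i) is a valuation on K[T]/(T^e - π).  The degree d of an element x divides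
-- e, because K[x] has a basis of elements whose valuations form a subgroup of ℤ/e; as d is then nonzero in K,
-- the derivative of the minimal polynomial of x is nonzero, and x is separable.
-- Two uniformisers agree modulo K^×ᵉ if and only if the residue of their quotient is an e-th power, and the e-th
-- powers have index gcd(q - 1, e) in the units of the residue field.
module Submission where

open import Defs
open import Level using (_⊔_)
open import Algebra.Bundles using (CommutativeRing; AbelianGroup)
open import Algebra.Morphism.Structures
  using (IsGroupHomomorphism; IsGroupIsomorphism; IsRingIsomorphism)
open import Algebra.Morphism.Bundles using (RingHomomorphism)
import Algebra.Construct.NaturalChoice.Min as Min
open import Algebra.Definitions.RawMagma using () renaming (_,_ to _,ᵈ_)
import Algebra.Definitions.RawMonoid as RawMonoidDefs
import Algebra.Properties.AbelianGroup as AbelianGroupProps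
import Algebra.Properties.CommutativeMonoid.Mult as CMonMult
import Algebra.Properties.CommutativeMonoid.Sum as CMonSum
import Algebra.Properties.CommutativeSemiring.Exp as CommExp
import Algebra.Properties.Ring as RingProps
import Algebra.Properties.Semiring.Exp as Exp
import Algebra.Properties.Semiring.Mult as Mult
import Algebra.Properties.Semiring.Sum as Sum
open import Algebra.Solver.Ring.AlmostCommutativeRing
  using (fromCommutativeRing; _-Raw-AlmostCommutative⟶_)
import Algebra.Solver.Ring as RingSolver
open import Data.Empty using (⊥; ⊥-elim)
open import Data.Fin.Base as Fin using (Fin; zero; suc; toℕ; fromℕ<; punchIn; punchOut)
import Data.Fin.Permutation as Perm
import Data.Fin.Properties as Fin
import Data.Fin.Relation.Unary.Top as Top
open import Data.Integer.Base as ℤ using (ℤ; 0ℤ; 1ℤ; +_; -[1+_])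
import Data.Integer.DivMod as ℤ
import Data.Integer.Properties as ℤ
import Data.Integer.Solver as ℤSolver
open import Data.List.Base using ([]; _∷_)
open import Data.Maybe.Base as Maybe using (Maybe; just; nothing)
open import Data.Nat.Base as ℕ using (ℕ; zero; suc; _<_; _∸_)
import Data.Nat.Divisibility as ℕ
import Data.Nat.DivMod as ℕ
import Data.Nat.GCD as ℕ
import Data.Nat.Properties as ℕ
import Data.Nat.Solver as ℕSolver
open import Data.Nat.GCD using (gcd)
open import Data.Product using (Σ; ∃; ∃-syntax; _×_; _,_; proj₁; proj₂)
open import Data.Sum.Base using (_⊎_; inj₁; inj₂)
open import Data.Vec.Base as Vec using (Vec; []; _∷_)
open import Data.Vec.Functional as Vector using (Vector)
import Data.Vec.Functional.Properties as VecF
open import Function.Base using (_∘_)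
open import Function.Bundles using (Bijection; Equivalence; mk⇔)
open import Relation.Binary.Bundles using (TotalOrder)
import Relation.Binary.Reasoning.Setoid as SetoidReasoning
open import Relation.Binary.Construct.Add.Supremum.NonStrict ℤ._≤_ using ([_]; _≤⊤⁺)
open import Relation.Binary.PropositionalEquality as ≡ using (_≡_; refl)
open import Relation.Binary.Definitions using (tri<; tri≈; tri>)
open import Relation.Nullary using (¬_; Dec; yes; no)
open import Relation.Unary using (_≐_)
open import Relation.Nullary.Decidable using (map′; decidable-stable; ¬?)
open import Relation.Nullary.Construct.Add.Supremum using (⊤⁺) renaming ([_] to fin)

-- Neither an integral closure nor the residue field of L is formed. What is needed about them
-- follows from one principle: terms whose values differ modulo e cannot cancel. It makes every
-- family with values in distinct classes modulo e independent, and a dimension count then yields a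
-- basis. It also makes the minimum formula on K[T]/(T^e - π) multiplicative, because a single term
-- is leading. The arguments are constructive. Equality with 0 is decidable through the valuation,
-- so linear dependence and minimal polynomials are computed; but which values occur on K[x] is not
-- decided, and the least positive one is used only under a double negation, in front of the
-- decidable claim that d divides e. Isomorphisms are compared through e-th roots of uniformisers:
-- an extension contains such roots for exactly one class of uniformisers modulo K^×ᵉ, and it is the
-- radical extension of each member of that class. Both the bijection and the count rest on this.
-- The count uses, in place of a generator of the units of the residue field, only that x^n = 1 has
-- at most n solutions.

-- Normalisation of ring expressions with integer coefficients.

module IntegerCoefficientSolver {c ℓ} (R : CommutativeRing c ℓ) where
  open CommutativeRing R hiding (zero) renaming (refl to ≈-refl; sym to ≈-sym; trans to ≈-trans)
  open RingProps ring
  open Mult semiring using (×1-homo-*; ×-homo-+) renaming (_×_ to _·_)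
  open SetoidReasoning setoid

  fromℤ : ℤ → Carrier
  fromℤ (+ n)    = n · 1#
  fromℤ -[1+ n ] = - (suc n · 1#)

  private
    fromℤ-⊖ : ∀ m n → fromℤ (m ℤ.⊖ n) ≈ m · 1# - n · 1#
    fromℤ-⊖ m       zero    = ≈-sym (≈-trans (+-congˡ -0#≈0#) (+-identityʳ _))
    fromℤ-⊖ zero    (suc n) = ≈-sym (+-identityˡ _)
    fromℤ-⊖ (suc m) (suc n) = begin
      fromℤ (suc m ℤ.⊖ suc n)   ≡⟨ ≡.cong fromℤ (ℤ.[1+m]⊖[1+n]≡m⊖n m n) ⟩
      fromℤ (m ℤ.⊖ n)   ≈⟨ fromℤ-⊖ m n ⟩
      m · 1# - n · 1#   ≈⟨ +-congʳ (+-identityˡ _) ⟨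
      0# + m · 1# - n · 1#   ≈⟨ +-congʳ (+-congʳ (-‿inverseʳ 1#)) ⟨
      1# - 1# + m · 1# - n · 1#   ≈⟨ +-congʳ (+-assoc _ _ _) ⟩
      1# + (- 1# + m · 1#) - n · 1#   ≈⟨ +-congʳ (+-congˡ (+-comm _ _)) ⟩
      1# + (m · 1# - 1#) - n · 1#   ≈⟨ +-congʳ (+-assoc _ _ _) ⟨
      1# + m · 1# - 1# - n · 1#   ≈⟨ +-assoc _ _ _ ⟩
      1# + m · 1# + (- 1# - n · 1#)   ≈⟨ +-congˡ (-‿+-comm _ _) ⟩
      suc m · 1# - suc n · 1#   ∎

    fromℤ-+ : ∀ i j → fromℤ (i ℤ.+ j) ≈ fromℤ i + fromℤ j
    fromℤ-+ (+ m)    (+ n)    = ×-homo-+ 1# m n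
    fromℤ-+ (+ m)    -[1+ n ] = fromℤ-⊖ m (suc n)
    fromℤ-+ -[1+ m ] (+ n)    = ≈-trans (fromℤ-⊖ n (suc m)) (+-comm _ _)
    fromℤ-+ -[1+ m ] -[1+ n ] = begin
      - (suc (suc (m ℕ.+ n)) · 1#)     ≡⟨ ≡.cong (λ k → - (suc k · 1#)) (ℕ.+-suc m n) ⟨
      - ((suc m ℕ.+ suc n) · 1#)   ≈⟨ -‿cong (×-homo-+ 1# (suc m) (suc n)) ⟩
      - (suc m · 1# + suc n · 1#)      ≈⟨ -‿+-comm _ _ ⟨
      - (suc m · 1#) - suc n · 1#      ∎

    fromℤ-neg : ∀ i → fromℤ (ℤ.- i) ≈ - fromℤ i
    fromℤ-neg (+ zero)  = ≈-sym -0#≈0#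
    fromℤ-neg (+ suc n) = ≈-refl
    fromℤ-neg -[1+ n ]  = ≈-sym (-‿involutive _)

    fromℤ-*ℕ : ∀ m j → fromℤ (+ m ℤ.* j) ≈ m · 1# * fromℤ j
    fromℤ-*ℕ m (+ n)    = ≈-trans (reflexive (≡.cong fromℤ (≡.sym (ℤ.pos-* m n)))) (×1-homo-* m n)
    fromℤ-*ℕ m -[1+ n ] = begin
      fromℤ (+ m ℤ.* -[1+ n ])      ≡⟨ ≡.cong fromℤ (ℤ.neg-distribʳ-* (+ m) (+ suc n)) ⟨
      fromℤ (ℤ.- (+ m ℤ.* + suc n)) ≈⟨ fromℤ-neg (+ m ℤ.* + suc n) ⟩
      - fromℤ (+ m ℤ.* + suc n)     ≈⟨ -‿cong (fromℤ-*ℕ m (+ suc n)) ⟩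
      - (m · 1# * suc n · 1#)   ≈⟨ -‿distribʳ-* _ _ ⟩
      m · 1# * - (suc n · 1#)   ∎

    fromℤ-* : ∀ i j → fromℤ (i ℤ.* j) ≈ fromℤ i * fromℤ j
    fromℤ-* (+ m)    j = fromℤ-*ℕ m j
    fromℤ-* -[1+ m ] j = begin
      fromℤ (-[1+ m ] ℤ.* j)   ≡⟨ ≡.cong fromℤ (ℤ.neg-distribˡ-* (+ suc m) j) ⟨
      fromℤ (ℤ.- (+ suc m ℤ.* j))   ≈⟨ fromℤ-neg (+ suc m ℤ.* j) ⟩
      - fromℤ (+ suc m ℤ.* j)   ≈⟨ -‿cong (fromℤ-*ℕ (suc m) j) ⟩
      - (suc m · 1# * fromℤ j)      ≈⟨ -‿distribˡ-* _ _ ⟩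
      - (suc m · 1#) * fromℤ j      ∎

    morphism : ℤ.+-*-rawRing -Raw-AlmostCommutative⟶ fromCommutativeRing R
    morphism = record
      { ⟦_⟧ = fromℤ ; +-homo = fromℤ-+ ; *-homo = fromℤ-* ; -‿homo = fromℤ-neg
      ; 0-homo = ≈-refl ; 1-homo = +-identityʳ 1# }

    -- A failed comparison is no refutation: in positive characteristic distinct integers may have
    -- the same image.
    equal? : ∀ i j → Maybe (fromℤ i ≈ fromℤ j)
    equal? i j with i ℤ.≟ j
    ... | yes i≡j = just (reflexive (≡.cong fromℤ i≡j))
    ... | no  _   = nothing

  open RingSolver ℤ.+-*-rawRing (fromCommutativeRing R) morphism equal? public
    using (solve; _:=_; _:+_; _:*_; :-_; _:-_)

-- Gaussian elimination.

module LinearAlgebra {c ℓ} (R : CommutativeRing c ℓ) (isField : IsField R)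
  (zero? : ∀ x → Dec (CommutativeRing._≈_ R x (CommutativeRing.0# R))) where
  open CommutativeRing R hiding (zero) renaming (refl to ≈-refl; sym to ≈-sym; trans to ≈-trans)
  open IsField isField
  open Sum semiring using (sum; sum-cong-≋; sum-remove; ∑-distrib-+; *-distribʳ-sum; sum-replicate-zero)
  open IntegerCoefficientSolver R
  open SetoidReasoning setoid

  Dependent Independent : ∀ {n N} → (Fin n → Fin N → Carrier) → Set (c ⊔ ℓ)
  Dependent {n} M   = Σ (Vector Carrier n) λ k →
    (∃[ i ] ¬ k i ≈ 0#) × ∀ j → sum (λ i → k i * M i j) ≈ 0#
  Independent {n} M = ∀ (k : Vector Carrier n) →
    (∀ j → sum (λ i → k i * M i j) ≈ 0#) → ∀ i → k i ≈ 0#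

  -- Elimination along the first column: a zero column is dropped, otherwise a pivot row clears it
  -- and one row and one column disappear. Both outcomes carry data that is used later: the explicit
  -- relation yields minimal polynomials, the bound n ≤ N yields comparisons of dimensions.
  gauss : ∀ N n (M : Fin n → Fin N → Carrier) → Dependent M ⊎ (n ℕ.≤ N × Independent M)
  gauss zero    zero    M = inj₂ (ℕ.z≤n , λ _ _ ())
  gauss zero    (suc n) M = inj₁ ((λ _ → 1#) , (zero , 1≉0) , λ ())
  gauss (suc N) n       M with Fin.all? (λ i → zero? (M i zero))
  ... | yes col≈0 with gauss N n (λ i j → M i (suc j))
  ...   | inj₁ (k , k≉0 , rel) = inj₁ (k , k≉0 , λ
          { zero    → ≈-trans (sum-cong-≋ λ i → ≈-trans (*-congˡ (col≈0 i)) (zeroʳ (k i))) (sum-replicate-zero n)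
          ; (suc j) → rel j })
  ...   | inj₂ (n≤N , ind) = inj₂ (ℕ.m≤n⇒m≤1+n n≤N , λ k rel → ind k (λ j → rel (suc j)))
  gauss (suc N) zero    M | no ¬col≈0 = ⊥-elim (¬col≈0 λ ())
  gauss (suc N) (suc n) M | no ¬col≈0 = conclude (gauss N n M′)
    where
    pivot = Fin.¬∀⟶∃¬ (suc n) _ (λ i → zero? (M i zero)) ¬col≈0
    p   = proj₁ pivot
    a   = M p zero
    a⁻¹ = proj₁ (inverse a (proj₂ pivot))
    aa⁻¹≈1 = proj₂ (inverse a (proj₂ pivot))
    M₋ : Fin n → Fin (suc N) → Carrier
    M₋ i j = M (punchIn p i) j
    M′ : Fin n → Fin N → Carrier
    M′ i j = M₋ i (suc j) - M₋ i zero * a⁻¹ * M p (suc j)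
    A : Vector Carrier n → Fin (suc N) → Carrier
    A k j = sum (λ i → k i * M₋ i j)
    eliminated : ∀ k j → sum (λ i → k i * M′ i j) ≈ A k (suc j) - A k zero * (a⁻¹ * M p (suc j))
    eliminated k j = begin
      sum (λ i → k i * M′ i j)
        ≈⟨ sum-cong-≋ (λ i → solve 5 (λ k x y b m → k :* (x :- y :* b :* m) := k :* x :+ k :* y :* (:- (b :* m)))
             ≈-refl (k i) (M₋ i (suc j)) (M₋ i zero) a⁻¹ (M p (suc j))) ⟩
      sum (λ i → k i * M₋ i (suc j) + k i * M₋ i zero * (- (a⁻¹ * M p (suc j))))
        ≈⟨ ∑-distrib-+ (λ i → k i * M₋ i (suc j)) _ ⟩
      A k (suc j) + sum (λ i → k i * M₋ i zero * (- (a⁻¹ * M p (suc j))))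
        ≈⟨ +-congˡ (≈-sym (*-distribʳ-sum (- (a⁻¹ * M p (suc j))) (λ i → k i * M₋ i zero))) ⟩
      A k (suc j) + A k zero * (- (a⁻¹ * M p (suc j)))
        ≈⟨ solve 3 (λ x y b → x :+ y :* (:- b) := x :- y :* b) ≈-refl (A k (suc j)) (A k zero) (a⁻¹ * M p (suc j)) ⟩
      A k (suc j) - A k zero * (a⁻¹ * M p (suc j)) ∎
    expand : ∀ k j → sum (λ i → k i * M i j) ≈ k p * M p j + A (k ∘ punchIn p) j
    expand k j = sum-remove (λ i → k i * M i j)
    conclude : Dependent M′ ⊎ (n ℕ.≤ N × Independent M′) → Dependent M ⊎ (suc n ℕ.≤ suc N × Independent M)
    conclude (inj₁ (k′ , (i , k′ᵢ≉0) , rel)) = inj₁ (k , (punchIn p i , k≉0) , λ j → ≈-trans (split j) (vanish j))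
      where
      -- The coefficient of the pivot row is forced by the first column, x a + A k′ zero = 0.
      x = - (A k′ zero * a⁻¹)
      k = Vector.insertAt k′ p x
      k≉0 : ¬ k (punchIn p i) ≈ 0#
      k≉0 e = k′ᵢ≉0 (≈-trans (reflexive (≡.sym (VecF.insertAt-punchIn k′ p x i))) e)
      split : ∀ j → sum (λ i → k i * M i j) ≈ x * M p j + A k′ j
      split j = ≈-trans (expand k j) (+-cong (*-congʳ (reflexive (VecF.insertAt-lookup k′ p x)))
        (sum-cong-≋ λ i → *-congʳ (reflexive (VecF.insertAt-punchIn k′ p x i))))
      vanish : ∀ j → x * M p j + A k′ j ≈ 0#
      vanish zero = begin
        x * a + A k′ zero
          ≈⟨ solve 3 (λ y b a → (:- (y :* b)) :* a :+ y := y :* (:- (a :* b)) :+ y) ≈-refl (A k′ zero) a⁻¹ a ⟩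
        A k′ zero * (- (a * a⁻¹)) + A k′ zero ≈⟨ +-congʳ (*-congˡ (-‿cong aa⁻¹≈1)) ⟩
        A k′ zero * (- 1#) + A k′ zero ≈⟨ +-congˡ (*-identityʳ _) ⟨
        A k′ zero * (- 1#) + A k′ zero * 1# ≈⟨ distribˡ _ _ _ ⟨
        A k′ zero * (- 1# + 1#) ≈⟨ *-congˡ (-‿inverseˡ 1#) ⟩
        A k′ zero * 0# ≈⟨ zeroʳ _ ⟩
        0# ∎
      vanish (suc j) = begin
        x * M p (suc j) + A k′ (suc j)
          ≈⟨ solve 4 (λ y b m z → (:- (y :* b)) :* m :+ z := z :- y :* (b :* m)) ≈-refl (A k′ zero) a⁻¹ (M p (suc j)) (A k′ (suc j)) ⟩
        A k′ (suc j) - A k′ zero * (a⁻¹ * M p (suc j)) ≈⟨ eliminated k′ j ⟨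
        sum (λ i → k′ i * M′ i j) ≈⟨ rel j ⟩
        0# ∎
    conclude (inj₂ (n≤N , ind)) = inj₂ (ℕ.s≤s n≤N , independent)
      where
      independent : Independent M
      independent k rel = λ i → vanish i (i Fin.≟ p)
        where
        k′ = k ∘ punchIn p
        rel′ : ∀ j → k p * M p j + A k′ j ≈ 0#
        rel′ j = ≈-trans (≈-sym (expand k j)) (rel j)
        A₀ : A k′ zero ≈ - (k p * a)
        A₀ = ≈-trans (solve 2 (λ x y → x := (y :+ x) :- y) ≈-refl (A k′ zero) (k p * a))
               (≈-trans (+-congʳ (rel′ zero)) (+-identityˡ _))
        k′≈0 : ∀ i → k′ i ≈ 0#
        k′≈0 = ind k′ λ j → begin
          sum (λ i → k′ i * M′ i j) ≈⟨ eliminated k′ j ⟩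
          A k′ (suc j) - A k′ zero * (a⁻¹ * M p (suc j)) ≈⟨ +-congˡ (-‿cong (*-congʳ A₀)) ⟩
          A k′ (suc j) - (- (k p * a)) * (a⁻¹ * M p (suc j))
            ≈⟨ solve 5 (λ z k a b m → z :- (:- (k :* a)) :* (b :* m) := z :+ k :* m :* (a :* b)) ≈-refl (A k′ (suc j)) (k p) a a⁻¹ (M p (suc j)) ⟩
          A k′ (suc j) + k p * M p (suc j) * (a * a⁻¹) ≈⟨ +-congˡ (≈-trans (*-congˡ aa⁻¹≈1) (*-identityʳ _)) ⟩
          A k′ (suc j) + k p * M p (suc j) ≈⟨ +-comm _ _ ⟩
          k p * M p (suc j) + A k′ (suc j) ≈⟨ rel′ (suc j) ⟩
          0# ∎
        kₚa≈0 : k p * a ≈ 0#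
        kₚa≈0 = begin
          k p * a ≈⟨ +-identityʳ _ ⟨
          k p * a + 0# ≈⟨ +-congˡ (sum-replicate-zero n) ⟨
          k p * a + sum {n} (λ _ → 0#) ≈⟨ +-congˡ (sum-cong-≋ λ i → ≈-trans (*-congʳ (k′≈0 i)) (zeroˡ _)) ⟨
          k p * a + A k′ zero ≈⟨ rel′ zero ⟩
          0# ∎
        kₚ≈0 : k p ≈ 0#
        kₚ≈0 = begin
          k p ≈⟨ ≈-trans (*-congˡ aa⁻¹≈1) (*-identityʳ _) ⟨
          k p * (a * a⁻¹) ≈⟨ *-assoc _ _ _ ⟨
          k p * a * a⁻¹ ≈⟨ *-congʳ kₚa≈0 ⟩
          0# * a⁻¹ ≈⟨ zeroˡ _ ⟩
          0# ∎
        vanish : ∀ i → Dec (i ≡ p) → k i ≈ 0#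
        vanish i (yes refl) = kₚ≈0
        vanish i (no i≢p)   = ≈-trans (reflexive (≡.cong k (≡.sym (Fin.punchIn-punchOut (i≢p ∘ ≡.sym)))))
                                      (k′≈0 (punchOut (i≢p ∘ ≡.sym)))

-- Arithmetic of ℤ ∪ {∞} and discrete valuations.

module Min∞ = Min ℤ∞-totalOrder
module ≤∞ = TotalOrder ℤ∞-totalOrder

i<1+j⇒i≤j : ∀ {i j} → i ℤ.< 1ℤ ℤ.+ j → i ℤ.≤ j
i<1+j⇒i≤j {i} {j} p = ≡.subst (i ℤ.≤_) (ℤ.pred-suc j) (ℤ.i<j⇒i≤pred[j] p)

fin-injective : ∀ {m n : ℤ} → fin m ≡ fin n → m ≡ n
fin-injective refl = refl

+∞-mono-≤ : ∀ {m n x y} → fin m ≤⁺ x → fin n ≤⁺ y → fin (m ℤ.+ n) ≤⁺ x +∞ y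
+∞-mono-≤ [ p ]     [ q ]     = [ ℤ.+-mono-≤ p q ]
+∞-mono-≤ [ p ]     (_ ≤⊤⁺)   = _ ≤⊤⁺
+∞-mono-≤ (_ ≤⊤⁺)   q         = _ ≤⊤⁺

_≤∞?_ : ∀ m x → Dec (fin m ≤⁺ x)
m ≤∞? fin n = map′ [_] (λ { [ p ] → p }) (m ℤ.≤? n)
m ≤∞? ⊤⁺    = yes (_ ≤⊤⁺)

finite-if-not-≤ : ∀ {m x} → ¬ fin m ≤⁺ x → ∃[ n ] x ≡ fin n × n ℤ.< m
finite-if-not-≤ {m} {fin n} ¬p = n , refl , ℤ.≰⇒> (λ p → ¬p [ p ])
finite-if-not-≤ {m} {⊤⁺}    ¬p = ⊥-elim (¬p (_ ≤⊤⁺))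

-- For x = ∞ and y = n the bound 1 + n holds for x and fails for y. This allows a value, in
-- particular a minimum, to be handled through its finite lower bounds alone.
≤∞-from-below : ∀ {x y} → (∀ n → fin n ≤⁺ x → fin n ≤⁺ y) → x ≤⁺ y
≤∞-from-below {fin m} h = h m ≤∞.refl
≤∞-from-below {⊤⁺} {⊤⁺} h = _ ≤⊤⁺
≤∞-from-below {⊤⁺} {fin n} h with [ p ] ← h (1ℤ ℤ.+ n) (_ ≤⊤⁺) = ⊥-elim (ℤ.<⇒≱ (ℤ.suc[i]≤j⇒i<j ℤ.≤-refl) p)

≤∞-extensional : ∀ {x y} → (∀ n → fin n ≤⁺ x → fin n ≤⁺ y) → (∀ n → fin n ≤⁺ y → fin n ≤⁺ x) → x ≡ y
≤∞-extensional x≤y y≤x = ≤∞.antisym (≤∞-from-below x≤y) (≤∞-from-below y≤x)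

≤∞-exact : ∀ {n x} → fin n ≤⁺ x → ¬ fin (1ℤ ℤ.+ n) ≤⁺ x → x ≡ fin n
≤∞-exact {n} {fin m} [ n≤m ] ¬q = ≡.cong fin (ℤ.≤-antisym (i<1+j⇒i≤j (ℤ.≰⇒> λ q → ¬q [ q ])) n≤m)
≤∞-exact {n} {⊤⁺}    _       ¬q = ⊥-elim (¬q (_ ≤⊤⁺))

1+n≰∞ : ∀ {n x} → x ≡ fin n → ¬ fin (1ℤ ℤ.+ n) ≤⁺ x
1+n≰∞ refl [ p ] = ℤ.<⇒≱ (ℤ.suc[i]≤j⇒i<j ℤ.≤-refl) p

n≤∞ : ∀ {x} → (∀ n → fin n ≤⁺ x) → x ≡ ⊤⁺
n≤∞ h = ≤∞-extensional (λ _ _ → _ ≤⊤⁺) (λ n _ → h n)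

module Valuation {c ℓ} (R : CommutativeRing c ℓ) (V : DiscreteValuation R) where
  open CommutativeRing R hiding (zero) renaming (refl to ≈-refl; sym to ≈-sym; trans to ≈-trans)
  open RingProps ring
  open DiscreteValuation V public
  open Sum semiring using (sum; sum-cong-≋)
  open Exp semiring using (_^_)
  open IntegerCoefficientSolver R

  infix 4 _≤ᵛ_
  _≤ᵛ_ : ℤ → Carrier → Set
  n ≤ᵛ x = fin n ≤⁺ v x

  _≤ᵛ?_ : ∀ n x → Dec (n ≤ᵛ x)
  n ≤ᵛ? x = n ≤∞? v x

  v0 : v 0# ≡ ⊤⁺
  v0 = Equivalence.from (v-∞ 0#) ≈-refl

  v≡∞⇒≈0 : ∀ {x} → v x ≡ ⊤⁺ → x ≈ 0#
  v≡∞⇒≈0 {x} = Equivalence.to (v-∞ x)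

  v≡fin⇒≉0 : ∀ {x n} → v x ≡ fin n → ¬ x ≈ 0#
  v≡fin⇒≉0 {x} e x≈0 with () ← ≡.trans (≡.sym e) (Equivalence.from (v-∞ x) x≈0)

  v-finite : ∀ {x} → ¬ x ≈ 0# → ∃[ n ] v x ≡ fin n
  v-finite {x} x≉0 with v x in eq
  ... | fin n = n , refl
  ... | ⊤⁺    = ⊥-elim (x≉0 (v≡∞⇒≈0 eq))

  zero? : ∀ x → Dec (x ≈ 0#)
  zero? x with v x in eq
  ... | fin n = no (v≡fin⇒≉0 eq)
  ... | ⊤⁺    = yes (v≡∞⇒≈0 eq)

  ≤ᵛ-resp : ∀ {n x y} → x ≈ y → n ≤ᵛ x → n ≤ᵛ y
  ≤ᵛ-resp x≈y p = ≤∞.trans p (≤∞.reflexive (v-cong x≈y))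

  ≤ᵛ-respˡ : ∀ {m n x} → m ≡ n → m ≤ᵛ x → n ≤ᵛ x
  ≤ᵛ-respˡ refl p = p

  ≤ᵛ-weaken : ∀ {m n x} → m ℤ.≤ n → n ≤ᵛ x → m ≤ᵛ x
  ≤ᵛ-weaken m≤n = ≤∞.trans [ m≤n ]

  v≡⇒≤ᵛ : ∀ {n x} → v x ≡ fin n → n ≤ᵛ x
  v≡⇒≤ᵛ e = ≤∞.reflexive (≡.sym e)

  ≤ᵛ⇒≤ : ∀ {m n x} → v x ≡ fin n → m ≤ᵛ x → m ℤ.≤ n
  ≤ᵛ⇒≤ {x = x} e p with v x
  ≤ᵛ⇒≤ refl [ p ] | fin _ = p

  ≤ᵛ-0 : ∀ {n x} → x ≈ 0# → n ≤ᵛ x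
  ≤ᵛ-0 x≈0 = ≤∞.trans (_ ≤⊤⁺) (≤∞.reflexive (≡.sym (≡.trans (v-cong x≈0) v0)))

  ≤ᵛ-all⇒≈0 : ∀ {x} → (∀ n → n ≤ᵛ x) → x ≈ 0#
  ≤ᵛ-all⇒≈0 h = v≡∞⇒≈0 (n≤∞ h)

  ≤ᵛ-exact : ∀ {n x} → n ≤ᵛ x → ¬ (1ℤ ℤ.+ n) ≤ᵛ x → v x ≡ fin n
  ≤ᵛ-exact = ≤∞-exact

  1+n≰ᵛ : ∀ {n x} → v x ≡ fin n → ¬ (1ℤ ℤ.+ n) ≤ᵛ x
  1+n≰ᵛ = 1+n≰∞

  ≤ᵛ-* : ∀ {m n x y} → m ≤ᵛ x → n ≤ᵛ y → (m ℤ.+ n) ≤ᵛ x * y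
  ≤ᵛ-* {x = x} {y} p q = ≤∞.trans (+∞-mono-≤ p q) (≤∞.reflexive (≡.sym (v-* x y)))

  ≤ᵛ-+ : ∀ {n x y} → n ≤ᵛ x → n ≤ᵛ y → n ≤ᵛ x + y
  ≤ᵛ-+ {x = x} {y} p q = ≤∞.trans (Min∞.⊓-glb p q) (v-+ x y)

  v≡* : ∀ {m n x y} → v x ≡ fin m → v y ≡ fin n → v (x * y) ≡ fin (m ℤ.+ n)
  v≡* {x = x} {y} p q = ≡.trans (v-* x y) (≡.cong₂ _+∞_ p q)

  -- Surjectivity of the value map excludes the zero ring, where every value is ∞. `TameAlgebra`
  -- starts from this when it builds a field structure out of a valuation.
  1≉0 : ¬ 1# ≈ 0#
  1≉0 1≈0 with x , vx≡0 ← onto 0ℤ =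
    v≡fin⇒≉0 vx≡0 (≈-trans (≈-sym (*-identityʳ x)) (≈-trans (*-congˡ 1≈0) (zeroʳ x)))

  private
    -- Serves 1 and -1 alike: v(1) = v(1) + v(1) gives v(1) = 0, and then 2 v(x) = 0 in ℤ.
    involution⇒v≡0 : ∀ {x} → ¬ x ≈ 0# → x * x ≈ 1# → v x ≡ fin 0ℤ
    involution⇒v≡0 {x} x≉0 xx≈1 with n , e ← v-finite x≉0 | k , e₁ ← v-finite 1≉0 =
      ≡.trans e (≡.cong fin (double n (≡.trans (fin-injective (≡.trans (≡.sym (v≡* e e)) (≡.trans (v-cong xx≈1) e₁))) k≡0)))
      where
      k≡0 : k ≡ 0ℤ
      k≡0 = AbelianGroupProps.∙-cancelˡ ℤ.+-0-abelianGroup k k 0ℤ (≡.trans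
        (fin-injective (≡.trans (≡.sym (v≡* e₁ e₁)) (≡.trans (v-cong (*-identityˡ 1#)) e₁))) (≡.sym (ℤ.+-identityʳ k)))
      double : ∀ n → n ℤ.+ n ≡ 0ℤ → n ≡ 0ℤ
      double (+ zero)  _  = refl
      double (+ suc n) ()
      double -[1+ n ]  ()

  v1 : v 1# ≡ fin 0ℤ
  v1 = involution⇒v≡0 1≉0 (*-identityˡ 1#)

  v-neg : ∀ x → v (- x) ≡ v x
  v-neg x = ≡.trans (v-cong (≈-sym (-1*x≈-x x))) (≡.trans (v-* (- 1#) x) (≡.trans (≡.cong (_+∞ v x) v-1) (0+∞ (v x))))
    where
    -1*-1 : - 1# * - 1# ≈ 1#
    -1*-1 = ≈-trans (-1*x≈-x (- 1#)) (-‿involutive 1#)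
    v-1 : v (- 1#) ≡ fin 0ℤ
    v-1 = involution⇒v≡0 (λ e → 1≉0 (≈-trans (≈-sym -1*-1) (≈-trans (*-congʳ e) (zeroˡ _)))) -1*-1
    0+∞ : ∀ m → fin 0ℤ +∞ m ≡ m
    0+∞ (fin n) = ≡.cong fin (ℤ.+-identityˡ n)
    0+∞ ⊤⁺      = refl

  ≤ᵛ-neg : ∀ {n x} → n ≤ᵛ x → n ≤ᵛ - x
  ≤ᵛ-neg {x = x} = ≡.subst (fin _ ≤⁺_) (≡.sym (v-neg x))

  ≤ᵛ-‿- : ∀ {n x y} → n ≤ᵛ x → n ≤ᵛ y → n ≤ᵛ x - y
  ≤ᵛ-‿- p q = ≤ᵛ-+ p (≤ᵛ-neg q)

  ≤ᵛ-cancelʳ : ∀ {n x y} → n ≤ᵛ x + y → n ≤ᵛ y → n ≤ᵛ x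
  ≤ᵛ-cancelʳ {x = x} {y} p q =
    ≤ᵛ-resp (solve 2 (λ x y → x :+ y :- y := x) ≈-refl x y) (≤ᵛ-‿- p q)

  ≤ᵛ-sum : ∀ {k n} {f : Vector Carrier k} → (∀ i → n ≤ᵛ f i) → n ≤ᵛ sum f
  ≤ᵛ-sum {zero}  h = ≤ᵛ-0 ≈-refl
  ≤ᵛ-sum {suc k} h = ≤ᵛ-+ (h zero) (≤ᵛ-sum (h ∘ suc))

  v-strict : ∀ {n x y} → v x ≡ fin n → (1ℤ ℤ.+ n) ≤ᵛ y → v (x + y) ≡ fin n
  v-strict e p = ≤ᵛ-exact (≤ᵛ-+ (v≡⇒≤ᵛ e) (≤ᵛ-weaken (ℤ.i≤suc[i] _) p)) (λ q → 1+n≰ᵛ e (≤ᵛ-cancelʳ q p))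

  *-≉0 : ∀ {x y} → ¬ x ≈ 0# → ¬ y ≈ 0# → ¬ x * y ≈ 0#
  *-≉0 x≉0 y≉0 = v≡fin⇒≉0 (v≡* (proj₂ (v-finite x≉0)) (proj₂ (v-finite y≉0)))

  xy≈0⇒ : ∀ {x y} → x * y ≈ 0# → x ≈ 0# ⊎ y ≈ 0#
  xy≈0⇒ {x} {y} xy≈0 with zero? x | zero? y
  ... | yes x≈0 | _       = inj₁ x≈0
  ... | no _    | yes y≈0 = inj₂ y≈0
  ... | no x≉0  | no y≉0  = ⊥-elim (*-≉0 x≉0 y≉0 xy≈0)

  v-^ : ∀ {n x} k → v x ≡ fin n → v (x ^ k) ≡ fin (+ k ℤ.* n)
  v-^ {n} zero    e = ≡.trans v1 (≡.cong fin (≡.sym (ℤ.*-zeroˡ n)))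
  v-^ {n} (suc k) e = ≡.trans (v≡* e (v-^ k e)) (≡.cong fin (≡.sym (ℤ.suc-* (+ k) n)))

  module _ {k} (f : Vector Carrier k)
    (distinct : ∀ i j {n} → v (f i) ≡ fin n → v (f j) ≡ fin n → i ≡ j) where

    -- Cancellation needs two terms of equal least value. If the first term had value m < n, the
    -- remaining sum, hence by induction each remaining term, would have value at least m, and by
    -- distinctness at least m + 1; the first term could then not have value m. Distinctness
    -- concerns finite values only, so several terms may be 0.
    sum-orthogonal : ∀ n → n ≤ᵛ sum f → ∀ i → n ≤ᵛ f i
    sum-orthogonal = go f distinct
      where
      go : ∀ {k} (f : Vector Carrier k) → (∀ i j {n} → v (f i) ≡ fin n → v (f j) ≡ fin n → i ≡ j) →
           ∀ n → n ≤ᵛ sum f → ∀ i → n ≤ᵛ f i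
      go {suc k} f distinct n n≤sum with n ≤ᵛ? f zero
      ... | yes n≤f₀ = λ { zero → n≤f₀ ; (suc i) → go (f ∘ suc) (λ i j p q → Fin.suc-injective (distinct _ _ p q)) n
              (≤ᵛ-cancelʳ (≤ᵛ-resp (+-comm _ _) n≤sum) n≤f₀) i }
      ... | no n≰f₀ with m , e , m<n ← finite-if-not-≤ n≰f₀ =
        ⊥-elim (1+n≰ᵛ e (≤ᵛ-cancelʳ (≤ᵛ-weaken (ℤ.i<j⇒suc[i]≤j m<n) n≤sum) (≤ᵛ-sum above)))
        where
        m≤rest : m ≤ᵛ sum (f ∘ suc)
        m≤rest = ≤ᵛ-cancelʳ (≤ᵛ-resp (+-comm _ _) (≤ᵛ-weaken (ℤ.<⇒≤ m<n) n≤sum)) (v≡⇒≤ᵛ e)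
        above : ∀ i → (1ℤ ℤ.+ m) ≤ᵛ f (suc i)
        above i with (1ℤ ℤ.+ m) ≤ᵛ? f (suc i)
        ... | yes p = p
        ... | no ¬p with () ← distinct zero (suc i) e
                (≤ᵛ-exact (go (f ∘ suc) (λ i j p q → Fin.suc-injective (distinct _ _ p q)) m m≤rest i) ¬p)

    sum-attained : ∀ {n} → v (sum f) ≡ fin n → ∃[ i ] v (f i) ≡ fin n
    sum-attained {n} e with Fin.all? (λ i → (1ℤ ℤ.+ n) ≤ᵛ? f i)
    ... | yes h = ⊥-elim (1+n≰ᵛ e (≤ᵛ-sum h))
    ... | no ¬h with i , ¬p ← Fin.¬∀⟶∃¬ k _ (λ i → (1ℤ ℤ.+ n) ≤ᵛ? f i) ¬h =
      i , ≤ᵛ-exact (sum-orthogonal n (v≡⇒≤ᵛ e) i) ¬p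

-- Roots of 1-units in a complete field.

module Hensel {c ℓ} (K : DiscretelyValuedField c ℓ) (complete : IsComplete K) where
  open DiscretelyValuedField K using (ring; inverse)
  open CommutativeRing ring hiding (zero; ring) renaming (refl to ≈-refl; sym to ≈-sym; trans to ≈-trans)
  open Valuation ring (DiscretelyValuedField.valuation K)
  open Exp semiring using (_^_)
  open Mult semiring using () renaming (_×_ to _·_)
  open IntegerCoefficientSolver ring
  open SetoidReasoning setoid

  private
    0≤ᵛ : ∀ n → 0ℤ ≤ᵛ n · 1#
    0≤ᵛ zero    = ≤ᵛ-0 ≈-refl
    0≤ᵛ (suc n) = ≤ᵛ-+ (v≡⇒≤ᵛ v1) (0≤ᵛ n)

    1-unit⇒0≤ᵛ : ∀ {x} → 1ℤ ≤ᵛ x - 1# → 0ℤ ≤ᵛ x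
    1-unit⇒0≤ᵛ {x} p = ≤ᵛ-resp (solve 2 (λ x o → (x :- o) :+ o := x) ≈-refl x 1#)
      (≤ᵛ-+ (≤ᵛ-weaken (ℤ.+≤+ ℕ.z≤n) p) (v≡⇒≤ᵛ v1))

  1-unit-^ : ∀ {x} → 1ℤ ≤ᵛ x - 1# → ∀ n → 1ℤ ≤ᵛ x ^ n - 1#
  1-unit-^     p zero    = ≤ᵛ-0 (-‿inverseʳ 1#)
  1-unit-^ {x} p (suc n) = ≤ᵛ-resp
    (solve 3 (λ x y o → x :* (y :- o) :+ (x :* o :- o) := x :* y :- o) ≈-refl x (x ^ n) 1#)
    (≤ᵛ-+ (≤ᵛ-* (1-unit⇒0≤ᵛ p) (1-unit-^ p n)) (≤ᵛ-resp (+-congʳ (≈-sym (*-identityʳ x))) p))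

  -- The quotient of x^n - y^n by x - y is a sum of n products x^i y^j, each congruent to 1; r
  -- collects the deviation from n. The product form also covers x = y.
  ^-difference : ∀ {x y} → 1ℤ ≤ᵛ x - 1# → 1ℤ ≤ᵛ y - 1# → ∀ n →
                 ∃[ r ] x ^ n - y ^ n ≈ (x - y) * (n · 1# + r) × 1ℤ ≤ᵛ r
  ^-difference {x} {y} p q zero =
    0# , ≈-trans (-‿inverseʳ 1#) (≈-sym (≈-trans (*-congˡ (+-identityʳ 0#)) (zeroʳ _))) , ≤ᵛ-0 ≈-refl
  ^-difference {x} {y} p q (suc n) with r , e , 1≤r ← ^-difference p q n =
    -- This r solves x (n + r′) + y^n = (1 + n) + r, where r′ is the remainder for n.
    (x - 1#) * n · 1# + x * r + (y ^ n - 1#) , eq ,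
    ≤ᵛ-+ (≤ᵛ-+ (≤ᵛ-* p (0≤ᵛ n)) (≤ᵛ-* (1-unit⇒0≤ᵛ p) 1≤r)) (1-unit-^ q n)
    where
    N = n · 1#
    eq : x * x ^ n - y * y ^ n ≈ (x - y) * (1# + N + ((x - 1#) * N + x * r + (y ^ n - 1#)))
    eq = begin
      x * x ^ n - y * y ^ n
        ≈⟨ solve 4 (λ x y X Y → x :* X :- y :* Y := x :* (X :- Y) :+ (x :- y) :* Y) ≈-refl x y (x ^ n) (y ^ n) ⟩
      x * (x ^ n - y ^ n) + (x - y) * y ^ n ≈⟨ +-congʳ (*-congˡ e) ⟩
      x * ((x - y) * (N + r)) + (x - y) * y ^ n
        ≈⟨ solve 5 (λ x y N r Y → x :* ((x :- y) :* (N :+ r)) :+ (x :- y) :* Y :=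
                      (x :- y) :* (x :* N :+ x :* r :+ Y)) ≈-refl x y N r (y ^ n) ⟩
      (x - y) * (x * N + x * r + y ^ n)
        ≈⟨ *-congˡ (solve 5 (λ o x N r Y → x :* N :+ r :+ Y := o :+ N :+ ((x :* N :- N) :+ r :+ (Y :- o)))
             ≈-refl 1# x N (x * r) (y ^ n)) ⟩
      (x - y) * (1# + N + ((x * N - N) + x * r + (y ^ n - 1#)))
        ≈⟨ *-congˡ (+-congˡ (+-congʳ (+-congʳ (≈-trans (+-congˡ (-‿cong (≈-sym (*-identityˡ N))))
             (solve 3 (λ x o N → x :* N :- o :* N := (x :- o) :* N) ≈-refl x 1# N))))) ⟩
      (x - y) * (1# + N + ((x - 1#) * N + x * r + (y ^ n - 1#))) ∎

  ≤ᵛ-^-difference : ∀ {x y k} → 1ℤ ≤ᵛ x - 1# → 1ℤ ≤ᵛ y - 1# → k ≤ᵛ x - y → ∀ n → k ≤ᵛ x ^ n - y ^ n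
  ≤ᵛ-^-difference {k = k} p q k≤ n with r , e , 1≤r ← ^-difference p q n = ≡.subst (_≤ᵛ _) (ℤ.+-identityʳ k)
    (≤ᵛ-resp (≈-sym e) (≤ᵛ-* k≤ (≤ᵛ-+ (0≤ᵛ n) (≤ᵛ-weaken (ℤ.+≤+ ℕ.z≤n) 1≤r))))

  module _ (e : ℕ) (v[e]≡0 : v (e · 1#) ≡ fin 0ℤ) {u : Carrier} (1≤u-1 : 1ℤ ≤ᵛ u - 1#) where
    private
      E   = e · 1#
      E⁻¹ = proj₁ (inverse E (v≡fin⇒≉0 v[e]≡0))
      EE⁻¹≈1 : E * E⁻¹ ≈ 1#
      EE⁻¹≈1 = proj₂ (inverse E (v≡fin⇒≉0 v[e]≡0))

      0≤E⁻¹ : 0ℤ ≤ᵛ E⁻¹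
      0≤E⁻¹ with k , eq ← v-finite {E⁻¹} (λ z → 1≉0 (≈-trans (≈-sym EE⁻¹≈1) (≈-trans (*-congˡ z) (zeroʳ E)))) =
        v≡⇒≤ᵛ (≡.trans eq (≡.cong fin (≡.trans (≡.sym (ℤ.+-identityˡ k))
          (fin-injective (≡.trans (≡.sym (v≡* v[e]≡0 eq)) (≡.trans (v-cong EE⁻¹≈1) v1))))))

      -- Precision k + 1 at stage k lets the iteration start from y = 1, where the error is u - 1.
      Approximation : ℕ → Set c
      Approximation k = ∃[ y ] 1ℤ ≤ᵛ y - 1# × + suc k ≤ᵛ u - y ^ e

      -- The Newton step for T^e - u, with the derivative at y replaced by e.
      newton : Carrier → Carrier
      newton y = y + (u - y ^ e) * E⁻¹

      correction : ∀ {k y} → k ≤ᵛ u - y ^ e → k ≤ᵛ (u - y ^ e) * E⁻¹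
      correction {k} q = ≡.subst (_≤ᵛ _) (ℤ.+-identityʳ k) (≤ᵛ-* q 0≤E⁻¹)

      refine : ∀ {k} → Approximation k → Approximation (suc k)
      refine {k} (y , p , q) = newton y , p′ , q′
        where
        d = u - y ^ e
        p′ : 1ℤ ≤ᵛ newton y - 1#
        p′ = ≤ᵛ-resp (solve 3 (λ y o d → (y :- o) :+ d := (y :+ d) :- o) ≈-refl y 1# (d * E⁻¹))
          (≤ᵛ-+ p (≤ᵛ-weaken (ℤ.+≤+ (ℕ.s≤s ℕ.z≤n)) (correction q)))
        diff = ^-difference p′ p e
        r = proj₁ diff
        -- The linear part d - d E E⁻¹ cancels, and the factor r that is left has value at least 1.
        -- Each step therefore gains one order of precision, which suffices for convergence.
        error : u - newton y ^ e ≈ - (d * E⁻¹ * r)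
        error = begin
          u - newton y ^ e
            ≈⟨ solve 3 (λ u Y Z → u :- Z := (u :- Y) :- (Z :- Y)) ≈-refl u (y ^ e) (newton y ^ e) ⟩
          d - (newton y ^ e - y ^ e) ≈⟨ +-congˡ (-‿cong (proj₁ (proj₂ diff))) ⟩
          d - (newton y - y) * (E + r)
            ≈⟨ solve 5 (λ y d b E r → d :- ((y :+ d :* b) :- y) :* (E :+ r) := d :- d :* (E :* b) :- d :* b :* r)
                 ≈-refl y d E⁻¹ E r ⟩
          d - d * (E * E⁻¹) - d * E⁻¹ * r ≈⟨ +-congʳ (+-congˡ (-‿cong (≈-trans (*-congˡ EE⁻¹≈1) (*-identityʳ d)))) ⟩
          d - d - d * E⁻¹ * r ≈⟨ +-congʳ (-‿inverseʳ d) ⟩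
          0# - d * E⁻¹ * r ≈⟨ +-identityˡ _ ⟩
          - (d * E⁻¹ * r) ∎
        q′ : + suc (suc k) ≤ᵛ u - newton y ^ e
        q′ = ≤ᵛ-resp (≈-sym error) (≤ᵛ-neg (≡.subst (_≤ᵛ d * E⁻¹ * r) (≡.cong +_ (ℕ.+-comm (suc k) 1))
          (≤ᵛ-* (correction q) (proj₂ (proj₂ diff)))))

      approximation : ∀ k → Approximation k
      approximation zero    = 1# , ≤ᵛ-0 (-‿inverseʳ 1#) ,
        ≤ᵛ-resp (+-congˡ (-‿cong (≈-sym (1^ e)))) 1≤u-1
        where
        1^ : ∀ n → 1# ^ n ≈ 1#
        1^ zero    = ≈-refl
        1^ (suc n) = ≈-trans (*-identityˡ _) (1^ n)
      approximation (suc k) = refine (approximation k)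

      abstract
        s : ℕ → Carrier
        s k = proj₁ (approximation k)

        s-unit : ∀ k → 1ℤ ≤ᵛ s k - 1#
        s-unit k = proj₁ (proj₂ (approximation k))

        s-error : ∀ k → + suc k ≤ᵛ u - s k ^ e
        s-error k = proj₂ (proj₂ (approximation k))

        s-suc : ∀ k → s (suc k) ≡ newton (s k)
        s-suc k = refl

      s-converges : ∀ k j → + suc k ≤ᵛ s (j ℕ.+ k) - s k
      s-converges k zero    = ≤ᵛ-0 (-‿inverseʳ _)
      s-converges k (suc j) = ≡.subst (λ z → + suc k ≤ᵛ z - s k) (≡.sym (s-suc (j ℕ.+ k)))
        (≤ᵛ-resp (solve 3 (λ y d z → d :+ (y :- z) := (y :+ d) :- z) ≈-refl (s (j ℕ.+ k)) ((u - s (j ℕ.+ k) ^ e) * E⁻¹) (s k))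
          (≤ᵛ-+ (correction (≤ᵛ-weaken (ℤ.+≤+ (ℕ.s≤s (ℕ.m≤n+m k j))) (s-error (j ℕ.+ k)))) (s-converges k j)))

      N≤1+∣N∣ : ∀ N → N ℤ.≤ + suc ℤ.∣ N ∣
      N≤1+∣N∣ (+ n)    = ℤ.+≤+ (ℕ.n≤1+n n)
      N≤1+∣N∣ -[1+ n ] = ℤ.-≤+

      s-cauchy : IsCauchy K s
      s-cauchy N = M , λ m n M≤m M≤n → ≤ᵛ-weaken (N≤1+∣N∣ N)
        (≤ᵛ-resp (solve 3 (λ a b z → (a :- z) :- (b :- z) := a :- b) ≈-refl (s m) (s n) (s M))
          (≤ᵛ-‿- (tail M≤m) (tail M≤n)))
        where
        M = ℤ.∣ N ∣
        tail : ∀ {m} → M ℕ.≤ m → + suc M ≤ᵛ s m - s M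
        tail {m} M≤m = ≡.subst (λ m → + suc M ≤ᵛ s m - s M) (ℕ.m∸n+n≡m M≤m) (s-converges M (m ∸ M))

      limit = complete s s-cauchy
      y = proj₁ limit

      -- One stage has to be both near the limit and a good approximate root; the maximum with the
      -- absolute value of N secures the latter.
      close : ∀ N → ∃[ M ] (N ℤ.≤ + suc M × N ≤ᵛ y - s M)
      close N = M′ , ℤ.≤-trans (N≤1+∣N∣ N) (ℤ.+≤+ (ℕ.s≤s (ℕ.m≤n⊔m M _))) ,
        ≤ᵛ-resp (solve 2 (λ a b → :- (a :- b) := b :- a) ≈-refl (s M′) y)
          (≤ᵛ-neg (proj₂ (proj₂ limit N) M′ (ℕ.m≤m⊔n M _)))
        where
        M  = proj₁ (proj₂ limit N)
        M′ = M ℕ.⊔ ℤ.∣ N ∣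

      1≤y-1 : 1ℤ ≤ᵛ y - 1#
      1≤y-1 = ≤ᵛ-resp (solve 3 (λ y s o → (y :- s) :+ (s :- o) := y :- o) ≈-refl y (s M) 1#)
        (≤ᵛ-+ (proj₂ (proj₂ (close 1ℤ))) (s-unit M))
        where M = proj₁ (close 1ℤ)

    private
      root : ∃[ y ] y ^ e ≈ u
      root = y , ≈-sym (≈-trans (solve 2 (λ u Y → u := (u :- Y) :+ Y) ≈-refl u (y ^ e))
        (≈-trans (+-congʳ (≤ᵛ-all⇒≈0 all)) (+-identityˡ _)))
        where
        all : ∀ N → N ≤ᵛ u - y ^ e
        -- The error at the limit is the error at a late stage, corrected by y^e - (s M)^e, which
        -- `≤ᵛ-^-difference` controls.
        all N = ≤ᵛ-resp
          (solve 3 (λ u S Y → (u :- S) :- (Y :- S) := u :- Y) ≈-refl u (s M ^ e) (y ^ e))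
          (≤ᵛ-‿- (≤ᵛ-weaken (proj₁ (proj₂ (close N))) (s-error M))
            (≤ᵛ-^-difference 1≤y-1 (s-unit M) (proj₂ (proj₂ (close N))) e))
          where M = proj₁ (close N)

    abstract
      1-unit-root : ∃[ y ] y ^ e ≈ u
      1-unit-root = root

-- Polynomials: division with remainder and evaluation.

module PolynomialFacts {c ℓ} (R : CommutativeRing c ℓ) where
  open CommutativeRing R hiding (zero) renaming (refl to ≈-refl; sym to ≈-sym; trans to ≈-trans)
  open RingProps ring using (-0#≈0#)
  open Mult semiring using () renaming (_×_ to _·_)
  open Polynomial R hiding (_^_)
  open IntegerCoefficientSolver R
  module P = CommutativeRing polynomialRing

  coeff-⊕ : ∀ f g n → coeff (f ⊕ g) n ≈ coeff f n + coeff g n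
  coeff-⊕ []      g       n       = ≈-sym (+-identityˡ _)
  coeff-⊕ (a ∷ f) []      n       = ≈-sym (+-identityʳ _)
  coeff-⊕ (a ∷ f) (b ∷ g) zero    = ≈-refl
  coeff-⊕ (a ∷ f) (b ∷ g) (suc n) = coeff-⊕ f g n

  coeff-⊖ : ∀ f n → coeff (⊖ f) n ≈ - coeff f n
  coeff-⊖ []      n       = ≈-sym -0#≈0#
  coeff-⊖ (a ∷ f) zero    = ≈-refl
  coeff-⊖ (a ∷ f) (suc n) = coeff-⊖ f n

  coeff-scale : ∀ a f n → coeff (scale a f) n ≈ a * coeff f n
  coeff-scale a []      n       = ≈-sym (zeroʳ a)
  coeff-scale a (b ∷ f) zero    = ≈-refl
  coeff-scale a (b ∷ f) (suc n) = coeff-scale a f n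

  coeff-derivative : ∀ f n → coeff (derivative f) n ≈ suc n · coeff f (suc n)
  coeff-derivative []      n       = ≈-sym (·0 (suc n))
    where
    ·0 : ∀ k → k · 0# ≈ 0#
    ·0 zero    = ≈-refl
    ·0 (suc k) = ≈-trans (+-identityˡ _) (·0 k)
  coeff-derivative (a ∷ g) zero    = coeff-⊕ g _ zero
  coeff-derivative (a ∷ g) (suc n) = ≈-trans (coeff-⊕ g _ (suc n)) (+-congˡ (coeff-derivative g n))

  ∷-⊗ : ∀ a f g n → coeff ((a ∷ f) ⊗ g) n ≈ a * coeff g n + coeff (0# ∷ f ⊗ g) n
  ∷-⊗ a f g n = ≈-trans (coeff-⊕ (scale a g) _ n) (+-congʳ (coeff-scale a g n))

  T⊗ : ∀ g → (T ⊗ g) ≋ (0# ∷ g)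
  T⊗ g = mk≋ λ
    { zero    → ≈-trans (∷-⊗ 0# (1# ∷ []) g zero) (≈-trans (+-identityʳ _) (zeroˡ _))
    ; (suc n) → ≈-trans (∷-⊗ 0# (1# ∷ []) g (suc n)) (≈-trans (+-congʳ (zeroˡ _)) (≈-trans (+-identityˡ _)
                  (coeff-≈ (P.*-identityˡ g) n))) }

  fromVector : ∀ {d} → Vector Carrier d → Poly
  fromVector {zero}  r = []
  fromVector {suc d} r = r zero ∷ fromVector (r ∘ suc)

  coeff-fromVector : ∀ {d} (r : Vector Carrier d) i → coeff (fromVector r) (toℕ i) ≡ r i
  coeff-fromVector r zero    = refl
  coeff-fromVector r (suc i) = coeff-fromVector (r ∘ suc) i

  -- Lists may end in zeros, so a degree is a bound on the support of the coefficients and not the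
  -- length of the list.
  BelowDegree : ℕ → Poly → Set ℓ
  BelowDegree d f = ∀ n → d ℕ.≤ n → coeff f n ≈ 0#

  fromVector-below : ∀ {d} (r : Vector Carrier d) → BelowDegree d (fromVector r)
  fromVector-below {zero}  r n       _         = ≈-refl
  fromVector-below {suc d} r (suc n) (ℕ.s≤s p) = fromVector-below (r ∘ suc) n p

  below⇒fromVector : ∀ d f → BelowDegree d f → f ≋ fromVector {d} (coeff f ∘ toℕ)
  below⇒fromVector d f p = mk≋ (go d f p)
    where
    go : ∀ d f → BelowDegree d f → ∀ n → coeff f n ≈ coeff (fromVector {d} (coeff f ∘ toℕ)) n
    go zero    f       p n       = p n ℕ.z≤n
    go (suc d) f       p zero    = ≈-refl
    go (suc d) []      p (suc n) = go d [] (λ _ _ → ≈-refl) n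
    go (suc d) (a ∷ f) p (suc n) = go d f (λ n d≤n → p (suc n) (ℕ.s≤s d≤n)) n

  Monic : ℕ → Poly → Set ℓ
  Monic d f = coeff f d ≈ 1# × BelowDegree (suc d) f

  -- Horner's scheme: if g = q f + r, then a + T g = T q f + (a + T r). The polynomial a + T r has
  -- degree at most d, and subtracting b f, with b its coefficient at d, brings it below d. The
  -- remainder is a vector of length d, to be read as a combination of 1, ..., x^(d-1).
  divide : ∀ {d f} → Monic d f → ∀ g → ∃[ q ] Σ (Vector Carrier d) λ r → g ≋ (q ⊗ f) ⊕ fromVector r
  divide {d} {f} (lead , below) [] = [] , (λ _ → 0#) , mk≋ (λ n → ≈-sym (go d n))
    where
    go : ∀ d n → coeff (fromVector {d} (λ _ → 0#)) n ≈ 0#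
    go zero    n       = ≈-refl
    go (suc d) zero    = ≈-refl
    go (suc d) (suc n) = go d n
  divide {d} {f} (lead , below) (a ∷ g) with q , r , e ← divide {d} {f} (lead , below) g =
    b ∷ q , coeff rest ∘ toℕ , mk≋ (λ n → ≈-trans (eq n) (≈-sym (≈-trans (coeff-⊕ ((b ∷ q) ⊗ f) _ n)
      (+-cong (∷-⊗ b q f n) (≈-sym (coeff-≈ (below⇒fromVector d rest rest-below) n))))))
    where
    h = a ∷ fromVector r
    b = coeff h d
    rest = h ⊕ (⊖ scale b f)
    coeff-rest : ∀ n → coeff rest n ≈ coeff h n - b * coeff f n
    coeff-rest n = ≈-trans (coeff-⊕ h (⊖ scale b f) n) (+-congˡ (≈-trans (coeff-⊖ (scale b f) n) (-‿cong (coeff-scale b f n))))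
    rest-below : BelowDegree d rest
    rest-below n d≤n with d ℕ.≟ n
    ... | yes refl = ≈-trans (coeff-rest n) (≈-trans (+-congˡ (-‿cong (≈-trans (*-congˡ lead) (*-identityʳ b)))) (-‿inverseʳ b))
    ... | no d≢n   = ≈-trans (coeff-rest n) (≈-trans (+-cong (h-below n (ℕ.≤∧≢⇒< d≤n d≢n))
                       (≈-trans (-‿cong (≈-trans (*-congˡ (below n (ℕ.≤∧≢⇒< d≤n d≢n))) (zeroʳ b))) -0#≈0#)) (+-identityʳ 0#))
      where
      h-below : BelowDegree (suc d) h
      h-below (suc n) (ℕ.s≤s p) = fromVector-below r n p
    eq : ∀ n → coeff (a ∷ g) n ≈ b * coeff f n + coeff (0# ∷ q ⊗ f) n + coeff rest n
    eq n = ≈-trans (eq′ n) (≈-trans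
        (solve 3 (λ x y z → y :+ z := x :+ y :+ (z :- x)) ≈-refl (b * coeff f n) (coeff (0# ∷ q ⊗ f) n) (coeff h n))
        (+-congˡ (≈-sym (coeff-rest n))))
      where
      eq′ : ∀ n → coeff (a ∷ g) n ≈ coeff (0# ∷ q ⊗ f) n + coeff h n
      eq′ zero    = ≈-sym (+-identityˡ a)
      eq′ (suc n) = ≈-trans (coeff-≈ e n) (coeff-⊕ (q ⊗ f) _ n)

  -- Induction from the constant term: a f has degree at most d, so above d the product (a + T q) f
  -- agrees with T q f, and q vanishes by induction. The coefficient at d is then a.
  multiple-below⇒0 : ∀ {d f} → Monic d f → ∀ q → BelowDegree d (q ⊗ f) → q ≋ []
  multiple-below⇒0 monic [] p = P.refl
  multiple-below⇒0 {d} {f} (lead , below) (a ∷ q) p = mk≋ λ { zero → a≈0 ; (suc n) → coeff-≈ q≋[] n }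
    where
    q≋[] : q ≋ []
    q≋[] = multiple-below⇒0 {d} {f} (lead , below) q λ n d≤n → ≈-trans (≈-sym (≈-trans (∷-⊗ a q f (suc n))
      (≈-trans (+-congʳ (≈-trans (*-congˡ (below (suc n) (ℕ.s≤s d≤n))) (zeroʳ a))) (+-identityˡ _))))
      (p (suc n) (ℕ.m≤n⇒m≤1+n d≤n))
    tail≈0 : ∀ n → coeff (0# ∷ q ⊗ f) n ≈ 0#
    tail≈0 zero    = ≈-refl
    tail≈0 (suc n) = coeff-≈ (P.trans (P.*-cong q≋[] (P.refl {f})) (P.zeroˡ f)) n
    a≈0 : a ≈ 0#
    a≈0 = ≈-trans (≈-sym (≈-trans (+-cong (≈-trans (*-congˡ lead) (*-identityʳ a)) (tail≈0 d)) (+-identityʳ a)))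
      (≈-trans (≈-sym (∷-⊗ a q f d)) (p d ℕ.≤-refl))

  module Evaluation {a b} (A : Algebra R a b) (x : Algebra.Carrier A) where
    private
      module A = Algebra A
      module ι = RingHomomorphism A.structure
      module S = IntegerCoefficientSolver A.ring
      open Sum A.semiring using (sum; sum-cong-≋; *-distribˡ-sum)
      open Exp A.semiring using (_^_)
      ev : Poly → A.Carrier
      ev f = evaluate A f x

    evaluate-≋[] : ∀ f → f ≋ [] → ev f A.≈ A.0#
    evaluate-≋[] []      e = A.refl
    evaluate-≋[] (a ∷ f) e = A.trans (A.+-cong (A.trans (ι.⟦⟧-cong (coeff-≈ e 0)) ι.0#-homo)
      (A.trans (A.*-congˡ (evaluate-≋[] f (mk≋ (coeff-≈ e ∘ suc)))) (A.zeroʳ x))) (A.+-identityʳ _)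

    evaluate-cong : ∀ {f g} → f ≋ g → ev f A.≈ ev g
    evaluate-cong {[]}    {g}     e = A.sym (evaluate-≋[] g (P.sym {[]} {g} e))
    evaluate-cong {a ∷ f} {[]}    e = evaluate-≋[] (a ∷ f) e
    evaluate-cong {a ∷ f} {b ∷ g} e = A.+-cong (ι.⟦⟧-cong (coeff-≈ e 0))
      (A.*-congˡ (evaluate-cong {f} {g} (mk≋ (coeff-≈ e ∘ suc))))

    evaluate-⊕ : ∀ f g → ev (f ⊕ g) A.≈ ev f A.+ ev g
    evaluate-⊕ []      g       = A.sym (A.+-identityˡ _)
    evaluate-⊕ (a ∷ f) []      = A.sym (A.+-identityʳ _)
    evaluate-⊕ (a ∷ f) (b ∷ g) = A.trans (A.+-cong (ι.+-homo a b) (A.*-congˡ (evaluate-⊕ f g)))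
      (S.solve 5 (λ a b x f g → (a S.:+ b) S.:+ x S.:* (f S.:+ g) S.:= (a S.:+ x S.:* f) S.:+ (b S.:+ x S.:* g))
        A.refl (A.ι a) (A.ι b) x (ev f) (ev g))

    evaluate-scale : ∀ a f → ev (scale a f) A.≈ A.ι a A.* ev f
    evaluate-scale a []      = A.sym (A.zeroʳ _)
    evaluate-scale a (b ∷ f) = A.trans (A.+-cong (ι.*-homo a b) (A.*-congˡ (evaluate-scale a f)))
      (S.solve 4 (λ a b x f → a S.:* b S.:+ x S.:* (a S.:* f) S.:= a S.:* (b S.:+ x S.:* f))
        A.refl (A.ι a) (A.ι b) x (ev f))

    evaluate-⊗ : ∀ f g → ev (f ⊗ g) A.≈ ev f A.* ev g
    evaluate-⊗ []      g = A.sym (A.zeroˡ _)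
    evaluate-⊗ (a ∷ f) g = A.trans (evaluate-⊕ (scale a g) (0# ∷ f ⊗ g))
      (A.trans (A.+-cong (evaluate-scale a g) (A.+-cong ι.0#-homo (A.*-congˡ (evaluate-⊗ f g))))
      (A.trans (A.+-congˡ (A.+-identityˡ _))
      (S.solve 4 (λ a x f g → a S.:* g S.:+ x S.:* (f S.:* g) S.:= (a S.:+ x S.:* f) S.:* g)
        A.refl (A.ι a) x (ev f) (ev g))))

    evaluate-⊖ : ∀ f → ev (⊖ f) A.≈ A.- ev f
    evaluate-⊖ []      = A.sym (RingProps.-0#≈0# (CommutativeRing.ring (Algebra.ring A)))
    evaluate-⊖ (a ∷ f) = A.trans (A.+-cong (ι.-‿homo a) (A.*-congˡ (evaluate-⊖ f)))
      (S.solve 3 (λ a x f → S.:- a S.:+ x S.:* (S.:- f) S.:= S.:- (a S.:+ x S.:* f)) A.refl (A.ι a) x (ev f))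

    evaluate-const : ∀ a → ev (const a) A.≈ A.ι a
    evaluate-const a = A.trans (A.+-congˡ (A.zeroʳ x)) (A.+-identityʳ _)

    evaluate-T : ev T A.≈ x
    evaluate-T = A.trans (A.+-congʳ ι.0#-homo) (A.trans (A.+-identityˡ _)
      (A.trans (A.*-congˡ (A.trans (evaluate-const 1#) ι.1#-homo)) (A.*-identityʳ x)))

    evaluate-T^ : ∀ n → ev (Polynomial._^_ R T n) A.≈ x ^ n
    evaluate-T^ zero    = A.trans (evaluate-const 1#) ι.1#-homo
    evaluate-T^ (suc n) = A.trans (evaluate-⊗ T (Polynomial._^_ R T n)) (A.*-cong evaluate-T (evaluate-T^ n))

    evaluate-fromVector : ∀ {d} (r : Vector Carrier d) →
      ev (fromVector r) A.≈ sum (λ i → A.ι (r i) A.* x ^ toℕ i)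
    evaluate-fromVector {zero}  r = A.refl
    evaluate-fromVector {suc d} r = A.+-cong (A.sym (A.*-identityʳ _)) (A.trans (A.*-congˡ (evaluate-fromVector (r ∘ suc)))
      (A.trans (*-distribˡ-sum x (λ i → A.ι (r (suc i)) A.* x ^ toℕ i))
      (sum-cong-≋ λ i → S.solve 3 (λ x a y → x S.:* (a S.:* y) S.:= a S.:* (x S.:* y)) A.refl x (A.ι (r (suc i))) (x ^ toℕ i))))

-- Linear combinations, dimension and minimal polynomials in an algebra.

module AlgebraCombinations {c ℓ a b} {R : CommutativeRing c ℓ} (A : Algebra R a b) where
  open Algebra A hiding (zero) renaming (refl to ≈-refl; sym to ≈-sym; trans to ≈-trans)
  private
    module R = CommutativeRing R
    module ιH = RingHomomorphism structure
    module RSum = Sum R.semiring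
  open Sum semiring using (sum; sum-cong-≋; ∑-distrib-+; *-distribˡ-sum; *-distribʳ-sum; ∑-comm; sum-replicate-zero) public
  open IntegerCoefficientSolver ring

  combination : ∀ {n} → Vector R.Carrier n → Vector Carrier n → Carrier
  combination k u = sum (λ i → ι (k i) * u i)

  IndependentFamily : ∀ {n} → Vector Carrier n → Set (c ⊔ ℓ ⊔ b)
  IndependentFamily {n} u = ∀ (k : Vector R.Carrier n) → combination k u ≈ 0# → ∀ i → k i R.≈ R.0#

  DependentFamily : ∀ {n} → Vector Carrier n → Set (c ⊔ ℓ ⊔ b)
  DependentFamily {n} u = Σ (Vector R.Carrier n) λ k → (∃[ i ] ¬ k i R.≈ R.0#) × combination k u ≈ 0#

  ι-sum : ∀ {n} (k : Vector R.Carrier n) → ι (RSum.sum k) ≈ sum (ι ∘ k)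
  ι-sum {zero}  k = ιH.0#-homo
  ι-sum {suc n} k = ≈-trans (ιH.+-homo _ _) (+-congˡ (ι-sum (k ∘ suc)))

  combination-0 : ∀ {n} {k : Vector R.Carrier n} (u : Vector Carrier n) → (∀ i → k i R.≈ R.0#) → combination k u ≈ 0#
  combination-0 {n} u k≈0 = ≈-trans (sum-cong-≋ λ i →
    ≈-trans (*-congʳ (≈-trans (ιH.⟦⟧-cong (k≈0 i)) ιH.0#-homo)) (zeroˡ (u i))) (sum-replicate-zero n)

  combination-congʳ : ∀ {n} (k : Vector R.Carrier n) {u v : Vector Carrier n} →
                      (∀ i → u i ≈ v i) → combination k u ≈ combination k v
  combination-congʳ {n} k e = sum-cong-≋ {n} λ i → *-congˡ (e i)

  combination-scale : ∀ {n} a (k : Vector R.Carrier n) u → combination (λ i → a R.* k i) u ≈ ι a * combination k u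
  combination-scale a k u = ≈-trans (sum-cong-≋ λ i → ≈-trans (*-congʳ (ιH.*-homo a (k i))) (*-assoc _ _ _))
    (≈-sym (*-distribˡ-sum (ι a) (λ i → ι (k i) * u i)))

  combination-sub : ∀ {n} (k l : Vector R.Carrier n) u →
                    combination (λ i → k i R.- l i) u ≈ combination k u - combination l u
  combination-sub k l u = ≈-trans (sum-cong-≋ λ i → ≈-trans (*-congʳ (ιH.+-homo (k i) (R.- l i)))
      (≈-trans (*-congʳ (+-congˡ (ιH.-‿homo (l i)))) (solve 3 (λ k l u → (k :- l) :* u := k :* u :+ (:- l) :* u) ≈-refl (ι (k i)) (ι (l i)) (u i))))
    (≈-trans (∑-distrib-+ (λ i → ι (k i) * u i) _) (+-congˡ (≈-trans (sum-cong-≋ λ i →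
      solve 3 (λ o l u → (:- l) :* u := :- (l :* u)) ≈-refl 1# (ι (l i)) (u i)) (sum-neg (λ i → ι (l i) * u i)))))
    where
    sum-neg : ∀ {n} (f : Vector Carrier n) → sum (λ i → - f i) ≈ - sum f
    sum-neg {zero}  f = ≈-sym (RingProps.-0#≈0# (CommutativeRing.ring ring))
    sum-neg {suc n} f = ≈-trans (+-congˡ (sum-neg (f ∘ suc)))
      (solve 2 (λ x y → :- x :+ (:- y) := :- (x :+ y)) ≈-refl (f zero) (sum (f ∘ suc)))

  -- Exchanging the two summations turns relations between the rows of a coefficient matrix into
  -- relations in A, which is how `gauss` comes to bear on A.
  combination-of-combinations : ∀ {n N} (u : Vector Carrier n) (v : Vector Carrier N) (M : Fin n → Fin N → R.Carrier) →
    (∀ i → u i ≈ combination (M i) v) → ∀ k → combination k u ≈ combination (λ j → RSum.sum (λ i → k i R.* M i j)) v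
  combination-of-combinations u v M e k =
    ≈-trans (sum-cong-≋ λ i → ≈-trans (*-congˡ (e i)) (*-distribˡ-sum (ι (k i)) (λ j → ι (M i j) * v j)))
    (≈-trans (∑-comm (λ i j → ι (k i) * (ι (M i j) * v j)))
    (sum-cong-≋ λ j → ≈-trans (sum-cong-≋ λ i → ≈-trans (≈-sym (*-assoc _ _ _)) (*-congʳ (≈-sym (ιH.*-homo (k i) (M i j)))))
      (≈-trans (≈-sym (*-distribʳ-sum (v j) (λ i → ι (k i R.* M i j)))) (*-congʳ (≈-sym (ι-sum (λ i → k i R.* M i j)))))))

module AlgebraOverField {c ℓ a b} {R : CommutativeRing c ℓ} (isField : IsField R)
  (zero? : ∀ x → Dec (CommutativeRing._≈_ R x (CommutativeRing.0# R)))
  (A : Algebra R a b) where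
  open Algebra A hiding (zero) renaming (refl to ≈-refl; sym to ≈-sym; trans to ≈-trans)
  open AlgebraCombinations A
  open LinearAlgebra R isField zero?
  private
    module R = CommutativeRing R
    module ιH = RingHomomorphism structure
  open IsField isField using (inverse)
  open Exp semiring using (_^_)
  open PolynomialFacts R
  open Polynomial R hiding (_^_)
  open IntegerCoefficientSolver ring

  -- The other outcome of `gauss`, a relation between the coefficient rows of u, would be a relation
  -- among the u i.
  steinitz : ∀ {n N} {u : Vector Carrier n} {v : Vector Carrier N} →
             IndependentFamily u → (∀ i → ∃[ k ] u i ≈ combination k v) → n ℕ.≤ N
  steinitz {n} {N} {u} {v} ind span with gauss N n (λ i → proj₁ (span i))
  ... | inj₂ (n≤N , _)             = n≤N
  ... | inj₁ (k , (i , kᵢ≉0) , rel) = ⊥-elim (kᵢ≉0 (ind k (≈-trans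
    (combination-of-combinations u v (λ i → proj₁ (span i)) (λ i → proj₂ (span i)) k) (combination-0 v rel)) i))

  module _ {N} (degree : HasDegree A N) where
    private
      basis = proj₁ degree
      module B = IsBasis (proj₂ degree)

    dependent? : ∀ {n} (u : Vector Carrier n) → DependentFamily u ⊎ (n ℕ.≤ N × IndependentFamily u)
    dependent? {n} u with gauss N n (λ i → proj₁ (B.spanning (u i)))
    ... | inj₁ (k , nz , rel) = inj₁ (k , nz , ≈-trans
      (combination-of-combinations u basis (λ i → proj₁ (B.spanning (u i))) (λ i → proj₂ (B.spanning (u i))) k) (combination-0 basis rel))
    ... | inj₂ (n≤N , ind)    = inj₂ (n≤N , λ k ku≈0 → ind k (B.independent _ (≈-trans
      (≈-sym (combination-of-combinations u basis (λ i → proj₁ (B.spanning (u i))) (λ i → proj₂ (B.spanning (u i))) k)) ku≈0)))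

    -- N + 1 elements are dependent in dimension N, and in a relation between x and the members of u
    -- the coefficient of x cannot vanish.
    independent⇒basis : (u : Vector Carrier N) → IndependentFamily u → IsBasis A u
    independent⇒basis u ind = record { spanning = spanning ; independent = ind }
      where
      spanning : ∀ x → Σ (Vector R.Carrier N) λ k → x ≈ combination k u
      spanning x with dependent? (x Vector.∷ u)
      ... | inj₂ (N<N , _) = ⊥-elim (ℕ.<-irrefl refl N<N)
      ... | inj₁ (k , (i , kᵢ≉0) , rel) with zero? (k zero)
      ...   | yes k₀≈0 = ⊥-elim (kᵢ≉0 (all i))
        where
        all : ∀ i → k i R.≈ R.0#
        all zero    = k₀≈0
        all (suc i) = ind (k ∘ suc) (≈-trans (≈-sym (≈-trans (+-congʳ (≈-trans
          (*-congʳ (≈-trans (ιH.⟦⟧-cong k₀≈0) ιH.0#-homo)) (zeroˡ x))) (+-identityˡ _))) rel) i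
      ...   | no k₀≉0 with k₀⁻¹ , k₀k₀⁻¹≈1 ← inverse (k zero) k₀≉0 = (λ i → R.- k₀⁻¹ R.* k (suc i)) , ≈-sym (
          ≈-trans (combination-scale (R.- k₀⁻¹) (k ∘ suc) u) (
          ≈-trans (*-congʳ (ιH.-‿homo k₀⁻¹)) (
          ≈-trans (solve 4 (λ i k x s → (:- i) :* s := x :* (k :* i) :+ (:- i) :* (k :* x :+ s)) ≈-refl (ι k₀⁻¹) (ι (k zero)) x s) (
          ≈-trans (+-cong (*-congˡ (≈-trans (≈-sym (ιH.*-homo _ _)) (≈-trans (ιH.⟦⟧-cong k₀k₀⁻¹≈1) ιH.1#-homo)))
            (≈-trans (*-congˡ rel) (zeroʳ _))) (≈-trans (+-identityʳ _) (*-identityʳ x))))))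
        where s = combination (k ∘ suc) u

    -- A minimal polynomial together with its degree. Independence of 1, ..., x^(d-1) forces the
    -- remainder of any g with g(x) = 0 to vanish, which is the field `multiple`.
    record PowerRelation (x : Carrier) : Set (c ⊔ ℓ ⊔ b) where
      field
        d           : ℕ
        independent : IndependentFamily {d} (λ i → x ^ toℕ i)
        poly        : Poly
        monic       : Monic d poly
        root        : evaluate A poly x ≈ 0#

      multiple : ∀ g → evaluate A g x ≈ 0# → poly ∣ g
      multiple g g[x]≈0 with q , r , e ← divide monic g =
        q ,ᵈ P.trans (P.sym (P.trans (P.+-congˡ (r≋[] (λ i → independent r r[x]≈0 i))) (P.+-identityʳ (q ⊗ poly)))) (P.sym e)
        where
        open Evaluation A x
        r[x]≈0 : combination r (λ i → x ^ toℕ i) ≈ 0#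
        r[x]≈0 = ≈-trans (≈-sym (evaluate-fromVector r)) (≈-trans (≈-sym (≈-trans (+-congʳ
          (≈-trans (evaluate-⊗ q poly) (≈-trans (*-congˡ root) (zeroʳ _)))) (+-identityˡ _)))
          (≈-trans (≈-sym (evaluate-⊕ (q ⊗ poly) (fromVector r))) (≈-trans (≈-sym (evaluate-cong {g} {(q ⊗ poly) ⊕ fromVector r} e)) g[x]≈0)))
        r≋[] : ∀ {d} {r : Vector R.Carrier d} → (∀ i → r i R.≈ R.0#) → fromVector r ≋ []
        r≋[] {d} {r} h = mk≋ (go h)
          where
          go : ∀ {d} {r : Vector R.Carrier d} → (∀ i → r i R.≈ R.0#) → ∀ n → coeff (fromVector r) n R.≈ R.0#
          go {zero}  h n       = R.refl
          go {suc d} h zero    = h zero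
          go {suc d} h (suc n) = go (h ∘ suc) n

      isMinimalPolynomial : IsMinimalPolynomial A x poly
      isMinimalPolynomial = record { monic = d , proj₁ monic , proj₂ monic ; root = root ; minimal = multiple }

    -- d is the first exponent for which 1, ..., x^d are dependent. It is at most N, since N + 1
    -- elements are always dependent; accordingly the fuel N + 1 - d never reaches 0.
    powerRelation : ∀ x → PowerRelation x
    powerRelation x = search (suc N) 0 (λ _ _ ()) (ℕ.+-identityʳ _) (ℕ.z≤n)
      where
      powers : ∀ d → Vector Carrier d
      powers d i = x ^ toℕ i
      relation : ∀ d → IndependentFamily (powers d) → DependentFamily (powers (suc d)) → PowerRelation x
      relation d ind (k , (i , kᵢ≉0) , rel) = record
        { d = d ; independent = ind ; poly = fromVector r
        ; monic = R.trans (R.reflexive (≡.subst (λ n → coeff (fromVector r) n ≡ r top) (Fin.toℕ-fromℕ d) (coeff-fromVector r top)))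
                          (R.trans (R.*-comm _ _) kk⁻¹≈1)
                , fromVector-below r
        ; root = ≈-trans (Evaluation.evaluate-fromVector A x r) (≈-trans (combination-scale k⁻¹ k (powers (suc d)))
                   (≈-trans (*-congˡ rel) (zeroʳ _))) }
        where
        open CMonSum +-commutativeMonoid using (sum-init-last)
        top = Fin.fromℕ d
        k-top≉0 : ¬ k top R.≈ R.0#
        k-top≉0 k-top≈0 = kᵢ≉0 (all i)
          where
          init≈0 : combination (k ∘ Fin.inject₁) (powers d) ≈ 0#
          init≈0 = ≈-trans (combination-congʳ (k ∘ Fin.inject₁) {powers d} {powers (suc d) ∘ Fin.inject₁}
                     λ i → reflexive (≡.cong (x ^_) (≡.sym (Fin.toℕ-inject₁ i))))
            (≈-trans (≈-sym (≈-trans (+-congˡ (≈-trans (*-congʳ (≈-trans (ιH.⟦⟧-cong k-top≈0) ιH.0#-homo)) (zeroˡ _))) (+-identityʳ _)))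
            (≈-trans (≈-sym (sum-init-last (λ i → ι (k i) * powers (suc d) i))) rel))
          all : ∀ i → k i R.≈ R.0#
          all i with Top.view i
          ... | Top.‵fromℕ     = k-top≈0
          ... | Top.‵inject₁ j = ind (k ∘ Fin.inject₁) init≈0 j
        k⁻¹ = proj₁ (inverse (k top) k-top≉0)
        kk⁻¹≈1 = proj₂ (inverse (k top) k-top≉0)
        r : Vector R.Carrier (suc d)
        r i = k⁻¹ R.* k i
      search : ∀ fuel d → IndependentFamily (powers d) → fuel ℕ.+ d ≡ suc N → d ℕ.≤ N → PowerRelation x
      search zero    d ind eq d≤N = ⊥-elim (ℕ.<-irrefl refl (≡.subst (ℕ._≤ N) eq d≤N))
      search (suc n) d ind eq d≤N with dependent? (powers (suc d))
      ... | inj₁ dep             = relation d ind dep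
      ... | inj₂ (d<N , ind′)    = search n (suc d) ind′ (≡.trans (ℕ.+-suc n d) eq) d<N

-- Algebras with a valuation of ramification index e.

-- If n < N, then e n + l < e (n + 1) ≤ e N. This passes from bounds in the value group of A to
-- bounds in that of K.
eN≤en+l⇒N≤n : ∀ e {l} N n → l ℕ.< e → + e ℤ.* N ℤ.≤ + e ℤ.* n ℤ.+ + l → N ℤ.≤ n
eN≤en+l⇒N≤n e {l} N n l<e le = ℤ.≮⇒≥ λ n<N → ℤ.<-irrefl refl (begin-strict
  + e ℤ.* n ℤ.+ + l    <⟨ ℤ.+-monoʳ-< (+ e ℤ.* n) (ℤ.+<+ l<e) ⟩
  + e ℤ.* n ℤ.+ + e    ≡⟨ ≡.trans (ℤ.+-comm (+ e ℤ.* n) (+ e)) (≡.sym (ℤ.*-suc (+ e) n)) ⟩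
  + e ℤ.* ℤ.suc n      ≤⟨ ℤ.*-monoˡ-≤-nonNeg (+ e) (ℤ.i<j⇒suc[i]≤j n<N) ⟩
  + e ℤ.* N            ≤⟨ le ⟩
  + e ℤ.* n ℤ.+ + l    ∎)
  where open ℤ.≤-Reasoning

remainder-unique : ∀ e {l l′} n n′ → l ℕ.< e → l′ ℕ.< e →
                   + e ℤ.* n ℤ.+ + l ≡ + e ℤ.* n′ ℤ.+ + l′ → l ≡ l′
remainder-unique e {l} {l′} n n′ l<e l′<e eq = ℤ.+-injective
  (AbelianGroupProps.∙-cancelˡ ℤ.+-0-abelianGroup (+ e ℤ.* n) (+ l) (+ l′)
    (≡.trans eq (≡.cong (λ n → + e ℤ.* n ℤ.+ + l′)
      (ℤ.≤-antisym (eN≤en+l⇒N≤n e n′ n l<e (below n′ l′ (≡.sym eq))) (eN≤en+l⇒N≤n e n n′ l′<e (below n l eq))))))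
  where
  below : ∀ n l {x} → + e ℤ.* n ℤ.+ + l ≡ x → + e ℤ.* n ℤ.≤ x
  below n l eq = ≡.subst (_ ℤ.≤_) eq (ℤ.i≤i+j (+ e ℤ.* n) (+ l))

eventually-all : ∀ {k} {P : Fin k → ℕ → Set} → (∀ i → ∃[ M ] ∀ n → M ℕ.≤ n → P i n) →
                 ∃[ M ] ∀ n → M ℕ.≤ n → ∀ i → P i n
eventually-all {zero}  h = 0 , λ _ _ ()
eventually-all {suc k} h with M₀ , p₀ ← h zero | M , p ← eventually-all (h ∘ suc) = M₀ ℕ.⊔ M , λ
  { n le zero    → p₀ n (ℕ.≤-trans (ℕ.m≤m⊔n M₀ M) le)
  ; n le (suc i) → p n (ℕ.≤-trans (ℕ.m≤n⊔m M₀ M) le) i }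

module RamifiedAlgebra {c ℓ a b} (K : DiscretelyValuedField c ℓ)
  (A : Algebra (DiscretelyValuedField.ring K) a b) (W : DiscreteValuation (Algebra.ring A)) (e-1 : ℕ)
  (ramified : ∀ x → DiscreteValuation.v W (Algebra.ι A x) ≡ Maybe.map (+ suc e-1 ℤ.*_) (DiscretelyValuedField.v K x)) where
  private
    e = suc e-1
    module KF = DiscretelyValuedField K
    module K = CommutativeRing KF.ring
    module v = Valuation KF.ring KF.valuation
    module ιH = RingHomomorphism (Algebra.structure A)
  open Algebra A hiding (zero) renaming (refl to ≈-refl; sym to ≈-sym; trans to ≈-trans)
  module w = Valuation (Algebra.ring A) W
  open w using (_≤ᵛ_)
  open AlgebraCombinations A
  open AlgebraOverField KF.isField v.zero? A
  open Exp semiring using (_^_)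
  open IntegerCoefficientSolver ring

  w-ι : ∀ {x n} → v.v x ≡ fin n → w.v (ι x) ≡ fin (+ e ℤ.* n)
  w-ι {x} eq = ≡.trans (ramified x) (≡.cong (Maybe.map (+ e ℤ.*_)) eq)

  ≤ᵛ-ι : ∀ {n x} → n v.≤ᵛ x → (+ e ℤ.* n) ≤ᵛ ι x
  ≤ᵛ-ι {n} {x} p with v.zero? x
  ... | yes x≈0 = w.≤ᵛ-0 (≈-trans (ιH.⟦⟧-cong x≈0) ιH.0#-homo)
  ... | no x≉0 with m , eq ← v.v-finite x≉0 =
    ≡.subst (fin _ ≤⁺_) (≡.sym (w-ι eq)) [ ℤ.*-monoˡ-≤-nonNeg (+ e) (v.≤ᵛ⇒≤ eq p) ]

  v-from-term : ∀ {N x u l} → l ℕ.< e → w.v u ≡ fin (+ l) → (+ e ℤ.* N) ≤ᵛ ι x * u → N v.≤ᵛ x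
  v-from-term {N} {x} l<e wu p with v.zero? x
  ... | yes x≈0 = v.≤ᵛ-0 x≈0
  ... | no x≉0 with m , eq ← v.v-finite x≉0 =
    ≡.subst (fin _ ≤⁺_) (≡.sym eq) [ eN≤en+l⇒N≤n e N m l<e (w.≤ᵛ⇒≤ (w.v≡* (w-ι eq) wu) p) ]

  -- On K the valuation w takes values in e ℤ, so the terms of any combination of the u i have
  -- values in distinct classes modulo e, and `sum-orthogonal` applies. The families in question are
  -- the powers of a uniformiser, powers of an element of K[x], and products of both.
  module Graded {k} (u : Vector Carrier k) (g : Fin k → ℕ) (g<e : ∀ i → g i ℕ.< e)
    (g-injective : ∀ {i j} → g i ≡ g j → i ≡ j) (w-u : ∀ i → w.v (u i) ≡ fin (+ g i)) where

    private
      term : ∀ {i x n} → w.v (ι x * u i) ≡ fin n → ∃[ m ] n ≡ + e ℤ.* m ℤ.+ + g i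
      term {i} {x} {n} eq with v.zero? x
      ... | yes x≈0 = ⊥-elim (w.v≡fin⇒≉0 eq (≈-trans (*-congʳ (≈-trans (ιH.⟦⟧-cong x≈0) ιH.0#-homo)) (zeroˡ _)))
      ... | no x≉0 with m , eq′ ← v.v-finite x≉0 = m , fin-injective (≡.trans (≡.sym eq) (w.v≡* (w-ι eq′) (w-u i)))

      distinct : ∀ (c : Vector K.Carrier k) i j {n} → w.v (ι (c i) * u i) ≡ fin n → w.v (ι (c j) * u j) ≡ fin n → i ≡ j
      distinct c i j p q with m , eq ← term p | m′ , eq′ ← term q =
        g-injective (remainder-unique e m m′ (g<e i) (g<e j) (≡.trans (≡.sym eq) eq′))

    orthogonal : ∀ (c : Vector K.Carrier k) n → n ≤ᵛ combination c u → ∀ i → n ≤ᵛ ι (c i) * u i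
    orthogonal c = w.sum-orthogonal (λ i → ι (c i) * u i) (distinct c)

    attained : ∀ (c : Vector K.Carrier k) {n} → w.v (combination c u) ≡ fin n →
               ∃[ i ] ¬ c i K.≈ K.0# × ∃[ m ] n ≡ + e ℤ.* m ℤ.+ + g i
    attained c eq with i , eq′ ← w.sum-attained (λ i → ι (c i) * u i) (distinct c) eq =
      i , (λ cᵢ≈0 → w.v≡fin⇒≉0 eq′ (≈-trans (*-congʳ (≈-trans (ιH.⟦⟧-cong cᵢ≈0) ιH.0#-homo)) (zeroˡ _))) , term eq′

    coordinate-≤ᵛ : ∀ (c : Vector K.Carrier k) N → (+ e ℤ.* N) ≤ᵛ combination c u → ∀ i → N v.≤ᵛ c i
    coordinate-≤ᵛ c N p i = v-from-term (g<e i) (w-u i) (orthogonal c (+ e ℤ.* N) p i)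

    independent : IndependentFamily u
    independent c cu≈0 i = v.≤ᵛ-all⇒≈0 λ N → coordinate-≤ᵛ c N (w.≤ᵛ-0 cu≈0) i

  w-^ : ∀ {μ} → w.v μ ≡ fin 1ℤ → ∀ n → w.v (μ ^ n) ≡ fin (+ n)
  w-^ e n = ≡.trans (w.v-^ n e) (≡.cong fin (ℤ.*-identityʳ (+ n)))

  module _ (degree : HasDegree A e) where

    -- The values 0, ..., e - 1 give independence and the degree e gives spanning: here the equality
    -- of degree and ramification index enters.
    graded-basis : (u : Vector Carrier e) → (∀ i → w.v (u i) ≡ fin (+ toℕ i)) → IsBasis A u
    graded-basis u w-u = independent⇒basis degree u (Graded.independent u toℕ Fin.toℕ<n Fin.toℕ-injective w-u)

    module UniformiserBasis {μ} (w-μ : w.v μ ≡ fin 1ℤ) where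
      powers : Vector Carrier e
      powers i = μ ^ toℕ i
      open Graded powers toℕ Fin.toℕ<n Fin.toℕ-injective (λ i → w-^ w-μ (toℕ i)) public
      open IsBasis (graded-basis powers (λ i → w-^ w-μ (toℕ i))) public using (spanning)

    private
      uniformiser = w.onto 1ℤ
      open UniformiserBasis (proj₂ uniformiser)

    private
      -- The residue field of A is that of K: when u is expanded in powers of a uniformiser, all
      -- coefficients are integral, and every term except the one at index 0 has positive value.
      representative : ∀ {u} → 0ℤ ≤ᵛ u → ∃[ x ] 0ℤ v.≤ᵛ x × 1ℤ ≤ᵛ u - ι x
      representative {u} 0≤u = κ zero , 0≤κ zero , ≤ᵛ-tail
        where
        κ = proj₁ (spanning u)
        0≤κ : ∀ i → 0ℤ v.≤ᵛ κ i
        0≤κ = coordinate-≤ᵛ κ 0ℤ (w.≤ᵛ-respˡ (≡.sym (ℤ.*-zeroʳ (+ e))) (w.≤ᵛ-resp (proj₂ (spanning u)) 0≤u))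
        ≤ᵛ-tail : 1ℤ ≤ᵛ u - ι (κ zero)
        ≤ᵛ-tail = w.≤ᵛ-resp (≈-trans (solve 2 (λ x t → t := (x :+ t) :- x) ≈-refl (ι (κ zero) * 1#) _)
            (+-cong (≈-sym (proj₂ (spanning u))) (-‿cong (*-identityʳ _))))
          (w.≤ᵛ-sum {e-1} {1ℤ} {λ i → ι (κ (suc i)) * powers (suc i)} λ i → w.≤ᵛ-weaken (ℤ.+≤+ (ℕ.s≤s ℕ.z≤n))
            (w.≤ᵛ-* (w.≤ᵛ-respˡ (ℤ.*-zeroʳ (+ e)) (≤ᵛ-ι (0≤κ (suc i)))) (w.v≡⇒≤ᵛ (w-^ (proj₂ uniformiser) (toℕ (suc i))))))

    abstract
      residue-representative : ∀ {u} → 0ℤ ≤ᵛ u → ∃[ x ] 0ℤ v.≤ᵛ x × 1ℤ ≤ᵛ u - ι x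
      residue-representative = representative

    module _ (isField : IsField (Algebra.ring A)) (complete : IsComplete K) where
      extension : DiscretelyValuedField a b
      extension = record { ring = Algebra.ring A ; isField = isField ; valuation = W }

      private
        complete′ : IsComplete extension
        complete′ s cauchy = X , converges
          where
          κ : ℕ → Vector K.Carrier e
          κ n = proj₁ (spanning (s n))
          difference : ∀ (x y : Vector K.Carrier e) {p q} → p ≈ combination x powers → q ≈ combination y powers →
                       combination (λ i → x i K.- y i) powers ≈ p - q
          difference x y p≈ q≈ = ≈-trans (combination-sub x y powers) (+-cong (≈-sym p≈) (-‿cong (≈-sym q≈)))
          coordinate-cauchy : ∀ i → IsCauchy K (λ n → κ n i)
          coordinate-cauchy i N = proj₁ bound , λ m n M≤m M≤n →
            coordinate-≤ᵛ (λ i → κ m i K.- κ n i) N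
              (w.≤ᵛ-resp (≈-sym (difference (κ m) (κ n) (proj₂ (spanning (s m))) (proj₂ (spanning (s n)))))
                (proj₂ bound m n M≤m M≤n)) i
            where bound = cauchy (+ e ℤ.* N)
          limits : ∀ i → ∃[ x ] ConvergesTo K (λ n → κ n i) x
          limits i = complete (λ n → κ n i) (coordinate-cauchy i)
          x : Vector K.Carrier e
          x i = proj₁ (limits i)
          X = combination x powers
          -- Precision |N| of the coordinates in K becomes e |N| in A, which still is at least N
          -- when N is negative.
          N≤e∣N∣ : ∀ N → N ℤ.≤ + e ℤ.* + ℤ.∣ N ∣
          N≤e∣N∣ (+ n)    = ≡.subst (+ n ℤ.≤_) (ℤ.pos-* e n) (ℤ.+≤+ (ℕ.m≤m+n n (e-1 ℕ.* n)))
          N≤e∣N∣ -[1+ n ] = ℤ.-≤+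
          converges : ConvergesTo extension s X
          converges N = proj₁ bound , λ n M≤n →
            w.≤ᵛ-resp (difference (κ n) x (proj₂ (spanning (s n))) ≈-refl)
              (w.≤ᵛ-sum {e} λ i → w.≤ᵛ-weaken (ℤ.≤-trans (N≤e∣N∣ N) (ℤ.i≤i+j _ (+ toℕ i)))
                (w.≤ᵛ-* (≤ᵛ-ι (proj₂ bound n M≤n i)) (w.v≡⇒≤ᵛ (w-^ (proj₂ uniformiser) (toℕ i)))))
            where bound = eventually-all (λ i → proj₂ (limits i) (+ ℤ.∣ N ∣))

      abstract
        extension-complete : IsComplete extension
        extension-complete = complete′

-- Field structure and separability in the tame case.

private
  -- P is an arbitrary predicate, so a least witness is available only under double negation. It
  -- will be used towards a divisibility in ℕ, which is decidable and hence stable.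
  ¬¬-least : ∀ {p} (P : ℕ → Set p) n → P n → ¬ ¬ (∃[ m ] P m × ∀ k → k ℕ.< m → ¬ P k)
  ¬¬-least P n Pn ¬least = none (suc n) n ℕ.≤-refl Pn
    where
    none : ∀ b k → k ℕ.< b → ¬ P k
    none (suc b) k (ℕ.s≤s k≤b) Pk = ¬least (k , Pk , λ j j<k → none b j (ℕ.≤-trans j<k k≤b))

module Span {c ℓ a b} {R : CommutativeRing c ℓ} (A : Algebra R a b) {n} (v : Vector (Algebra.Carrier A) n) where
  open Algebra A hiding (zero) renaming (refl to ≈-refl; sym to ≈-sym; trans to ≈-trans)
  open AlgebraCombinations A
  private
    module R = CommutativeRing R
    module ιH = RingHomomorphism structure

  InSpan : Carrier → Set (c ⊔ b)
  InSpan x = Σ (Vector R.Carrier n) λ k → x ≈ combination k v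

  span-resp : ∀ {x y} → x ≈ y → InSpan x → InSpan y
  span-resp x≈y (k , e) = k , ≈-trans (≈-sym x≈y) e

  span-0 : InSpan 0#
  span-0 = (λ _ → R.0#) , ≈-sym (combination-0 v (λ _ → R.refl))

  span-+ : ∀ {x y} → InSpan x → InSpan y → InSpan (x + y)
  span-+ (k , e) (l , e′) = (λ i → k i R.+ l i) , ≈-trans (+-cong e e′)
    (≈-trans (≈-sym (∑-distrib-+ (λ i → ι (k i) * v i) (λ i → ι (l i) * v i)))
      (sum-cong-≋ {n} λ i → ≈-trans (≈-sym (distribʳ (v i) _ _)) (*-congʳ (≈-sym (ιH.+-homo (k i) (l i))))))

  span-scale : ∀ a {x} → InSpan x → InSpan (ι a * x)
  span-scale a (k , e) = (λ i → a R.* k i) , ≈-trans (*-congˡ e) (≈-sym (combination-scale a k v))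

  span-sum : ∀ {m} (f : Vector Carrier m) → (∀ i → InSpan (f i)) → InSpan (sum f)
  span-sum {zero}  f h = span-0
  span-sum {suc m} f h = span-+ (h zero) (span-sum (f ∘ suc) (h ∘ suc))

  span-member : ∀ i → InSpan (v i)
  span-member i = δ i , ≈-sym (go v i)
    where
    δ : ∀ {n} → Fin n → Vector R.Carrier n
    δ zero    zero    = R.1#
    δ zero    (suc j) = R.0#
    δ (suc i) zero    = R.0#
    δ (suc i) (suc j) = δ i j
    go : ∀ {n} (v : Vector Carrier n) i → combination (δ i) v ≈ v i
    go v zero    = ≈-trans (+-cong (≈-trans (*-congʳ ιH.1#-homo) (*-identityˡ _)) (combination-0 (v ∘ suc) (λ _ → R.refl))) (+-identityʳ _)
    go v (suc i) = ≈-trans (+-cong (≈-trans (*-congʳ ιH.0#-homo) (zeroˡ _)) (go (v ∘ suc) i)) (+-identityˡ _)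

module TameAlgebra {c ℓ a b} (K : DiscretelyValuedField c ℓ)
  (A : Algebra (DiscretelyValuedField.ring K) a b) (W : DiscreteValuation (Algebra.ring A)) (e-1 : ℕ)
  (ramified : ∀ x → DiscreteValuation.v W (Algebra.ι A x) ≡ Maybe.map (+ suc e-1 ℤ.*_) (DiscretelyValuedField.v K x))
  (degree : HasDegree A (suc e-1)) where
  private
    e = suc e-1
    module KF = DiscretelyValuedField K
    module K = CommutativeRing KF.ring
    module v = Valuation KF.ring KF.valuation
    module ιH = RingHomomorphism (Algebra.structure A)
    module P = PolynomialFacts.P KF.ring
  open Algebra A hiding (zero) renaming (refl to ≈-refl; sym to ≈-sym; trans to ≈-trans)
  open RamifiedAlgebra K A W e-1 ramified
  open AlgebraCombinations A
  open AlgebraOverField KF.isField v.zero? A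
  open Exp semiring using (_^_)
  open Mult K.semiring using () renaming (_×_ to _·_)
  open IntegerCoefficientSolver ring
  open PolynomialFacts KF.ring hiding (module P)
  open Polynomial KF.ring hiding (_^_)

  monic-cancel : ∀ {d f} → Monic d f → ∀ u → u ⊗ f ≋ f → u ≋ const K.1#
  monic-cancel {d} {f} monic u uf≋f = mk≋ λ n → K.trans (S.solve 2 (λ x y → x S.:= (x S.:- y) S.:+ y) K.refl (coeff u n) (coeff (const K.1#) n))
    (K.trans (K.+-congʳ (K.trans (K.sym (K.trans (coeff-⊕ u (⊖ const K.1#) n) (K.+-congˡ (coeff-⊖ (const K.1#) n)))) (coeff-≈ u-1≋0 n))) (K.+-identityˡ _))
    where
    module S = IntegerCoefficientSolver KF.ring
    [u-1]f≋0 : (u ⊕ (⊖ const K.1#)) ⊗ f ≋ []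
    [u-1]f≋0 = P.trans (P.distribʳ f u (⊖ const K.1#)) (P.trans (P.+-cong uf≋f
      (P.trans (P.sym (RingProps.-‿distribˡ-* P.ring (const K.1#) f)) (P.-‿cong (P.*-identityˡ f)))) (P.-‿inverseʳ f))
    u-1≋0 : u ⊕ (⊖ const K.1#) ≋ []
    u-1≋0 = multiple-below⇒0 monic (u ⊕ (⊖ const K.1#)) λ n _ → coeff-≈ [u-1]f≋0 n

  -- Write the minimal polynomial of x as a + T q. If a is nonzero, then x q(x) = -a is invertible.
  -- If a = 0, then x q(x) = 0, and as the valuation excludes zero divisors q(x) = 0; so q = s (T
  -- q), whence T s = 1, which fails at the constant coefficient.
  isField : IsField (Algebra.ring A)
  isField = record { 1≉0 = w.1≉0 ; inverse = inverse }
    where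
    inverse : ∀ x → ¬ x ≈ 0# → ∃[ y ] x * y ≈ 1#
    inverse x x≉0 = fromPoly (PR.poly) PR.monic PR.root PR.multiple
      where
      module PR = PowerRelation (powerRelation degree x)
      fromPoly : ∀ f → Monic PR.d f → evaluate A f x ≈ 0# → (∀ g → evaluate A g x ≈ 0# → f ∣ g) → ∃[ y ] x * y ≈ 1#
      fromPoly []      (lead , _) _    _        = ⊥-elim (v.1≉0 (K.sym lead))
      fromPoly (a ∷ q) monic      root multiple with v.zero? a
      ... | no a≉0 = evaluate A q x * ι (K.- a⁻¹) , (begin
          x * (Q * ι (K.- a⁻¹))     ≈⟨ *-congˡ (*-congˡ (ιH.-‿homo a⁻¹)) ⟩
          x * (Q * - ι a⁻¹)   ≈⟨ solve 4 (λ x q i a → x :* (q :* (:- i)) := a :* i :- i :* (a :+ x :* q)) ≈-refl x Q (ι a⁻¹) (ι a) ⟩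
          ι a * ι a⁻¹ - ι a⁻¹ * (ι a + x * Q) ≈⟨ +-cong (≈-trans (≈-sym (ιH.*-homo a a⁻¹)) (≈-trans (ιH.⟦⟧-cong aa⁻¹≈1) ιH.1#-homo))
                                                   (-‿cong (≈-trans (*-congˡ root) (zeroʳ _))) ⟩
          1# - 0#   ≈⟨ +-congˡ (RingProps.-0#≈0# (CommutativeRing.ring (Algebra.ring A))) ⟩
          1# + 0#   ≈⟨ +-identityʳ 1# ⟩
          1#   ∎)
        where
        open SetoidReasoning setoid
        a⁻¹ = proj₁ (KF.inverse a a≉0)
        aa⁻¹≈1 = proj₂ (KF.inverse a a≉0)
        Q = evaluate A q x
      ... | yes a≈0 = ⊥-elim (absurd (w.xy≈0⇒ xQ≈0))
        where
        xQ≈0 : x * evaluate A q x ≈ 0#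
        xQ≈0 = ≈-trans (≈-sym (≈-trans (+-congʳ (≈-trans (ιH.⟦⟧-cong a≈0) ιH.0#-homo)) (+-identityˡ _))) root
        absurd : x ≈ 0# ⊎ evaluate A q x ≈ 0# → ⊥
        absurd (inj₁ x≈0) = x≉0 x≈0
        absurd (inj₂ Q≈0) with multiple q Q≈0
        ... | s ,ᵈ sf≋q = v.1≉0 (K.sym (coeff-≈ (P.trans (P.sym (T⊗ s)) Ts≋1) 0))
          where
          Ts≋1 : T ⊗ s ≋ const K.1#
          Ts≋1 = monic-cancel monic (T ⊗ s) (P.trans (P.*-assoc T s (a ∷ q)) (P.trans (P.*-congˡ {T} sf≋q)
            (P.trans (T⊗ q) (mk≋ λ { zero → K.sym a≈0 ; (suc n) → K.refl }))))

  -- K[x] is spanned by the powers of an element y of K[x] whose valuation m generates the valuations on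
  -- K[x], because y^i λ^j with j < m is a graded basis of A; so d is the index e / m.
  module _ {x} (PR : PowerRelation degree x) where
    open PowerRelation PR
    open Evaluation A x
    private
      ev : Poly → Carrier
      ev g = evaluate A g x

      Value : ℕ → Set c
      Value s = ∃[ g ] w.v (ev g) ≡ fin (+ s)

      value-* : ∀ {s t g h} → w.v (ev g) ≡ fin s → w.v (ev h) ≡ fin t → w.v (ev (g ⊗ h)) ≡ fin (s ℤ.+ t)
      value-* {g = g} {h} p q = ≡.trans (w.v-cong (evaluate-⊗ g h)) (w.v≡* p q)

      value-+ : ∀ {s t} → Value s → Value t → Value (s ℕ.+ t)
      value-+ (g , p) (h , q) = g ⊗ h , value-* {g = g} {h} p q

      value-multiple : ∀ {s} k → Value s → Value (k ℕ.* s)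
      value-multiple zero    S = const K.1# , ≡.trans (w.v-cong (≈-trans (evaluate-const K.1#) ιH.1#-homo)) w.v1
      value-multiple (suc k) S = value-+ S (value-multiple k S)

      -- K[x] contains K, on whose nonzero elements w takes all multiples of e, so the values on
      -- K[x] are stable under translation by e. Hence natural numbers suffice to describe them.
      value-mod-e : ∀ {s g n} → w.v (ev g) ≡ fin (+ e ℤ.* n ℤ.+ + s) → Value s
      value-mod-e {s} {g} {n} p = const y ⊗ g ,
        ≡.trans (value-* {g = const y} {g} (≡.trans (w.v-cong (evaluate-const y)) (w-ι (proj₂ (v.onto (ℤ.- n))))) p)
          (≡.cong fin (solveℤ 3 (λ e n s → e :*ℤ (:-ℤ n) :+ℤ (e :*ℤ n :+ℤ s) :=ℤ s) refl (+ e) n (+ s)))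
        where
        y = proj₁ (v.onto (ℤ.- n))
        open ℤSolver.+-*-Solver using () renaming (solve to solveℤ; _:*_ to _:*ℤ_; _:+_ to _:+ℤ_; :-_ to :-ℤ_; _:=_ to _:=ℤ_)

      value-e : Value e
      value-e = const (proj₁ (v.onto 1ℤ)) , ≡.trans (w.v-cong (evaluate-const _))
        (≡.trans (w-ι (proj₂ (v.onto 1ℤ))) (≡.cong fin (ℤ.*-identityʳ (+ e))))

      module WithLeastValue (m-1 : ℕ) (Sm : Value (suc m-1)) (least : ∀ k → k ℕ.< m-1 → ¬ Value (suc k)) where
        m = suc m-1
        gy = proj₁ Sm
        y = ev gy

        -- Subtraction of t m without inverses in K[x]: add (e - 1) t m by powers of y, then remove
        -- e t m by an element of K.
        value-% : ∀ {l} → Value l → Value (l ℕ.% m)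
        value-% {l} S = value-mod-e {g = proj₁ big} {n = + (m ℕ.* t)} (≡.trans (proj₂ big) (≡.cong fin (≡.sym eq)))
          where
          t = l ℕ./ m
          r = l ℕ.% m
          big : Value (e-1 ℕ.* (t ℕ.* m) ℕ.+ l)
          big = value-+ (value-multiple e-1 (value-multiple t Sm)) S
          eq : + e ℤ.* + (m ℕ.* t) ℤ.+ + r ≡ + (e-1 ℕ.* (t ℕ.* m) ℕ.+ l)
          eq = ≡.trans (≡.cong (ℤ._+ + r) (≡.sym (ℤ.pos-* e (m ℕ.* t)))) (≡.cong +_ (≡.trans
            (solveℕ 4 (λ e m t r → (m :*ℕ t :+ℕ e :*ℕ (m :*ℕ t)) :+ℕ r :=ℕ e :*ℕ (t :*ℕ m) :+ℕ (r :+ℕ t :*ℕ m)) refl e-1 m t r)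
            (≡.cong (e-1 ℕ.* (t ℕ.* m) ℕ.+_) (≡.sym (ℕ.m≡m%n+[m/n]*n l m)))))
            where open ℕSolver.+-*-Solver using () renaming (solve to solveℕ; _:*_ to _:*ℕ_; _:+_ to _:+ℕ_; _:=_ to _:=ℕ_)

        value⇒∣ : ∀ {l} → Value l → m ℕ.∣ l
        value⇒∣ {l} S = ℕ.m%n≡0⇒n∣m l m (zero-remainder (l ℕ.% m) (ℕ.m%n<n l m) (value-% S))
          where
          zero-remainder : ∀ r → r ℕ.< m → Value r → r ≡ 0
          zero-remainder zero    _         _ = refl
          zero-remainder (suc r) (ℕ.s≤s p) S = ⊥-elim (least r p S)

        k = ℕ.quotient (value⇒∣ value-e)
        e≡km : e ≡ k ℕ.* m
        e≡km = ℕ._∣_.equality (value⇒∣ value-e)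

        ys : Vector Carrier k
        ys i = y ^ toℕ i
        ys-independent : IndependentFamily ys
        ys-independent = Graded.independent ys (λ i → toℕ i ℕ.* m)
          (λ i → ≡.subst (toℕ i ℕ.* m ℕ.<_) (≡.sym e≡km) (ℕ.*-monoˡ-< m (Fin.toℕ<n i)))
          (λ {i} {j} eq → Fin.toℕ-injective (ℕ.*-cancelʳ-≡ (toℕ i) (toℕ j) m eq))
          (λ i → ≡.trans (w.v-^ (toℕ i) (proj₂ Sm)) (≡.cong fin (≡.sym (ℤ.pos-* (toℕ i) m))))

        λ′ = w.onto 1ℤ
        -- y has value m and λ has value 1, so the member at l has value (l / m) m + l % m = l.
        -- Those with m dividing l are powers of y, hence lie in K[x].
        bs : Vector Carrier e
        bs l = y ^ (toℕ l ℕ./ m) * proj₁ λ′ ^ (toℕ l ℕ.% m)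
        w-bs : ∀ l → w.v (bs l) ≡ fin (+ toℕ l)
        w-bs l = ≡.trans (w.v≡* (w.v-^ (toℕ l ℕ./ m) (proj₂ Sm)) (w-^ (proj₂ λ′) (toℕ l ℕ.% m)))
          (≡.cong fin (≡.trans (≡.cong (ℤ._+ + (toℕ l ℕ.% m)) (≡.sym (ℤ.pos-* (toℕ l ℕ./ m) m)))
            (≡.cong +_ (≡.trans (ℕ.+-comm _ (toℕ l ℕ.% m)) (≡.sym (ℕ.m≡m%n+[m/n]*n (toℕ l) m))))))
        bs-basis = graded-basis degree bs w-bs

        module Yspan = Span A ys
        module Xspan = Span A (λ (i : Fin d) → x ^ toℕ i)

        Image : Carrier → Set (c ⊔ b)
        Image z = ∃[ g ] z ≈ ev g

        image-sum : ∀ {n} (f : Vector Carrier n) → (∀ i → Image (f i)) → Image (sum f)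
        image-sum {zero}  f h = [] , ≈-refl
        image-sum {suc n} f h = proj₁ (h zero) ⊕ proj₁ (image-sum (f ∘ suc) (h ∘ suc)) ,
          ≈-trans (+-cong (proj₂ (h zero)) (proj₂ (image-sum (f ∘ suc) (h ∘ suc)))) (≈-sym (evaluate-⊕ (proj₁ (h zero)) _))

        image-ι* : ∀ a {z} → Image z → Image (ι a * z)
        image-ι* a (g , eq) = scale a g , ≈-trans (*-congˡ eq) (≈-sym (evaluate-scale a g))

        image-y^ : ∀ n → Image (y ^ n)
        image-y^ zero    = const K.1# , ≈-sym (≈-trans (evaluate-const K.1#) ιH.1#-homo)
        image-y^ (suc n) = gy ⊗ proj₁ (image-y^ n) , ≈-trans (*-congˡ (proj₂ (image-y^ n))) (≈-sym (evaluate-⊗ gy _))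

        module _ (g : Poly) where
          z = ev g
          cs = proj₁ (IsBasis.spanning bs-basis z)
          z≈ : z ≈ combination cs bs
          z≈ = proj₂ (IsBasis.spanning bs-basis z)
          keep : ∀ {l} → Dec (m ℕ.∣ l) → K.Carrier → K.Carrier
          keep (yes _) a = a
          keep (no _)  a = K.0#
          -- Keeps the part of z that is visibly a polynomial in y; the aim is that nothing has been
          -- discarded.
          cs⁺ : Vector K.Carrier e
          cs⁺ l = keep (m ℕ.∣? toℕ l) (cs l)

          bs-divisible : ∀ l → m ℕ.∣ toℕ l → bs l ≈ y ^ (toℕ l ℕ./ m)
          bs-divisible l m∣l = ≈-trans (*-congˡ (reflexive (≡.cong (proj₁ λ′ ^_) (ℕ.n∣m⇒m%n≡0 (toℕ l) m m∣l)))) (*-identityʳ _)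

          term-image : ∀ l dec → Image (ι (keep {toℕ l} dec (cs l)) * bs l)
          term-image l (yes m∣l) = image-ι* (cs l) (proj₁ (image-y^ (toℕ l ℕ./ m)) , ≈-trans (bs-divisible l m∣l) (proj₂ (image-y^ (toℕ l ℕ./ m))))
          term-image l (no _)    = [] , ≈-trans (*-congʳ ιH.0#-homo) (zeroˡ _)

          term-span : ∀ l dec → Yspan.InSpan (ι (keep {toℕ l} dec (cs l)) * bs l)
          term-span l (yes m∣l) = Yspan.span-scale (cs l) (Yspan.span-resp
            (≈-sym (≈-trans (bs-divisible l m∣l) (reflexive (≡.cong (y ^_) (≡.sym (Fin.toℕ-fromℕ< l/m<k))))))
            (Yspan.span-member (fromℕ< l/m<k)))
            where
            l/m<k : toℕ l ℕ./ m ℕ.< k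
            l/m<k = ℕ.m<n*o⇒m/o<n (≡.subst (toℕ l ℕ.<_) e≡km (Fin.toℕ<n l))
          term-span l (no _)    = Yspan.span-resp (≈-sym (≈-trans (*-congʳ ιH.0#-homo) (zeroˡ _))) Yspan.span-0

          z⁺ = combination cs⁺ bs
          z⁺-image = image-sum (λ l → ι (cs⁺ l) * bs l) (λ l → term-image l (m ℕ.∣? toℕ l))

          difference : z - z⁺ ≈ combination (λ l → cs l K.- cs⁺ l) bs
          difference = ≈-trans (+-congʳ z≈) (≈-sym (combination-sub cs cs⁺ bs))

          -- z⁺ is a polynomial in y, so z - z⁺ lies in K[x]. Its value, if finite, would be
          -- congruent modulo e to an index l not divisible by m, against `value⇒∣`.
          z-z⁺-finite : ∀ {n} → ¬ w.v (z - z⁺) ≡ fin n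
          z-z⁺-finite {n} eq = absurd (Graded.attained bs toℕ Fin.toℕ<n Fin.toℕ-injective w-bs
              (λ l → cs l K.- cs⁺ l) (≡.trans (≡.sym (w.v-cong difference)) eq))
            where
            absurd : ∃[ l ] ¬ (cs l K.- cs⁺ l) K.≈ K.0# × ∃[ j ] n ≡ + e ℤ.* j ℤ.+ + toℕ l → ⊥
            absurd (l , cₗ≉0 , j , refl) = contra (m ℕ.∣? toℕ l) cₗ≉0
              where
              value : Value (toℕ l)
              value = value-mod-e {g = g ⊕ (⊖ proj₁ z⁺-image)} {n = j} (≡.trans (w.v-cong (≈-trans (evaluate-⊕ g _)
                (+-congˡ (≈-trans (evaluate-⊖ (proj₁ z⁺-image)) (-‿cong (≈-sym (proj₂ z⁺-image))))))) eq)
              contra : ∀ dec → ¬ (cs l K.- keep {toℕ l} dec (cs l)) K.≈ K.0# → ⊥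
              contra (yes _)  h = h (K.-‿inverseʳ _)
              contra (no m∤l) h = m∤l (value⇒∣ value)

          image-in-Yspan : Yspan.InSpan z
          image-in-Yspan = Yspan.span-resp (≈-sym z≈z⁺) (Yspan.span-sum (λ l → ι (cs⁺ l) * bs l) (λ l → term-span l (m ℕ.∣? toℕ l)))
            where
            z≈z⁺ : z ≈ z⁺
            z≈z⁺ = ≈-trans (solve 2 (λ x y → x := (x :- y) :+ y) ≈-refl z z⁺) (≈-trans (+-congʳ
              (decidable-stable (w.zero? (z - z⁺)) λ ¬p → z-z⁺-finite (proj₂ (w.v-finite ¬p)))) (+-identityˡ _))

          image-in-Xspan : Xspan.InSpan z
          image-in-Xspan with q , r , eq ← divide monic g = r , ≈-trans (evaluate-cong {g} {(q ⊗ poly) ⊕ fromVector r} eq)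
            (≈-trans (evaluate-⊕ (q ⊗ poly) (fromVector r)) (≈-trans (+-cong (≈-trans (evaluate-⊗ q poly)
              (≈-trans (*-congˡ root) (zeroʳ _))) (evaluate-fromVector r)) (+-identityˡ _)))

        -- The powers of x below d and those of y below k are both independent and both span K[x],
        -- so `steinitz` applies in either direction.
        d≡k : d ≡ k
        d≡k = ℕ.≤-antisym
          (steinitz independent λ i → Yspan.span-resp (evaluate-T^ (toℕ i)) (image-in-Yspan (Polynomial._^_ KF.ring T (toℕ i))))
          (steinitz ys-independent λ i → Xspan.span-resp (≈-sym (proj₂ (image-y^ (toℕ i)))) (image-in-Xspan (proj₁ (image-y^ (toℕ i)))))

        d∣e : d ℕ.∣ e
        d∣e = ℕ.divides m (≡.trans e≡km (≡.trans (ℕ.*-comm k m) (≡.cong (m ℕ.*_) (≡.sym d≡k))))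

    degree-∣ : d ℕ.∣ e
    degree-∣ = decidable-stable (d ℕ.∣? e) λ ∤ →
      -- The value e, taken already on K, is the positive value from which the descent starts.
      ¬¬-least (Value ∘ suc) e-1 value-e λ { (m-1 , Sm , least) → ∤ (WithLeastValue.d∣e m-1 Sm least) }

  isSeparable : (∀ d → d ℕ.∣ e → ¬ d · K.1# K.≈ K.0#) → IsSeparable A
  isSeparable d≉0 x = poly , isMinimalPolynomial , coprime
    where
    PR = powerRelation degree x
    open PowerRelation PR
    open Evaluation A x
    f′ = derivative poly
    f′-below : BelowDegree d f′
    f′-below n d≤n = K.trans (coeff-derivative poly n) (K.trans (Mult.×-congʳ K.semiring (suc n) (proj₂ monic (suc n) (ℕ.s≤s d≤n))) (·0 (suc n)))
      where
      ·0 : ∀ k → k · K.0# K.≈ K.0#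
      ·0 zero    = K.refl
      ·0 (suc k) = K.trans (K.+-identityˡ _) (·0 k)
    f′≉0 : ¬ f′ ≋ []
    f′≉0 f′≋[] = go d (degree-∣ PR) (proj₁ monic)
      where
      go : ∀ d → d ℕ.∣ e → coeff poly d K.≈ K.1# → ⊥
      go zero    0∣e _    with () ← ℕ.0∣⇒≡0 0∣e
      go (suc d) d∣e lead = d≉0 (suc d) d∣e (K.trans (Mult.×-congʳ K.semiring (suc d) (K.sym lead))
        (K.trans (K.sym (coeff-derivative poly d)) (coeff-≈ f′≋[] d)))
    -- Irreducibility enters through the absence of zero divisors: s z = f gives s(x) = 0 or z(x) =
    -- 0. In the first case f divides s, and z is a unit. In the second f′(x) = 0, so f divides f′,
    -- which has lower degree and would have to vanish.
    coprime : IsSeparablePolynomial poly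
    coprime {z} (s ,ᵈ sz≋f) z∣f′ = decide (w.xy≈0⇒ (≈-trans (≈-sym (evaluate-⊗ s z)) (≈-trans (evaluate-cong {s ⊗ z} {poly} sz≋f) root))) z∣f′
      where
      decide : evaluate A s x ≈ 0# ⊎ evaluate A z x ≈ 0# → z ∣ f′ → z ∣ const K.1#
      decide (inj₁ s[x]≈0) _ with multiple s s[x]≈0
      ... | u ,ᵈ uf≋s = u ,ᵈ monic-cancel monic (u ⊗ z) (P.trans (P.*-assoc u z poly) (P.trans (P.*-congˡ {u} (P.*-comm z poly))
              (P.trans (P.sym (P.*-assoc u poly z)) (P.trans (P.*-congʳ {z} uf≋s) sz≋f))))
      decide (inj₂ z[x]≈0) (t ,ᵈ tz≋f′) with multiple f′ (≈-trans (≈-sym (evaluate-cong {t ⊗ z} {f′} tz≋f′))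
          (≈-trans (evaluate-⊗ t z) (≈-trans (*-congˡ z[x]≈0) (zeroʳ _))))
      ... | u ,ᵈ uf≋f′ = ⊥-elim (f′≉0 (P.trans (P.sym uf≋f′) (P.trans (P.*-congʳ {poly}
              (multiple-below⇒0 monic u λ n d≤n → K.trans (coeff-≈ uf≋f′ n) (f′-below n d≤n))) (P.zeroˡ poly))))

-- From a uniformiser to an extension: the valuation of a radical algebra.

-- An algebra with basis 1, t, …, t^(e-1) and t^e = π, for a uniformiser π: the valuation extends by
-- w (Σ xᵢ tⁱ) = min (e v(xᵢ) + i), where the finite terms are pairwise distinct modulo e.
module RadicalValuation {c ℓ a b} (K : DiscretelyValuedField c ℓ) (A : Algebra (DiscretelyValuedField.ring K) a b)
  (e-1 : ℕ) {π : DiscretelyValuedField.Carrier K} (v-π : DiscretelyValuedField.v K π ≡ fin 1ℤ) (t : Algebra.Carrier A)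
  (t^e≈π : Algebra._≈_ A (Exp._^_ (Algebra.semiring A) t (suc e-1)) (Algebra.ι A π))
  (isBasis : IsBasis A {suc e-1} (λ i → Exp._^_ (Algebra.semiring A) t (toℕ i))) where
  private
    e = suc e-1
    module KF = DiscretelyValuedField K
    module K = CommutativeRing KF.ring
    module v = Valuation KF.ring KF.valuation
    module ιH = RingHomomorphism (Algebra.structure A)
  open Algebra A hiding (zero) renaming (refl to ≈-refl; sym to ≈-sym; trans to ≈-trans)
  open AlgebraCombinations A
  open Exp semiring using (_^_; ^-homo-*; ^-assocʳ; ^-congˡ)
  open Exp K.semiring using () renaming (_^_ to _^ᴷ_)
  open CMonSum +-commutativeMonoid using (sum-remove)
  open IntegerCoefficientSolver ring
  open IsBasis isBasis

  private
    powers : Vector Carrier e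
    powers i = t ^ toℕ i

    coords : Carrier → Vector K.Carrier e
    coords x = proj₁ (spanning x)

    coords-expand : ∀ x → x ≈ combination (coords x) powers
    coords-expand x = proj₂ (spanning x)

    coords-unique : ∀ {x} (κ : Vector K.Carrier e) → x ≈ combination κ powers → ∀ i → coords x i K.≈ κ i
    coords-unique {x} κ eq i = K.trans (S.solve 2 (λ x y → x S.:= (x S.:- y) S.:+ y) K.refl (coords x i) (κ i))
      (K.trans (K.+-congʳ (independent (λ i → coords x i K.- κ i) (≈-trans (combination-sub (coords x) κ powers)
        (≈-trans (+-cong (≈-trans (≈-sym (coords-expand x)) eq) ≈-refl) (-‿inverseʳ _))) i)) (K.+-identityˡ _))
      where module S = IntegerCoefficientSolver KF.ring

    shift : ℤ∞ → ℕ → ℤ∞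
    shift x i = Maybe.map (λ n → + e ℤ.* n ℤ.+ + i) x

    shift-mono : ∀ {x y} i → x ≤⁺ y → shift x i ≤⁺ shift y i
    shift-mono i [ p ]   = [ ℤ.+-monoˡ-≤ (+ i) (ℤ.*-monoˡ-≤-nonNeg (+ e) p) ]
    shift-mono i (_ ≤⊤⁺) = _ ≤⊤⁺

    shift-+ : ∀ {N M} x y i j → fin N ≤⁺ shift x i → fin M ≤⁺ shift y j → fin (N ℤ.+ M) ≤⁺ shift (x +∞ y) (i ℕ.+ j)
    shift-+ (fin m) (fin n) i j [ p ] [ q ] = [ ≡.subst (_ ℤ.≤_)
      (S.solve 5 (λ e m n i j → (e S.:* m S.:+ i) S.:+ (e S.:* n S.:+ j) S.:= e S.:* (m S.:+ n) S.:+ (i S.:+ j)) refl (+ e) m n (+ i) (+ j))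
      (ℤ.+-mono-≤ p q) ]
      where module S = ℤSolver.+-*-Solver
    shift-+ (fin m) ⊤⁺      i j p q = _ ≤⊤⁺
    shift-+ ⊤⁺      y       i j p q = _ ≤⊤⁺

    minimum : ∀ {n} → Vector ℤ∞ n → ℤ∞
    minimum = Vector.foldr _⊓∞_ ⊤⁺

    ≤minimum⁺ : ∀ {n} (f : Vector ℤ∞ n) {N} → (∀ i → fin N ≤⁺ f i) → fin N ≤⁺ minimum f
    ≤minimum⁺ {zero}  f h = _ ≤⊤⁺
    ≤minimum⁺ {suc n} f h = Min∞.⊓-glb (h zero) (≤minimum⁺ (f ∘ suc) (h ∘ suc))

    ≤minimum⁻ : ∀ {n} (f : Vector ℤ∞ n) {N} → fin N ≤⁺ minimum f → ∀ i → fin N ≤⁺ f i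
    ≤minimum⁻ {suc n} f p zero    = ≤∞.trans p (Min∞.x⊓y≤x (f zero) (minimum (f ∘ suc)))
    ≤minimum⁻ {suc n} f p (suc i) = ≤minimum⁻ (f ∘ suc) (≤∞.trans p (Min∞.x⊓y≤y (f zero) (minimum (f ∘ suc)))) i

    term : K.Carrier → ℕ → ℤ∞
    term x i = shift (v.v x) i

    term-+ : ∀ {N x y} i → fin N ≤⁺ term x i → fin N ≤⁺ term y i → fin N ≤⁺ term (x K.+ y) i
    term-+ {N} {x} {y} i p q with TotalOrder.total ℤ∞-totalOrder (v.v x) (v.v y)
    ... | inj₁ x≤y = ≤∞.trans p (shift-mono i (≤∞.trans (Min∞.⊓-glb ≤∞.refl x≤y) (v.v-+ x y)))
    ... | inj₂ y≤x = ≤∞.trans q (shift-mono i (≤∞.trans (Min∞.⊓-glb y≤x ≤∞.refl) (v.v-+ x y)))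

    term-cong : ∀ {x y} i → x K.≈ y → term x i ≡ term y i
    term-cong i x≈y = ≡.cong (λ z → shift z i) (v.v-cong x≈y)

    term-0 : ∀ {x N} i → x K.≈ K.0# → fin N ≤⁺ term x i
    term-0 i x≈0 = ≡.subst (_ ≤⁺_) (≡.sym (≡.cong (λ z → shift z i) (≡.trans (v.v-cong x≈0) v.v0))) (_ ≤⊤⁺)

    term-all⇒≈0 : ∀ {x} i → (∀ N → fin N ≤⁺ term x i) → x K.≈ K.0#
    term-all⇒≈0 {x} i h = v.v≡∞⇒≈0 (go (v.v x) h)
      where
      go : ∀ z → (∀ N → fin N ≤⁺ shift z i) → z ≡ ⊤⁺
      go (fin n) h with () ← n≤∞ h
      go ⊤⁺      h = refl

    val : Carrier → ℤ∞
    val x = minimum (λ i → term (coords x i) (toℕ i))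

    infix 4 _≤ₐ_
    -- Bounds on every coordinate stand in for the minimum `val`: they pass through sums and
    -- products without asking which coordinate attains it.
    _≤ₐ_ : ℤ → Carrier → Set
    N ≤ₐ x = ∀ i → fin N ≤⁺ term (coords x i) (toℕ i)

    -- `coords` is a choice made by `spanning`; by independence every other expansion has the same
    -- coefficients and may be used instead.
    ≤ₐ-from : ∀ {N x} (κ : Vector K.Carrier e) → x ≈ combination κ powers →
              (∀ i → fin N ≤⁺ term (κ i) (toℕ i)) → N ≤ₐ x
    ≤ₐ-from κ eq h i = ≡.subst (_ ≤⁺_) (≡.sym (term-cong (toℕ i) (coords-unique κ eq i))) (h i)

    ≤ₐ-resp : ∀ {N x y} → x ≈ y → N ≤ₐ x → N ≤ₐ y
    ≤ₐ-resp {x = x} x≈y h = ≤ₐ-from (coords x) (≈-trans (≈-sym x≈y) (coords-expand x)) h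

    ≤ₐ-+ : ∀ {N x y} → N ≤ₐ x → N ≤ₐ y → N ≤ₐ x + y
    ≤ₐ-+ {N} {x} {y} p q = ≤ₐ-from (λ i → coords x i K.+ coords y i)
      (≈-trans (+-cong (coords-expand x) (coords-expand y)) (≈-trans (≈-sym (∑-distrib-+ (λ i → ι (coords x i) * powers i) (λ i → ι (coords y i) * powers i)))
        (sum-cong-≋ {e} λ i → ≈-trans (≈-sym (distribʳ (powers i) _ _)) (*-congʳ (≈-sym (ιH.+-homo (coords x i) (coords y i)))))))
      (λ i → term-+ {N} {coords x i} {coords y i} (toℕ i) (p i) (q i))

    ≤ₐ-0 : ∀ {N x} → x ≈ 0# → N ≤ₐ x
    ≤ₐ-0 {N} {x} x≈0 = ≤ₐ-from (λ _ → K.0#) (≈-trans x≈0 (≈-sym (combination-0 {e} powers (λ _ → K.refl)))) (λ i → term-0 (toℕ i) K.refl)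

    ≤ₐ-sum : ∀ {n N} (f : Vector Carrier n) → (∀ i → N ≤ₐ f i) → N ≤ₐ sum f
    ≤ₐ-sum {zero}  f h = ≤ₐ-0 ≈-refl
    ≤ₐ-sum {suc n} f h = ≤ₐ-+ (h zero) (≤ₐ-sum (f ∘ suc) (h ∘ suc))

    ≤ₐ-neg : ∀ {N x} → N ≤ₐ x → N ≤ₐ - x
    ≤ₐ-neg {N} {x} h = ≤ₐ-from (λ i → K.0# K.- coords x i)
      (≈-trans (≈-trans (≈-sym (+-identityˡ _)) (+-cong (≈-sym (combination-0 {e} powers (λ _ → K.refl))) (-‿cong (coords-expand x))))
        (≈-sym (combination-sub (λ _ → K.0#) (coords x) powers)))
      (λ i → ≡.subst (_ ≤⁺_) (≡.cong (λ z → shift z (toℕ i)) (≡.sym (≡.trans (v.v-cong (K.+-identityˡ _)) (v.v-neg (coords x i))))) (h i))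

    module _ (x : K.Carrier) (i : Fin e) where
      private
        κ : Vector K.Carrier e
        κ = Vector.insertAt (λ _ → K.0#) i x
        κ-i : κ i ≡ x
        κ-i = VecF.insertAt-lookup (λ _ → K.0#) i x
        κ-other : ∀ j → κ (punchIn i j) ≡ K.0#
        κ-other = VecF.insertAt-punchIn (λ _ → K.0#) i x
        expand : ι x * powers i ≈ combination κ powers
        expand = ≈-sym (≈-trans (sum-remove {i = i} (λ j → ι (κ j) * powers j)) (≈-trans (+-cong (*-congʳ (reflexive (≡.cong ι κ-i)))
          (combination-0 {k = κ ∘ punchIn i} (powers ∘ punchIn i) (λ j → K.reflexive (κ-other j)))) (+-identityʳ _)))

      monomial-≤ₐ⁺ : ∀ {N} → fin N ≤⁺ term x (toℕ i) → N ≤ₐ ι x * powers i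
      monomial-≤ₐ⁺ {N} p = ≤ₐ-from κ expand (λ j → go j (i Fin.≟ j))
        where
        go : ∀ j → Dec (i ≡ j) → fin N ≤⁺ term (κ j) (toℕ j)
        go j (yes refl) = ≡.subst (λ z → fin N ≤⁺ term z (toℕ i)) (≡.sym κ-i) p
        go j (no i≢j)   = ≡.subst (λ j → fin N ≤⁺ term (κ j) (toℕ j)) (Fin.punchIn-punchOut i≢j)
          (term-0 (toℕ (punchIn i (punchOut i≢j))) (K.reflexive (κ-other (punchOut i≢j))))

      monomial-≤ₐ⁻ : ∀ {N} → N ≤ₐ ι x * powers i → fin N ≤⁺ term x (toℕ i)
      monomial-≤ₐ⁻ p = ≡.subst (_ ≤⁺_) (term-cong (toℕ i) (K.trans (coords-unique κ expand i) (K.reflexive κ-i))) (p i)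

    module _ (x : K.Carrier) (n : ℕ) where
      private
        i = Fin.fromℕ< (ℕ.m%n<n n e)
        j = n ℕ./ e
        y = x K.* π ^ᴷ j
        ι-^ : ∀ j → ι (π ^ᴷ j) ≈ ι π ^ j
        ι-^ zero    = ιH.1#-homo
        ι-^ (suc j) = ≈-trans (ιH.*-homo π _) (*-congˡ (ι-^ j))
        reduce : ι x * t ^ n ≈ ι y * powers i
        reduce = begin
          ι x * t ^ n   ≡⟨ ≡.cong (λ k → ι x * t ^ k) (≡.trans (ℕ.m≡m%n+[m/n]*n n e) (≡.cong₂ ℕ._+_ (≡.sym (Fin.toℕ-fromℕ< (ℕ.m%n<n n e))) (ℕ.*-comm j e))) ⟩
          ι x * t ^ (toℕ i ℕ.+ e ℕ.* j)   ≈⟨ *-congˡ (^-homo-* t (toℕ i) (e ℕ.* j)) ⟩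
          ι x * (powers i * t ^ (e ℕ.* j))    ≈⟨ *-congˡ (*-congˡ (^-assocʳ t e j)) ⟨
          ι x * (powers i * (t ^ e) ^ j)      ≈⟨ *-congˡ (*-congˡ (≈-trans (^-congˡ j t^e≈π) (≈-sym (ι-^ j)))) ⟩
          ι x * (powers i * ι (π ^ᴷ j))   ≈⟨ solve 3 (λ x p q → x :* (p :* q) := (x :* q) :* p) ≈-refl (ι x) (powers i) (ι (π ^ᴷ j)) ⟩
          ι x * ι (π ^ᴷ j) * powers i   ≈⟨ *-congʳ (ιH.*-homo x (π ^ᴷ j)) ⟨
          ι y * powers i   ∎
          where open SetoidReasoning setoid
        -- Replacing t^(e j) by π^j lowers the exponent by e j and raises v by j, which counts
        -- e-fold. This is where v(π) = 1 is used.
        v-y : term y (toℕ i) ≡ term x n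
        v-y = ≡.trans (≡.cong (λ z → shift z (toℕ i)) (≡.trans (v.v-* x (π ^ᴷ j)) (≡.cong (v.v x +∞_) (≡.trans (v.v-^ j v-π) (≡.cong fin (ℤ.*-identityʳ (+ j)))))))
          (go (v.v x))
          where
          go : ∀ z → shift (z +∞ fin (+ j)) (toℕ i) ≡ shift z n
          go (fin m) = ≡.cong fin (≡.trans
            (S.solve 4 (λ e m j i → e S.:* (m S.:+ j) S.:+ i S.:= e S.:* m S.:+ (i S.:+ j S.:* e)) refl (+ e) m (+ j) (+ toℕ i))
            (≡.cong (λ k → + e ℤ.* m ℤ.+ k) (≡.trans (≡.cong₂ ℤ._+_ (≡.cong +_ (Fin.toℕ-fromℕ< (ℕ.m%n<n n e))) (≡.sym (ℤ.pos-* j e))) (≡.cong +_ (≡.sym (ℕ.m≡m%n+[m/n]*n n e))))))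
            where module S = ℤSolver.+-*-Solver
          go ⊤⁺      = refl

      power-≤ₐ⁺ : ∀ {N} → fin N ≤⁺ term x n → N ≤ₐ ι x * t ^ n
      power-≤ₐ⁺ p = ≤ₐ-resp (≈-sym reduce) (monomial-≤ₐ⁺ y i (≡.subst (_ ≤⁺_) (≡.sym v-y) p))

      power-≤ₐ⁻ : ∀ {N} → N ≤ₐ ι x * t ^ n → fin N ≤⁺ term x n
      power-≤ₐ⁻ p = ≡.subst (_ ≤⁺_) v-y (monomial-≤ₐ⁻ y i (≤ₐ-resp reduce p))

    monomial-*-≤ₐ : ∀ {N M} a i {y} → fin N ≤⁺ term a i → M ≤ₐ y → (N ℤ.+ M) ≤ₐ (ι a * t ^ i) * y
    monomial-*-≤ₐ {N} {M} a i {y} p q = ≤ₐ-resp (≈-sym (≈-trans (*-congˡ (coords-expand y)) (*-distribˡ-sum (ι a * t ^ i) (λ j → ι (coords y j) * powers j))))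
      (≤ₐ-sum (λ j → (ι a * t ^ i) * (ι (coords y j) * powers j)) λ j → ≤ₐ-resp (≈-sym (product j))
        (power-≤ₐ⁺ (a K.* coords y j) (i ℕ.+ toℕ j)
          (≡.subst (λ z → _ ≤⁺ shift z (i ℕ.+ toℕ j)) (≡.sym (v.v-* a (coords y j))) (shift-+ (v.v a) (v.v (coords y j)) i (toℕ j) p (q j)))))
      where
      product : ∀ j → (ι a * t ^ i) * (ι (coords y j) * powers j) ≈ ι (a K.* coords y j) * t ^ (i ℕ.+ toℕ j)
      product j = ≈-trans (solve 4 (λ a s b r → (a :* s) :* (b :* r) := (a :* b) :* (s :* r)) ≈-refl (ι a) (t ^ i) (ι (coords y j)) (powers j))
        (*-cong (≈-sym (ιH.*-homo a (coords y j))) (≈-sym (^-homo-* t i (toℕ j))))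

    ≤ₐ-* : ∀ {N M x y} → N ≤ₐ x → M ≤ₐ y → (N ℤ.+ M) ≤ₐ x * y
    ≤ₐ-* {x = x} {y} p q = ≤ₐ-resp (≈-sym (≈-trans (*-congʳ (coords-expand x)) (*-distribʳ-sum y (λ i → ι (coords x i) * powers i))))
      (≤ₐ-sum (λ i → (ι (coords x i) * powers i) * y) λ i → monomial-*-≤ₐ (coords x i) (toℕ i) (p i) q)

    term-fin : ∀ {x m} i → term x i ≡ fin m → ∃[ n ] v.v x ≡ fin n × m ≡ + e ℤ.* n ℤ.+ + i
    term-fin {x} i eq with v.v x
    term-fin i refl | fin n = n , refl , refl
    term-fin i ()   | ⊤⁺

    -- A single coordinate attains the minimum, since the finite values of the terms are distinct
    -- modulo e. Splitting off that term reduces multiplicativity to monomials.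
    record Leading (x : Carrier) (m : ℤ) : Set (c ⊔ a ⊔ b) where
      field
        lead   : K.Carrier
        index  : ℕ
        v-lead : term lead index ≡ fin m
        rest   : Carrier
        expand : x ≈ ι lead * t ^ index + rest
        1+m≤   : (1ℤ ℤ.+ m) ≤ₐ rest

    leading : ∀ {x m} → val x ≡ fin m → Leading x m
    leading {x} {m} eq with Fin.all? (λ i → (1ℤ ℤ.+ m) ≤∞? term (coords x i) (toℕ i))
    ... | yes h = ⊥-elim (1+n≰∞ eq (≤minimum⁺ (λ i → term (coords x i) (toℕ i)) h))
    ... | no ¬h = record { lead = coords x i ; index = toℕ i ; v-lead = v-lead ; rest = sum (others ∘ punchIn i)
        ; expand = ≈-trans (coords-expand x) (sum-remove {i = i} others) ; 1+m≤ = ≤ₐ-sum (others ∘ punchIn i) (λ j →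
            monomial-≤ₐ⁺ (coords x (punchIn i j)) (punchIn i j) (above j)) }
      where
      found = Fin.¬∀⟶∃¬ e _ (λ i → (1ℤ ℤ.+ m) ≤∞? term (coords x i) (toℕ i)) ¬h
      i = proj₁ found
      m≤x : m ≤ₐ x
      m≤x = ≤minimum⁻ (λ i → term (coords x i) (toℕ i)) (≤∞.reflexive (≡.sym eq))
      v-lead : term (coords x i) (toℕ i) ≡ fin m
      v-lead = ≤∞-exact (m≤x i) (proj₂ found)
      others : Vector Carrier e
      others j = ι (coords x j) * powers j
      above : ∀ j → fin (1ℤ ℤ.+ m) ≤⁺ term (coords x (punchIn i j)) (toℕ (punchIn i j))
      above j = decidable-stable ((1ℤ ℤ.+ m) ≤∞? _) λ ≰ →
        let eq₁ = term-fin (toℕ i) v-lead ; eq₂ = term-fin (toℕ (punchIn i j)) (≤∞-exact (m≤x (punchIn i j)) ≰) in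
        Fin.punchInᵢ≢i i j (Fin.toℕ-injective (remainder-unique e (proj₁ eq₂) (proj₁ eq₁) (Fin.toℕ<n (punchIn i j)) (Fin.toℕ<n i)
          (≡.trans (≡.sym (proj₂ (proj₂ eq₂))) (proj₂ (proj₂ eq₁)))))

    ≤ₐ⇒≤val : ∀ {N} x → N ≤ₐ x → fin N ≤⁺ val x
    ≤ₐ⇒≤val x = ≤minimum⁺ (λ i → term (coords x i) (toℕ i))

    ≤val⇒≤ₐ : ∀ {N} x → fin N ≤⁺ val x → N ≤ₐ x
    ≤val⇒≤ₐ x = ≤minimum⁻ (λ i → term (coords x i) (toℕ i))

    -- The product of the leading terms differs from x y by elements of value at least m + n + 1,
    -- while its own value is exactly m + n.
    product-exact : ∀ {x y m n} → Leading x m → m ≤ₐ x → Leading y n → ¬ (1ℤ ℤ.+ (m ℤ.+ n)) ≤ₐ x * y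
    product-exact {x} {y} {m} {n} X m≤x Y p = contra (term-fin X.index X.v-lead) (term-fin Y.index Y.v-lead)
      where
      module X = Leading X
      module Y = Leading Y
      mono-x = ι X.lead * t ^ X.index
      mono-y = ι Y.lead * t ^ Y.index
      product : ι (X.lead K.* Y.lead) * t ^ (X.index ℕ.+ Y.index) ≈ x * y + - (mono-y * X.rest + x * Y.rest)
      product = begin
        ι (X.lead K.* Y.lead) * t ^ (X.index ℕ.+ Y.index)
          ≈⟨ *-cong (ιH.*-homo X.lead Y.lead) (^-homo-* t X.index Y.index) ⟩
        (ι X.lead * ι Y.lead) * (t ^ X.index * t ^ Y.index)
          ≈⟨ solve 6 (λ a b s r x′ y′ → (a :* b) :* (s :* r) :=
               (a :* s :+ x′) :* (b :* r) :- b :* r :* x′) ≈-refl (ι X.lead) (ι Y.lead) (t ^ X.index) (t ^ Y.index) X.rest Y.rest ⟩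
        (mono-x + X.rest) * mono-y - mono-y * X.rest
          ≈⟨ +-congʳ (*-congʳ (≈-sym X.expand)) ⟩
        x * mono-y - mono-y * X.rest
          ≈⟨ solve 4 (λ x u r z → x :* u :- z := x :* (u :+ r) :+ (:- (z :+ x :* r))) ≈-refl x mono-y Y.rest (mono-y * X.rest) ⟩
        x * (mono-y + Y.rest) + - (mono-y * X.rest + x * Y.rest)
          ≈⟨ +-congʳ (*-congˡ (≈-sym Y.expand)) ⟩
        x * y + - (mono-y * X.rest + x * Y.rest) ∎
        where open SetoidReasoning setoid
      1+ : ∀ {N z} → N ≡ 1ℤ ℤ.+ (m ℤ.+ n) → N ≤ₐ z → (1ℤ ℤ.+ (m ℤ.+ n)) ≤ₐ z
      1+ refl h = h
      high : fin (1ℤ ℤ.+ (m ℤ.+ n)) ≤⁺ term (X.lead K.* Y.lead) (X.index ℕ.+ Y.index)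
      high = power-≤ₐ⁻ (X.lead K.* Y.lead) (X.index ℕ.+ Y.index) (≤ₐ-resp (≈-sym product) (≤ₐ-+ p (≤ₐ-neg (≤ₐ-+
        (1+ (S.solve 2 (λ m n → n S.:+ (S.con 1ℤ S.:+ m) S.:= S.con 1ℤ S.:+ (m S.:+ n)) refl m n)
          (monomial-*-≤ₐ Y.lead Y.index (≤∞.reflexive (≡.sym Y.v-lead)) X.1+m≤))
        (1+ (S.solve 2 (λ m n → m S.:+ (S.con 1ℤ S.:+ n) S.:= S.con 1ℤ S.:+ (m S.:+ n)) refl m n) (≤ₐ-* m≤x Y.1+m≤))))))
        where module S = ℤSolver.+-*-Solver
      contra : ∃[ α ] v.v X.lead ≡ fin α × m ≡ + e ℤ.* α ℤ.+ + X.index → ∃[ β ] v.v Y.lead ≡ fin β × n ≡ + e ℤ.* β ℤ.+ + Y.index → ⊥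
      contra (α , vα , m≡) (β , vβ , n≡) = 1+n≰∞ (≡.trans (≡.cong (λ z → shift z (X.index ℕ.+ Y.index)) (v.v≡* vα vβ))
        (≡.cong fin (≡.trans (S.solve 5 (λ e m n i j → e S.:* (m S.:+ n) S.:+ (i S.:+ j) S.:= (e S.:* m S.:+ i) S.:+ (e S.:* n S.:+ j))
          refl (+ e) α β (+ X.index) (+ Y.index)) (≡.cong₂ ℤ._+_ (≡.sym m≡) (≡.sym n≡))))) high
        where module S = ℤSolver.+-*-Solver

    val-cong : ∀ {x y} → x ≈ y → val x ≡ val y
    val-cong {x} {y} x≈y = ≤∞-extensional (λ N p → ≤ₐ⇒≤val y (≤ₐ-resp x≈y (≤val⇒≤ₐ x p)))
                                          (λ N p → ≤ₐ⇒≤val x (≤ₐ-resp (≈-sym x≈y) (≤val⇒≤ₐ y p)))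

    val∞⇒≈0 : ∀ x → val x ≡ ⊤⁺ → x ≈ 0#
    val∞⇒≈0 x eq = ≈-trans (coords-expand x) (combination-0 {k = coords x} powers λ i →
      term-all⇒≈0 (toℕ i) (λ N → ≤val⇒≤ₐ x (≡.subst (fin N ≤⁺_) (≡.sym eq) (_ ≤⊤⁺)) i))

    ≈0⇒val∞ : ∀ x → x ≈ 0# → val x ≡ ⊤⁺
    ≈0⇒val∞ x x≈0 = n≤∞ λ N → ≤ₐ⇒≤val x (≤ₐ-0 x≈0)

    val-* : ∀ x y → val (x * y) ≡ val x +∞ val y
    val-* x y = go (val x) (val y) refl refl
      where
      go : ∀ m n → val x ≡ m → val y ≡ n → val (x * y) ≡ m +∞ n
      go (fin m) (fin n) p q = ≤∞-exact (≤ₐ⇒≤val (x * y) (≤ₐ-* m≤x (≤val⇒≤ₐ y (≤∞.reflexive (≡.sym q)))))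
        (λ r → product-exact (leading p) m≤x (leading q) (≤val⇒≤ₐ (x * y) r))
        where
        m≤x : m ≤ₐ x
        m≤x = ≤val⇒≤ₐ x (≤∞.reflexive (≡.sym p))
      go (fin m) ⊤⁺ p q = ≈0⇒val∞ (x * y) (≈-trans (*-congˡ (val∞⇒≈0 y q)) (zeroʳ x))
      go ⊤⁺      n  p q = ≈0⇒val∞ (x * y) (≈-trans (*-congʳ (val∞⇒≈0 x p)) (zeroˡ y))

    val-power : ∀ x n → val (ι x * t ^ n) ≡ term x n
    val-power x n = ≤∞-extensional (λ N p → power-≤ₐ⁻ x n (≤val⇒≤ₐ (ι x * t ^ n) p)) (λ N p → ≤ₐ⇒≤val (ι x * t ^ n) (power-≤ₐ⁺ x n p))

  valuation : DiscreteValuation (Algebra.ring A)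
  valuation = record
    { v      = val
    ; v-cong = val-cong
    ; v-∞    = λ x → mk⇔ (val∞⇒≈0 x) (≈0⇒val∞ x)
    ; v-*    = val-*
    ; v-+    = λ x y → ≤∞-from-below λ N p → ≤ₐ⇒≤val (x + y) (≤ₐ-+
        (≤val⇒≤ₐ x (≤∞.trans p (Min∞.x⊓y≤x (val x) (val y)))) (≤val⇒≤ₐ y (≤∞.trans p (Min∞.x⊓y≤y (val x) (val y)))))
    -- Division with remainder, n = e (n / e) + n % e with 0 ≤ n % e < e, valid for negative n as
    -- well.
    ; onto   = λ n → ι (proj₁ (v.onto (n ℤ./ℕ e))) * t ^ (n ℤ.%ℕ e) , ≡.trans (val-power _ (n ℤ.%ℕ e))
        (≡.trans (≡.cong (λ z → shift z (n ℤ.%ℕ e)) (proj₂ (v.onto (n ℤ./ℕ e)))) (≡.cong fin (≡.trans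
          (≡.trans (ℤ.+-comm (+ e ℤ.* (n ℤ./ℕ e)) _) (≡.cong (λ z → + (n ℤ.%ℕ e) ℤ.+ z) (ℤ.*-comm (+ e) (n ℤ./ℕ e)))) (≡.sym (ℤ.a≡a%ℕn+[a/ℕn]*n n e)))))
    }

  ramified : ∀ x → DiscreteValuation.v valuation (ι x) ≡ Maybe.map (+ e ℤ.*_) (KF.v x)
  ramified x = ≡.trans (val-cong (≈-sym (*-identityʳ (ι x)))) (≡.trans (val-power x 0) (go (KF.v x)))
    where
    go : ∀ z → shift z 0 ≡ Maybe.map (+ e ℤ.*_) z
    go (fin n) = ≡.cong fin (ℤ.+-identityʳ _)
    go ⊤⁺      = refl

-- The algebras R[T]/(f) and K[T]/(T^e - π).

module AdjoinRoot {c ℓ} (R : CommutativeRing c ℓ) (f : Polynomial.Poly R) where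
  private
    module R = CommutativeRing R
    A = Polynomial.adjoinRoot R f
  open Polynomial R using (Poly; T; evaluate; const; _⊕_; ⊖_; _⊗_; _∣_; _≋_; mk≋; coeff-≈; coeff)
  open PolynomialFacts R
  open Algebra A hiding (zero) renaming (refl to ≈-refl; sym to ≈-sym; trans to ≈-trans)
  open AlgebraCombinations A
  open Exp semiring using (_^_)
  open SetoidReasoning setoid

  ≋⇒≈ : ∀ {g h} → g ≋ h → g ≈ h
  ≋⇒≈ {g} {h} e = [] ,ᵈ P.trans (P.zeroˡ f) (P.sym (P.trans (P.+-congʳ {⊖ h} e) (P.-‿inverseʳ h)))

  ∣⇒≈0 : ∀ {g} → f ∣ g → g ≈ []
  ∣⇒≈0 {g} (q ,ᵈ e) = q ,ᵈ P.trans e (P.sym (P.+-identityʳ g))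

  ≈0⇒∣ : ∀ {g} → g ≈ [] → f ∣ g
  ≈0⇒∣ {g} (q ,ᵈ e) = q ,ᵈ P.trans e (P.+-identityʳ g)

  evaluate-T≈ : ∀ g → evaluate A g T ≈ g
  evaluate-T≈ []      = ≈-refl {[]}
  evaluate-T≈ (a ∷ g) = begin
    const a + T * evaluate A g T   ≈⟨ +-congˡ {const a} {T * evaluate A g T} {T * g} (*-congˡ {T} {evaluate A g T} {g} (evaluate-T≈ g)) ⟩
    const a + T * g   ≈⟨ ≋⇒≈ {const a ⊕ T ⊗ g} {a ∷ g} (P.trans (P.+-congˡ {const a} (T⊗ g))
                                        (mk≋ λ { zero → R.+-identityʳ a ; (suc n) → R.refl })) ⟩
    a ∷ g   ∎

  root : evaluate A f T ≈ []
  root = begin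
    evaluate A f T   ≈⟨ evaluate-T≈ f ⟩
    f   ≈⟨ ∣⇒≈0 (const R.1# ,ᵈ P.*-identityˡ f) ⟩
    []   ∎

  -- Remainders modulo f give spanning. A vanishing combination is a multiple of f of degree below
  -- d, hence zero by `multiple-below⇒0`.
  powers-basis : ∀ {d} → Monic d f → IsBasis A {d} (λ i → T ^ toℕ i)
  powers-basis {d} monic = record { spanning = spanning ; independent = independent }
    where
    open Evaluation A T
    powers : Vector Carrier d
    powers i = T ^ toℕ i
    spanning : ∀ g → Σ (Vector R.Carrier d) λ k → g ≈ combination k powers
    spanning g with q , r , e ← divide monic g = r , (begin
      g   ≈⟨ evaluate-T≈ g ⟨
      evaluate A g T   ≈⟨ evaluate-cong {g} {(q ⊗ f) ⊕ fromVector r} e ⟩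
      evaluate A ((q ⊗ f) ⊕ fromVector r) T   ≈⟨ evaluate-⊕ (q ⊗ f) (fromVector r) ⟩
      evaluate A (q ⊗ f) T + evaluate A (fromVector r) T     ≈⟨ +-cong {evaluate A (q ⊗ f) T} {0#} {evaluate A (fromVector r) T} {combination r powers} (multiple q) (evaluate-fromVector r) ⟩
      0# + combination r powers   ≈⟨ +-identityˡ (combination r powers) ⟩
      combination r powers   ∎)
      where
      multiple : ∀ q → evaluate A (q ⊗ f) T ≈ 0#
      multiple q = begin
        evaluate A (q ⊗ f) T   ≈⟨ evaluate-⊗ q f ⟩
        evaluate A q T * evaluate A f T      ≈⟨ *-congˡ {evaluate A q T} {evaluate A f T} {0#} root ⟩
        evaluate A q T * 0#   ≈⟨ zeroʳ (evaluate A q T) ⟩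
        0#   ∎
    independent : IndependentFamily powers
    independent k k≈0 i = conclude (≈0⇒∣ (begin
        fromVector k   ≈⟨ evaluate-T≈ (fromVector k) ⟨
        evaluate A (fromVector k) T   ≈⟨ evaluate-fromVector k ⟩
        combination k powers   ≈⟨ k≈0 ⟩
        []   ∎))
      where
      conclude : f ∣ fromVector k → k i R.≈ R.0#
      conclude (q ,ᵈ e) = R.trans (R.reflexive (≡.sym (coeff-fromVector k i))) (R.trans (R.sym (coeff-≈ e (toℕ i))) (coeff-≈ qf≋[] (toℕ i)))
        where
        qf≋[] : q ⊗ f ≋ []
        qf≋[] = P.trans (P.*-congʳ {f} (multiple-below⇒0 monic q λ n d≤n →
          R.trans (coeff-≈ e n) (fromVector-below k n d≤n))) (P.zeroˡ f)

-- radicalAlgebra is defined relative to a valued field and the exponent of K^×/K^×ᵉ, but only uses the ring.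
module RadicalAlgebra {c ℓ} (K : DiscretelyValuedField c ℓ) (e-1 : ℕ) (π : DiscretelyValuedField.Carrier K) where
  private
    e = suc e-1
    module K = CommutativeRing (DiscretelyValuedField.ring K)
  open Polynomial (DiscretelyValuedField.ring K) using (Poly; T; evaluate; const; _⊕_; ⊖_; _⊗_; _≋_; mk≋; coeff-≈; coeff) renaming (_^_ to _^ᴾ_)
  open PolynomialFacts (DiscretelyValuedField.ring K)

  A : Algebra (DiscretelyValuedField.ring K) c (c ⊔ ℓ)
  A = radicalAlgebra K e π

  f : Poly
  f = (T ^ᴾ e) ⊕ (⊖ const π)

  private
    coeff-T^ : ∀ n → coeff (T ^ᴾ n) n K.≈ K.1# × BelowDegree (suc n) (T ^ᴾ n)
    coeff-T^ zero    = K.refl , λ { (suc n) _ → K.refl }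
    coeff-T^ (suc n) = K.trans (coeff-≈ (T⊗ (T ^ᴾ n)) (suc n)) (proj₁ (coeff-T^ n)) ,
      λ { (suc m) (ℕ.s≤s p) → K.trans (coeff-≈ (T⊗ (T ^ᴾ n)) (suc m)) (proj₂ (coeff-T^ n) m p) }

  f-monic : Monic e f
  f-monic = K.trans (coeff-⊕ (T ^ᴾ e) (⊖ const π) e) (K.trans (K.+-identityʳ _) (proj₁ (coeff-T^ e))) ,
    λ { (suc n) p → K.trans (coeff-⊕ (T ^ᴾ e) (⊖ const π) (suc n)) (K.trans (K.+-identityʳ _) (proj₂ (coeff-T^ e) (suc n) p)) }

  open AdjoinRoot (DiscretelyValuedField.ring K) f public using (powers-basis; evaluate-T≈; ≈0⇒∣; ∣⇒≈0)

  private module A = Algebra A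
  open Exp A.semiring using (_^_)

  basis : IsBasis A {e} (λ i → T ^ toℕ i)
  basis = powers-basis f-monic

  evaluate-f : ∀ {a b} (B : Algebra (DiscretelyValuedField.ring K) a b) x →
               Algebra._≈_ B (evaluate B f x) (Algebra._-_ B (Exp._^_ (Algebra.semiring B) x e) (Algebra.ι B π))
  evaluate-f B x = B.trans (evaluate-⊕ (T ^ᴾ e) (⊖ const π)) (B.+-cong (evaluate-T^ e)
      (B.trans (evaluate-⊖ (const π)) (B.-‿cong (evaluate-const π))))
    where
    module B = Algebra B
    open Evaluation B x

  abstract
    T^e≈π : (T ^ e) A.≈ A.ι π
    T^e≈π = x∙y⁻¹≈ε⇒x≈y (T ^ e) (A.ι π) (begin
      (T ^ e) A.- A.ι π   ≈⟨ evaluate-f A T ⟨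
      evaluate A f T      ≈⟨ AdjoinRoot.root (DiscretelyValuedField.ring K) f ⟩
      A.0#   ∎)
      where
      open AbelianGroupProps A.+-abelianGroup using (x∙y⁻¹≈ε⇒x≈y)
      open SetoidReasoning A.setoid

  module _ (v-π : DiscretelyValuedField.v K π ≡ fin 1ℤ) where
    open RadicalValuation K A e-1 {π} v-π T T^e≈π basis using () renaming (valuation to w; ramified to w-ramified) public

    open TameAlgebra K A w e-1 w-ramified ((λ i → T ^ toℕ i) , basis)

    totallyRamified : (∀ d → d ℕ.∣ e → ¬ Mult._×_ K.semiring d K.1# K.≈ K.0#) → TotallyRamifiedExtension K e
    totallyRamified d≉0 = record
      { algebra = A ; algebra-isField = isField ; separable = isSeparable d≉0
      ; degree = (λ i → T ^ toℕ i) , basis ; ramification = w , w-ramified }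

-- From an extension to a uniformiser: e-th roots in totally ramified extensions.

module PowerIdentities {c ℓ} (R : CommutativeRing c ℓ) where
  open CommutativeRing R hiding (zero) renaming (refl to ≈-refl; sym to ≈-sym; trans to ≈-trans)
  open Exp semiring using (_^_; ^-congˡ)
  open CommExp commutativeSemiring using (^-distrib-*)
  open IntegerCoefficientSolver R
  open SetoidReasoning setoid

  1^ : ∀ n → 1# ^ n ≈ 1#
  1^ zero    = ≈-refl
  1^ (suc n) = ≈-trans (*-identityˡ _) (1^ n)

  inverse-^ : ∀ {x x⁻¹} n → x * x⁻¹ ≈ 1# → x ^ n * x⁻¹ ^ n ≈ 1#
  inverse-^ {x} {x⁻¹} n e = ≈-trans (≈-sym (^-distrib-* x x⁻¹ n)) (≈-trans (^-congˡ n e) (1^ n))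

  inverse-unique : ∀ {x y z} → x * y ≈ 1# → x * z ≈ 1# → y ≈ z
  inverse-unique {x} {y} {z} xy≈1 xz≈1 = begin
    y   ≈⟨ *-identityʳ y ⟨
    y * 1#   ≈⟨ *-congˡ xz≈1 ⟨
    y * (x * z)  ≈⟨ solve 3 (λ x y z → y :* (x :* z) := (x :* y) :* z) ≈-refl x y z ⟩
    x * y * z    ≈⟨ *-congʳ xy≈1 ⟩
    1# * z   ≈⟨ *-identityˡ z ⟩
    z   ∎

  -- Used with l a uniformiser of L, p one of K, r a unit of K and y the root of the 1-unit l^e / (p
  -- r): dividing l by y leaves an e-th root of p r.
  quotient-root : ∀ {l y y⁻¹ p p⁻¹ r r⁻¹} n → y * y⁻¹ ≈ 1# → p * p⁻¹ ≈ 1# → r * r⁻¹ ≈ 1# →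
                  y ^ n ≈ l ^ n * p⁻¹ * r⁻¹ → (l * y⁻¹) ^ n ≈ p * r
  quotient-root {l} {y} {y⁻¹} {p} {p⁻¹} {r} {r⁻¹} n yy⁻¹ pp⁻¹ rr⁻¹ y^n = begin
    (l * y⁻¹) ^ n   ≈⟨ ^-distrib-* l y⁻¹ n ⟩
    l ^ n * y⁻¹ ^ n   ≈⟨ *-identityʳ _ ⟨
    l ^ n * y⁻¹ ^ n * 1#   ≈⟨ *-congˡ (≈-trans (*-cong pp⁻¹ rr⁻¹) (*-identityˡ 1#)) ⟨
    l ^ n * y⁻¹ ^ n * ((p * p⁻¹) * (r * r⁻¹))
      ≈⟨ solve 6 (λ l y p q r s → l :* y :* ((p :* q) :* (r :* s)) := (p :* r) :* ((l :* q :* s) :* y)) ≈-refl (l ^ n) (y⁻¹ ^ n) p p⁻¹ r r⁻¹ ⟩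
    p * r * (l ^ n * p⁻¹ * r⁻¹ * y⁻¹ ^ n)   ≈⟨ *-congˡ (*-congʳ y^n) ⟨
    p * r * (y ^ n * y⁻¹ ^ n)   ≈⟨ *-congˡ (inverse-^ n yy⁻¹) ⟩
    p * r * 1#   ≈⟨ *-identityʳ _ ⟩
    p * r   ∎

  -- Used in K with uniformisers p and q and a unit x such that p / (q x^e) is the e-th power of y.
  quotient-power : ∀ {p q q⁻¹ x x⁻¹ y} n → q * q⁻¹ ≈ 1# → x * x⁻¹ ≈ 1# →
                   y ^ n ≈ p * q⁻¹ * x⁻¹ ^ n → p ≈ q * (y * x) ^ n
  quotient-power {p} {q} {q⁻¹} {x} {x⁻¹} {y} n qq⁻¹ xx⁻¹ y^n = ≈-sym (begin
    q * (y * x) ^ n   ≈⟨ *-congˡ (^-distrib-* y x n) ⟩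
    q * (y ^ n * x ^ n)   ≈⟨ *-congˡ (*-congʳ y^n) ⟩
    q * (p * q⁻¹ * x⁻¹ ^ n * x ^ n)   ≈⟨ solve 5 (λ q p r d c → q :* (p :* r :* d :* c) := p :* (q :* r) :* (c :* d)) ≈-refl q p q⁻¹ (x⁻¹ ^ n) (x ^ n) ⟩
    p * (q * q⁻¹) * (x ^ n * x⁻¹ ^ n)      ≈⟨ *-cong (*-congˡ qq⁻¹) (inverse-^ n xx⁻¹) ⟩
    p * 1# * 1#   ≈⟨ ≈-trans (*-identityʳ _) (*-identityʳ _) ⟩
    p   ∎)

module TotallyTame {c ℓ} (K : DiscretelyValuedField c ℓ) (e-1 : ℕ) (L : TotallyRamifiedExtension K (suc e-1)) where
  private
    e = suc e-1
    module KF = DiscretelyValuedField K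
    module K = CommutativeRing KF.ring
    module v = Valuation KF.ring KF.valuation
  open TotallyRamifiedExtension L using (algebra; algebra-isField; degree; ramification)
  private
    W = proj₁ ramification
    ramified = proj₂ ramification
    module ιH = RingHomomorphism (Algebra.structure algebra)
  open Algebra algebra hiding (zero) renaming (refl to ≈-refl; sym to ≈-sym; trans to ≈-trans)
  open RamifiedAlgebra K algebra W e-1 ramified
  open AlgebraOverField KF.isField v.zero? algebra
  open Exp semiring using (_^_; ^-congˡ)
  open CommExp commutativeSemiring using (^-distrib-*)
  open Exp K.semiring using () renaming (_^_ to _^ᴷ_)
  open IntegerCoefficientSolver ring
  open PowerIdentities ring
  module Kᵖ = PowerIdentities KF.ring
  open w using (_≤ᵛ_)

  w-root : ∀ {π μ} → v.v π ≡ fin 1ℤ → μ ^ e ≈ ι π → w.v μ ≡ fin 1ℤ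
  w-root {π} {μ} v-π μ^e≈π = go (w.zero? μ)
    where
    wπ : w.v (ι π) ≡ fin (+ e ℤ.* 1ℤ)
    wπ = w-ι v-π
    go : Dec (μ ≈ 0#) → w.v μ ≡ fin 1ℤ
    go (yes μ≈0) = ⊥-elim (w.v≡fin⇒≉0 wπ (≈-trans (≈-sym μ^e≈π) (≈-trans (*-congʳ μ≈0) (zeroˡ _))))
    go (no μ≉0) with m , eq ← w.v-finite μ≉0 = ≡.trans eq (≡.cong fin (ℤ.*-cancelˡ-≡ (+ e) m 1ℤ
      (fin-injective (≡.trans (≡.sym (w.v-^ e eq)) (≡.trans (w.v-cong μ^e≈π) wπ)))))

  module _ {π : K.Carrier} {μ : Carrier} (v-π : v.v π ≡ fin 1ℤ) (μ^e≈π : μ ^ e ≈ ι π) where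
    private
      module Rad = RadicalAlgebra K e-1 π
      module U = UniformiserBasis degree (w-root v-π μ^e≈π)
      open Polynomial KF.ring using (Poly; evaluate; const; _⊕_; ⊖_; _⊗_; _∣_; _≋_)
      open PolynomialFacts KF.ring hiding (module P)
      open Evaluation algebra μ
      module P = CommutativeRing (Polynomial.polynomialRing KF.ring)

      ev : Poly → Carrier
      ev g = evaluate algebra g μ

      root : ev Rad.f ≈ 0#
      root = ≈-trans (Rad.evaluate-f algebra μ) (≈-trans (+-congʳ μ^e≈π) (-‿inverseʳ _))

      minimal : ∀ g → ev g ≈ 0# → Rad.f ∣ g
      minimal = PowerRelation.multiple {degree = degree} (record
        { d = e ; independent = U.independent ; poly = Rad.f ; monic = Rad.f-monic ; root = root })

      difference : ∀ g h → ev (g ⊕ (⊖ h)) ≈ ev g - ev h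
      difference g h = ≈-trans (evaluate-⊕ g (⊖ h)) (+-congˡ (evaluate-⊖ h))

      ev-cong : ∀ {g h} → Rad.f ∣ (g ⊕ (⊖ h)) → ev g ≈ ev h
      ev-cong {g} {h} (q ,ᵈ eq) = x∙y⁻¹≈ε⇒x≈y (ev g) (ev h) (≈-trans (≈-sym (difference g h))
        (≈-trans (≈-sym (evaluate-cong {q ⊗ Rad.f} {g ⊕ (⊖ h)} eq)) (≈-trans (evaluate-⊗ q Rad.f) (≈-trans (*-congˡ root) (zeroʳ _)))))
        where open AbelianGroupProps +-abelianGroup using (x∙y⁻¹≈ε⇒x≈y)

    -- Evaluation at μ. As w(μ) = 1, the powers of μ below e form a basis: their independence makes
    -- T^e - π the minimal polynomial of μ, which gives injectivity, and their spanning gives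
    -- surjectivity.
    root⇒≅ : radicalAlgebra K e π ≅ algebra
    root⇒≅ = record
      { to = ev
      ; isRingIsomorphism = record
        { isRingMonomorphism = record
          { isRingHomomorphism = record
            { isSemiringHomomorphism = record
              { isNearSemiringHomomorphism = record
                { +-isMonoidHomomorphism = record
                  { isMagmaHomomorphism = record
                    { isRelHomomorphism = record { cong = λ {g} {h} → ev-cong {g} {h} }
                    ; homo = evaluate-⊕ }
                  ; ε-homo = ≈-refl }
                ; *-homo = evaluate-⊗ }
              ; 1#-homo = ≈-trans (evaluate-const K.1#) ιH.1#-homo }
            ; -‿homo = evaluate-⊖ }
          ; injective = λ {g} {h} eq → minimal (g ⊕ (⊖ h)) (≈-trans (difference g h) (≈-trans (+-congʳ eq) (-‿inverseʳ _))) }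
        ; surjective = λ y → fromVector (proj₁ (U.spanning y)) , λ {g} eq →
            ≈-trans (ev-cong {g} {fromVector (proj₁ (U.spanning y))} eq)
              (≈-trans (evaluate-fromVector (proj₁ (U.spanning y))) (≈-sym (proj₂ (U.spanning y)))) }
      ; to-ι = evaluate-const }

  module _ (complete : IsComplete K) (v[e]≡0 : v.v (Mult._×_ K.semiring e K.1#) ≡ fin 0ℤ) where
    private
      module HK = Hensel K complete
      module HL = Hensel (extension degree algebra-isField complete) (extension-complete degree algebra-isField complete)

      w[e]≡0 : w.v (Mult._×_ semiring e 1#) ≡ fin 0ℤ
      w[e]≡0 = ≡.trans (w.v-cong (≈-sym (ι-× e))) (≡.trans (w-ι v[e]≡0) (≡.cong fin (ℤ.*-zeroʳ (+ e))))
        where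
        ι-× : ∀ n → ι (Mult._×_ K.semiring n K.1#) ≈ Mult._×_ semiring n 1#
        ι-× zero    = ιH.0#-homo
        ι-× (suc n) = ≈-trans (ιH.+-homo _ _) (+-cong ιH.1#-homo (ι-× n))

      ι-^ : ∀ x n → ι (x ^ᴷ n) ≈ ι x ^ n
      ι-^ x zero    = ιH.1#-homo
      ι-^ x (suc n) = ≈-trans (ιH.*-homo x _) (*-congˡ (ι-^ x n))

      invert : ∀ {x y n} → x * y ≈ 1# → w.v x ≡ fin n → w.v y ≡ fin (ℤ.- n)
      invert {x} {y} {n} xy≈1 vx with m , eq ← w.v-finite {y} (λ y≈0 → w.1≉0 (≈-trans (≈-sym xy≈1) (≈-trans (*-congˡ y≈0) (zeroʳ x)))) =
        ≡.trans eq (≡.cong fin (AbelianGroup.uniqueʳ-⁻¹ ℤ.+-0-abelianGroup n m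
          (fin-injective (≡.trans (≡.sym (w.v≡* vx eq)) (≡.trans (w.v-cong xy≈1) w.v1)))))

      -- A splitting of a unit of L into a unit x of K and a 1-unit of L, possible because L has the
      -- residue field of K.
      record Normalised (u : Carrier) : Set (c ⊔ ℓ) where
        field
          x x⁻¹  : K.Carrier
          v-x    : v.v x ≡ fin 0ℤ
          xx⁻¹≈1 : x K.* x⁻¹ K.≈ K.1#
          1-unit : 1ℤ ≤ᵛ u * ι x⁻¹ - 1#
        ιxx⁻¹≈1 : ι x * ι x⁻¹ ≈ 1#
        ιxx⁻¹≈1 = ≈-trans (≈-sym (ιH.*-homo x x⁻¹)) (≈-trans (ιH.⟦⟧-cong xx⁻¹≈1) ιH.1#-homo)

      ι-inverse : ∀ {x y} → x K.* y K.≈ K.1# → ι x * ι y ≈ 1#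
      ι-inverse {x} {y} e = ≈-trans (≈-sym (ιH.*-homo x y)) (≈-trans (ιH.⟦⟧-cong e) ιH.1#-homo)

      v-from-ι : ∀ {x} → w.v (ι x) ≡ fin 0ℤ → v.v x ≡ fin 0ℤ
      v-from-ι {x} wιx = ≡.trans (proj₂ vx) (≡.cong fin (ℤ.*-cancelˡ-≡ (+ e) (proj₁ vx) 0ℤ
          (≡.trans (fin-injective (≡.trans (≡.sym (w-ι (proj₂ vx))) wιx)) (≡.sym (ℤ.*-zeroʳ (+ e))))))
        where
        vx : ∃[ n ] v.v x ≡ fin n
        vx = v.v-finite λ x≈0 → w.v≡fin⇒≉0 wιx (≈-trans (ιH.⟦⟧-cong x≈0) ιH.0#-homo)

      close-1-unit : ∀ {u x x⁻¹} → 1ℤ ≤ᵛ u - ι x → x K.* x⁻¹ K.≈ K.1# → w.v (ι x⁻¹) ≡ fin 0ℤ → 1ℤ ≤ᵛ u * ι x⁻¹ - 1#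
      close-1-unit {u} {x} {x⁻¹} p xx⁻¹≈1 wιx⁻¹ = w.≤ᵛ-resp
        (≈-trans (solve 3 (λ u x y → (u :- x) :* y := u :* y :- x :* y) ≈-refl u (ι x) (ι x⁻¹)) (+-congˡ (-‿cong (ι-inverse xx⁻¹≈1))))
        (w.≤ᵛ-* {1ℤ} {0ℤ} p (w.v≡⇒≤ᵛ wιx⁻¹))

      normalise-by : ∀ {u x} → w.v u ≡ fin 0ℤ → 1ℤ ≤ᵛ u - ι x → Normalised u
      normalise-by {u} {x} w-u 1≤u-x = from-inverse (KF.inverse x x≉0)
        where
        wιx : w.v (ι x) ≡ fin 0ℤ
        wιx = ≡.trans (w.v-cong (solve 2 (λ u x → x := u :+ (:- (u :- x))) ≈-refl u (ι x))) (w.v-strict w-u (w.≤ᵛ-neg 1≤u-x))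
        x≉0 : ¬ x K.≈ K.0#
        x≉0 = v.v≡fin⇒≉0 (v-from-ι wιx)
        from-inverse : ∃[ y ] x K.* y K.≈ K.1# → Normalised u
        from-inverse (x⁻¹ , xx⁻¹≈1) = record { x = x ; x⁻¹ = x⁻¹ ; v-x = v-from-ι wιx ; xx⁻¹≈1 = xx⁻¹≈1
          ; 1-unit = close-1-unit 1≤u-x xx⁻¹≈1 (invert (ι-inverse xx⁻¹≈1) wιx) }

      normalise : ∀ {u} → w.v u ≡ fin 0ℤ → Normalised u
      normalise {u} w-u = normalise-by w-u (proj₂ (proj₂ (residue-representative degree {u} (w.v≡⇒≤ᵛ w-u))))

      -- By `1-unit-^` the value of s - 1 in L is at least 1; being e v(s - 1), it is positive only
      -- if v(s - 1) is. This brings Hensel's lemma from L down to K.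
      power-1-unit : ∀ {z s} → 1ℤ ≤ᵛ z - 1# → z ^ e ≈ ι s → 1ℤ v.≤ᵛ s K.- K.1#
      power-1-unit {z} {s} 1-unit z^e≈s = go (v.zero? (s K.- K.1#))
        where
        ι-difference : z ^ e - 1# ≈ ι (s K.- K.1#)
        ι-difference = ≈-trans (+-cong z^e≈s (≈-trans (-‿cong (≈-sym ιH.1#-homo)) (≈-sym (ιH.-‿homo K.1#)))) (≈-sym (ιH.+-homo s (K.- K.1#)))
        1≤ : 1ℤ ≤ᵛ ι (s K.- K.1#)
        1≤ = w.≤ᵛ-resp ι-difference (HL.1-unit-^ {z} 1-unit e)
        positive : ∀ n → 1ℤ ℤ.≤ + e ℤ.* n → 1ℤ ℤ.≤ n
        positive n le = ℤ.i<j⇒suc[i]≤j (ℤ.≰⇒> λ n≤0 → ℤ.<⇒≱ (ℤ.suc[i]≤j⇒i<j {0ℤ} le)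
          (≡.subst (+ e ℤ.* n ℤ.≤_) (ℤ.*-zeroʳ (+ e)) (ℤ.*-monoˡ-≤-nonNeg (+ e) n≤0)))
        go : Dec (s K.- K.1# K.≈ K.0#) → 1ℤ v.≤ᵛ s K.- K.1#
        go (yes p) = v.≤ᵛ-0 p
        go (no ¬p) = v.≤ᵛ-weaken (positive (proj₁ (v.v-finite ¬p)) (w.≤ᵛ⇒≤ (w-ι (proj₂ (v.v-finite ¬p))) 1≤)) (v.v≡⇒≤ᵛ (proj₂ (v.v-finite ¬p)))

      invertible : ∀ {x n} → w.v x ≡ fin n → ∃[ y ] x * y ≈ 1#
      invertible {x} wx = IsField.inverse algebra-isField x (w.v≡fin⇒≉0 wx)

      invertibleᴷ : ∀ {x n} → v.v x ≡ fin n → ∃[ y ] x K.* y K.≈ K.1#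
      invertibleᴷ {x} vx = KF.inverse x (v.v≡fin⇒≉0 vx)

      1-unit⇒≉0 : ∀ {z y} → 1ℤ ≤ᵛ z - 1# → y ^ e ≈ z → ¬ y ≈ 0#
      1-unit⇒≉0 {z} {y} 1-unit y^e≈z y≈0 = w.1+n≰ᵛ (≡.trans (w.v-neg 1#) w.v1)
        (w.≤ᵛ-resp (≈-trans (+-congʳ (≈-trans (≈-sym y^e≈z) (≈-trans (*-congʳ y≈0) (zeroˡ _)))) (+-identityˡ (- 1#))) 1-unit)

    -- A uniformiser λ of L satisfies λ^e = π₀ u with u a unit, and u is a constant times a 1-unit, whose e-th root
    -- corrects λ.
    root-of-uniformiser : ∃[ π ] v.v π ≡ fin 1ℤ × ∃[ μ ] μ ^ e ≈ ι π
    root-of-uniformiser = from (w.onto 1ℤ) (v.onto 1ℤ)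
      where
      from : ∃[ l ] w.v l ≡ fin 1ℤ → ∃[ p ] v.v p ≡ fin 1ℤ → ∃[ π ] v.v π ≡ fin 1ℤ × ∃[ μ ] μ ^ e ≈ ι π
      from (l , wl) (p , vp) = from-inverse (invertibleᴷ vp)
        where
        from-inverse : ∃[ p⁻¹ ] p K.* p⁻¹ K.≈ K.1# → ∃[ π ] v.v π ≡ fin 1ℤ × ∃[ μ ] μ ^ e ≈ ι π
        from-inverse (p⁻¹ , pp⁻¹≈1) = from-normalised (normalise w-u)
          where
          u = l ^ e * ι p⁻¹
          w-u : w.v u ≡ fin 0ℤ
          w-u = ≡.trans (w.v≡* (w.v-^ e wl) (invert (ι-inverse pp⁻¹≈1) (w-ι vp))) (≡.cong fin (ℤ.+-inverseʳ (+ e ℤ.* 1ℤ)))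
          from-normalised : Normalised u → ∃[ π ] v.v π ≡ fin 1ℤ × ∃[ μ ] μ ^ e ≈ ι π
          from-normalised N = from-root (HL.1-unit-root e w[e]≡0 {u * ι x⁻¹} 1-unit)
            where
            open Normalised N
            from-root : ∃[ y ] y ^ e ≈ u * ι x⁻¹ → ∃[ π ] v.v π ≡ fin 1ℤ × ∃[ μ ] μ ^ e ≈ ι π
            from-root (y , y^e) with IsField.inverse algebra-isField y (1-unit⇒≉0 1-unit y^e)
            ... | y⁻¹ , yy⁻¹≈1 = p K.* x , v.v≡* vp v-x , l * y⁻¹ ,
                  ≈-trans (quotient-root e yy⁻¹≈1 (ι-inverse pp⁻¹≈1) ιxx⁻¹≈1 y^e) (≈-sym (ιH.*-homo p x))

    roots⇒power : ∀ {π π′ α β} → v.v π ≡ fin 1ℤ → v.v π′ ≡ fin 1ℤ → α ^ e ≈ ι π → β ^ e ≈ ι π′ →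
                  ∃[ z ] ¬ z K.≈ K.0# × π K.≈ π′ K.* z ^ᴷ e
    roots⇒power {π} {π′} {α} {β} v-π v-π′ α^e β^e = from-inverses (invertible (w-root v-π′ β^e)) (invertibleᴷ v-π′)
      where
      Result = ∃[ z ] ¬ z K.≈ K.0# × π K.≈ π′ K.* z ^ᴷ e
      from-inverses : ∃[ β⁻¹ ] β * β⁻¹ ≈ 1# → ∃[ ϖ ] π′ K.* ϖ K.≈ K.1# → Result
      from-inverses (β⁻¹ , ββ⁻¹≈1) (ϖ , π′ϖ≈1) = from-normalised (normalise w-u)
        where
        u = α * β⁻¹
        w-u : w.v u ≡ fin 0ℤ
        w-u = w.v≡* (w-root v-π α^e) (invert ββ⁻¹≈1 (w-root v-π′ β^e))
        u^e : u ^ e ≈ ι (π K.* ϖ)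
        u^e = ≈-trans (^-distrib-* α β⁻¹ e) (≈-trans (*-cong α^e
          (inverse-unique (≈-trans (*-congʳ (≈-sym β^e)) (inverse-^ e ββ⁻¹≈1)) (ι-inverse π′ϖ≈1))) (≈-sym (ιH.*-homo π ϖ)))
        from-normalised : Normalised u → Result
        from-normalised N = from-root (HK.1-unit-root e v[e]≡0 {s} (power-1-unit 1-unit z^e≈s))
          where
          open Normalised N
          -- s = π / (π′ x^e) is the e-th power of the 1-unit u / x of L and lies in K, so it is a
          -- 1-unit of K and has an e-th root y constructed inside K.
          s = π K.* ϖ K.* x⁻¹ ^ᴷ e
          z^e≈s : (u * ι x⁻¹) ^ e ≈ ι s
          z^e≈s = ≈-trans (^-distrib-* u (ι x⁻¹) e) (≈-trans (*-cong u^e (≈-sym (ι-^ x⁻¹ e))) (≈-sym (ιH.*-homo (π K.* ϖ) (x⁻¹ ^ᴷ e))))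
          from-root : ∃[ y ] y ^ᴷ e K.≈ s → Result
          from-root (y , y^e) = y K.* x , yx≉0 , π≈
            where
            π≈ : π K.≈ π′ K.* (y K.* x) ^ᴷ e
            π≈ = Kᵖ.quotient-power e π′ϖ≈1 xx⁻¹≈1 y^e
            yx≉0 : ¬ y K.* x K.≈ K.0#
            yx≉0 yx≈0 = v.v≡fin⇒≉0 v-π (K.trans π≈ (K.trans (K.*-congˡ (K.trans (K.*-congʳ yx≈0) (K.zeroˡ _))) (K.zeroʳ π′)))

-- Ramified lines and their generators.

module Lines {c ℓ} (K : DiscretelyValuedField c ℓ) (e-1 : ℕ) where
  private
    e = suc e-1
    module KF = DiscretelyValuedField K
    module K = CommutativeRing KF.ring
    module v = Valuation KF.ring KF.valuation
    module H = AbelianGroup (unitGroup K)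
    module G = AbelianGroup (K^×/K^×ᵉ K e)
    module ℤG = AbelianGroup (ℤ/ e ℤ)
    module w̄ = IsGroupHomomorphism (w̄-isGroupHomomorphism K e)
  open CMonMult G.commutativeMonoid using (×-homo-+; ×-assocˡ; ×-congʳ; ×-homo-1) renaming (_×_ to _·_)
  open CMonMult H.commutativeMonoid using () renaming (_×_ to _·ᴴ_)
  open RawMonoidDefs (AbelianGroup.rawMonoid ℤ.+-0-abelianGroup) using () renaming (_×_ to _·ℤ_)
  open Exp K.semiring using (_^_)

  private
    G≈H : ∀ n x → n · x ≡ n ·ᴴ x
    G≈H zero    x = refl
    G≈H (suc n) x = ≡.cong (x H.∙_) (G≈H n x)

    ·ᴴ-^ : ∀ n x → proj₁ (n ·ᴴ x) ≡ proj₁ x ^ n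
    ·ᴴ-^ zero    x = refl
    ·ᴴ-^ (suc n) x = ≡.cong (proj₁ x K.*_) (·ᴴ-^ n x)

    ·ℤ-* : ∀ n k → n ·ℤ k ≡ + n ℤ.* k
    ·ℤ-* zero    k = ≡.sym (ℤ.*-zeroˡ k)
    ·ℤ-* (suc n) k = ≡.trans (≡.cong (λ i → k ℤ.+ i) (·ℤ-* n k)) (≡.sym (ℤ.suc-* (+ n) k))

  power⇒≈ : ∀ {x y : H.Carrier} z → ¬ z K.≈ K.0# → proj₁ x K.≈ proj₁ y K.* z ^ e → x G.≈ y
  power⇒≈ z z≉0 eq = (z , z≉0) , K.trans eq (K.*-congˡ (K.reflexive (≡.sym (·ᴴ-^ e (z , z≉0)))))

  ≈⇒power : ∀ {x y : H.Carrier} → x G.≈ y → ∃[ z ] ¬ z K.≈ K.0# × proj₁ x K.≈ proj₁ y K.* z ^ e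
  ≈⇒power (z , eq) = proj₁ z , proj₂ z , K.trans eq (K.*-congˡ (K.reflexive (·ᴴ-^ e z)))

  private
    exponent : ∀ x → e · x G.≈ G.ε
    exponent x = x , K.trans (K.reflexive (≡.cong proj₁ (G≈H e x))) (K.sym (K.*-identityˡ _))

    ·-ε : ∀ n → n · G.ε G.≈ G.ε
    ·-ε zero    = G.refl {G.ε}
    ·-ε (suc n) = G.trans {G.ε G.∙ n · G.ε} {n · G.ε} {G.ε} (G.identityˡ (n · G.ε)) (·-ε n)

    ·-multiple : ∀ n x → (n ℕ.* e) · x G.≈ G.ε
    ·-multiple n x = begin
      (n ℕ.* e) · x   ≈⟨ ×-assocˡ x n e ⟨
      n · (e · x)     ≈⟨ ×-congʳ n (exponent x) ⟩
      n · G.ε   ≈⟨ ·-ε n ⟩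
      G.ε   ∎
      where open SetoidReasoning G.setoid

    ·-mod : ∀ n j x → (n ℕ.+ j ℕ.* e) · x G.≈ n · x
    ·-mod n j x = begin
      (n ℕ.+ j ℕ.* e) · x   ≈⟨ ×-homo-+ x n (j ℕ.* e) ⟩
      n · x G.∙ (j ℕ.* e) · x      ≈⟨ G.∙-congˡ {n · x} {(j ℕ.* e) · x} {G.ε} (·-multiple j x) ⟩
      n · x G.∙ G.ε   ≈⟨ G.identityʳ (n · x) ⟩
      n · x   ∎
      where open SetoidReasoning G.setoid

    -- The group is killed by e, so a multiple depends on n modulo e only. The integer k in n = m +
    -- k e may be negative; then n and m exchange roles.
    ·-congruent : ∀ {n m} x → ℤG._≈_ (+ n) (+ m) → n · x G.≈ m · x
    ·-congruent {n} {m} x (k , eq) = go k (≡.trans eq (≡.cong (λ i → + m ℤ.+ i) (≡.trans (·ℤ-* e k) (ℤ.*-comm (+ e) k))))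
      where
      go : ∀ k → + n ≡ + m ℤ.+ k ℤ.* + e → n · x G.≈ m · x
      go (+ j) eq = ≡.subst (λ n → n · x G.≈ m · x)
        (≡.sym (ℤ.+-injective (≡.trans eq (≡.cong (λ i → + m ℤ.+ i) (≡.sym (ℤ.pos-* j e)))))) (·-mod m j x)
      go -[1+ j ] eq = G.sym {m · x} {n · x} (≡.subst (λ m → m · x G.≈ n · x)
        (≡.sym (ℤ.+-injective (≡.trans (S.solve 2 (λ m p → m S.:= (m S.:+ (S.:- p)) S.:+ p) refl (+ m) (+ suc j ℤ.* + e))
          (≡.trans (≡.cong (λ i → i ℤ.+ + suc j ℤ.* + e) (≡.trans (≡.cong (λ i → + m ℤ.+ i) (ℤ.neg-distribˡ-* (+ suc j) (+ e))) (≡.sym eq)))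
            (≡.cong (λ i → + n ℤ.+ i) (≡.sym (ℤ.pos-* (suc j) e))))))) (·-mod n (suc j) x))
        where module S = ℤSolver.+-*-Solver

  ord-1 : ∀ {x : H.Carrier} → v.v (proj₁ x) ≡ fin 1ℤ → ord K x ≡ 1ℤ
  ord-1 {x} vx = fin-injective (≡.trans (≡.sym (v≡ord K x)) vx)

  private
    ord-· : ∀ {x : H.Carrier} → v.v (proj₁ x) ≡ fin 1ℤ → ∀ n → ord K (n · x) ≡ + n
    ord-· {x} vx n = fin-injective (≡.trans (≡.sym (v≡ord K (n · x)))
      (≡.trans (≡.cong v.v (≡.trans (≡.cong proj₁ (G≈H n x)) (·ᴴ-^ n x))) (≡.trans (v.v-^ n vx) (≡.cong fin (ℤ.*-identityʳ (+ n))))))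

    ℤG-reflexive : ∀ {i j} → i ≡ j → ℤG._≈_ i j
    ℤG-reflexive {i} refl = ℤG.refl {i}

    ℤG-mod : ∀ j → ℤG._≈_ (+ (j ℤ.%ℕ e)) j
    ℤG-mod j = ℤG.sym {j} {+ (j ℤ.%ℕ e)} (j ℤ./ℕ e , ≡.trans (ℤ.a≡a%ℕn+[a/ℕn]*n j e)
      (≡.cong (λ i → + (j ℤ.%ℕ e) ℤ.+ i) (≡.sym (≡.trans (·ℤ-* e (j ℤ./ℕ e)) (ℤ.*-comm (+ e) (j ℤ./ℕ e))))))

  module _ {π : H.Carrier} (v-π : v.v (proj₁ π) ≡ fin 1ℤ) where
    private
      -- In additive notation, natural multiples of π already form a subgroup, because e kills the
      -- group: the inverse of n π is n (e - 1) π.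
      Member : G.Carrier → Set (c ⊔ ℓ)
      Member x = ∃[ n ] x G.≈ n · π

      w̄-member : ∀ {x} ((n , _) : Member x) → ℤG._≈_ (w̄ K e x) (+ n)
      w̄-member {x} (n , x≈) = ℤG.trans {w̄ K e x} {w̄ K e (n · π)} {+ n} (w̄.⟦⟧-cong {x} {n · π} x≈) (ℤG-reflexive (ord-· v-π n))

      subgroup : Subgroup (K^×/K^×ᵉ K e) (c ⊔ ℓ)
      subgroup = record
        { Member    = Member
        ; resp      = λ {x} {y} x≈y (n , x≈) → n , G.trans {y} {x} {n · π} (G.sym {x} {y} x≈y) x≈
        ; ε-closed  = 0 , G.refl {G.ε}
        ; ∙-closed  = λ {x} {y} (n , x≈) (m , y≈) → n ℕ.+ m , (begin
            x G.∙ y   ≈⟨ G.∙-cong {x} {n · π} {y} {m · π} x≈ y≈ ⟩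
            n · π G.∙ m · π    ≈⟨ ×-homo-+ π n m ⟨
            (n ℕ.+ m) · π      ∎)
        ; ⁻¹-closed = λ {x} (n , x≈) → n ℕ.* e-1 , G.sym {(n ℕ.* e-1) · π} {x G.⁻¹} (G.uniqueʳ-⁻¹ x ((n ℕ.* e-1) · π) (begin
            x G.∙ (n ℕ.* e-1) · π   ≈⟨ G.∙-congʳ {(n ℕ.* e-1) · π} {x} {n · π} x≈ ⟩
            n · π G.∙ (n ℕ.* e-1) · π    ≈⟨ ×-homo-+ π n (n ℕ.* e-1) ⟨
            (n ℕ.+ n ℕ.* e-1) · π   ≡⟨ ≡.cong (_· π) (ℕ.*-suc n e-1) ⟨
            (n ℕ.* e) · π   ≈⟨ ·-multiple n π ⟩
            G.ε   ∎))
        }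
        where open SetoidReasoning G.setoid

    generatedLine : RamifiedLine K e
    generatedLine = record
      { subgroup = subgroup
      ; w̄-isomorphism = record
        { isGroupMonomorphism = record
          { isGroupHomomorphism = record
            { isMonoidHomomorphism = record
              { isMagmaHomomorphism = record
                { isRelHomomorphism = record { cong = λ {x} {y} → w̄.⟦⟧-cong {proj₁ x} {proj₁ y} }
                ; homo = λ x y → w̄.homo (proj₁ x) (proj₁ y) }
              ; ε-homo = w̄.ε-homo }
            ; ⁻¹-homo = λ x → w̄.⁻¹-homo (proj₁ x) }
          ; injective = λ {x} {y} eq → injective x y eq }
        ; surjective = λ j → ((j ℤ.%ℕ e) · π , j ℤ.%ℕ e , G.refl {(j ℤ.%ℕ e) · π}) , λ {z} z≈ →
            ℤG.trans {w̄ K e (proj₁ z)} {w̄ K e ((j ℤ.%ℕ e) · π)} {j} (w̄.⟦⟧-cong {proj₁ z} {(j ℤ.%ℕ e) · π} z≈)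
              (ℤG.trans {w̄ K e ((j ℤ.%ℕ e) · π)} {+ (j ℤ.%ℕ e)} {j} (ℤG-reflexive (ord-· v-π (j ℤ.%ℕ e))) (ℤG-mod j)) }
      }
      where
      injective : ∀ (x y : ∃ Member) → ℤG._≈_ (w̄ K e (proj₁ x)) (w̄ K e (proj₁ y)) → proj₁ x G.≈ proj₁ y
      injective (x , n , x≈) (y , m , y≈) eq = begin
        x   ≈⟨ x≈ ⟩
        n · π    ≈⟨ ·-congruent π (ℤG.trans {+ n} {w̄ K e x} {+ m} (ℤG.sym {w̄ K e x} {+ n} (w̄-member {x} (n , x≈)))
                      (ℤG.trans {w̄ K e x} {w̄ K e y} {+ m} eq (w̄-member {y} (m , y≈)))) ⟩
        m · π    ≈⟨ y≈ ⟨
        y   ∎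
        where open SetoidReasoning G.setoid

    generator∈generatedLine : RamifiedLine.Member generatedLine π
    generator∈generatedLine = 1 , G.sym {1 · π} {π} (×-homo-1 π)

  module _ (D : RamifiedLine K e) where
    private
      module D = RamifiedLine D
      module iso = IsGroupIsomorphism D.w̄-isomorphism

    uniformisers-≈ : ∀ {x y : H.Carrier} → v.v (proj₁ x) ≡ fin 1ℤ → v.v (proj₁ y) ≡ fin 1ℤ →
                     D.Member x → D.Member y → x G.≈ y
    uniformisers-≈ {x} {y} vx vy x∈D y∈D = iso.injective {x , x∈D} {y , y∈D} (ℤG-reflexive (≡.trans (ord-1 {x} vx) (≡.sym (ord-1 {y} vy))))

    private
      ·-closed : ∀ {x} n → D.Member x → D.Member (n · x)
      ·-closed zero    x∈D = D.ε-closed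
      ·-closed (suc n) x∈D = D.∙-closed x∈D (·-closed n x∈D)

    -- D is generated by π: an element x and the multiple of π by ord x mod e have the same image
    -- under w̄, which is injective on D. A generator shared with D′ therefore carries all of D
    -- along.
    line⊆ : ∀ (D′ : RamifiedLine K e) {π π′ : H.Carrier} → v.v (proj₁ π) ≡ fin 1ℤ → D.Member π →
            RamifiedLine.Member D′ π′ → π G.≈ π′ → ∀ {x} → D.Member x → RamifiedLine.Member D′ x
    line⊆ D′ {π} {π′} v-π π∈D π′∈D′ π≈π′ {x} x∈D = D′.resp {n · π} {x} (G.sym {x} {n · π} x≈) (closed n)
      where
      module D′ = RamifiedLine D′
      n = ord K x ℤ.%ℕ e
      x≈ : x G.≈ n · π
      x≈ = iso.injective {x , x∈D} {n · π , ·-closed n π∈D} (ℤG.trans {ord K x} {+ n} {ord K (n · π)}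
        (ℤG.sym {+ n} {ord K x} (ℤG-mod (ord K x))) (ℤG-reflexive (≡.sym (ord-· {π} v-π n))))
      closed : ∀ n → D′.Member (n · π)
      closed zero    = D′.ε-closed
      closed (suc n) = D′.∙-closed {π} {n · π} (D′.resp {π′} {π} (G.sym {π} {π′} π≈π′) π′∈D′) (closed n)

-- Counting e-th power classes in a finite abelian group.

module FiniteSubset where
  record Listing {p} {N} (P : Fin N → Set p) : Set p where
    field
      size      : ℕ
      element   : Fin size → Fin N
      member    : ∀ i → P (element i)
      injective : ∀ {i j} → element i ≡ element j → i ≡ j
      position  : ∀ {x} → P x → ∃[ i ] element i ≡ x

  listing : ∀ {p} {N} {P : Fin N → Set p} → (∀ x → Dec (P x)) → Listing P
  listing {N = zero}  P? = record { size = 0 ; element = λ () ; member = λ () ; injective = λ { {()} } ; position = λ { {()} } }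
  listing {N = suc N} {P} P? with listing {P = P ∘ suc} (P? ∘ suc) | P? zero
  ... | L | yes P₀ = record
    { size = suc L.size
    ; element = λ { zero → zero ; (suc i) → suc (L.element i) }
    ; member = λ { zero → P₀ ; (suc i) → L.member i }
    ; injective = λ { {zero} {zero} _ → refl ; {suc i} {suc j} eq → ≡.cong suc (L.injective (Fin.suc-injective eq)) }
    ; position = λ { {zero} _ → zero , refl ; {suc x} Px → suc (proj₁ (L.position Px)) , ≡.cong suc (proj₂ (L.position Px)) } }
    where module L = Listing L
  ... | L | no ¬P₀ = record
    { size = L.size
    ; element = suc ∘ L.element
    ; member = L.member
    ; injective = L.injective ∘ Fin.suc-injective
    ; position = λ { {zero} P₀ → ⊥-elim (¬P₀ P₀) ; {suc x} Px → proj₁ (L.position Px) , ≡.cong suc (proj₂ (L.position Px)) } }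
    where module L = Listing L

-- With I the image and K the kernel of x ↦ x^e and C a set of representatives of G/I, one has |C||I| = N ≤ |I||K|.
-- If x^n = 1 has at most n solutions, then |K| ≤ g and |I| ≤ N/g for g = gcd(N, e), whence |C| = g.
module FinitePowerClasses {c ℓ} (G : AbelianGroup c ℓ) (N : ℕ)
  (enum : Fin N → AbelianGroup.Carrier G) (index : AbelianGroup.Carrier G → Fin N)
  (index-cong : ∀ {x y} → AbelianGroup._≈_ G x y → index x ≡ index y)
  (enum-index : ∀ x → AbelianGroup._≈_ G (enum (index x)) x)
  (index-enum : ∀ i → index (enum i) ≡ i) where
  open AbelianGroup G renaming (refl to ≈-refl; sym to ≈-sym; trans to ≈-trans)
  open CMonMult commutativeMonoid using (×-homo-+; ×-assocˡ; ×-congʳ; ×-distrib-+) renaming (_×_ to _·_)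
  open CMonSum commutativeMonoid using (sum; sum-permute; ∑-distrib-+; sum-replicate; sum-cong-≋)
  open AbelianGroupProps G using (∙-cancelʳ; ∙-cancelˡ)
  open SetoidReasoning setoid
  open FiniteSubset

  private
    _≈?_ : ∀ x y → Dec (x ≈ y)
    x ≈? y = map′ (λ eq → ≈-trans (≈-sym (enum-index x)) (≈-trans (reflexive (≡.cong enum eq)) (enum-index y))) index-cong (index x Fin.≟ index y)

    enum-injective : ∀ {i j} → enum i ≈ enum j → i ≡ j
    enum-injective eq = ≡.trans (≡.sym (index-enum _)) (≡.trans (index-cong eq) (index-enum _))

    ·-ε : ∀ n → n · ε ≈ ε
    ·-ε zero    = ≈-refl
    ·-ε (suc n) = ≈-trans (identityˡ _) (·-ε n)

  -- Translation by x permutes the elements of G, so their sum S, in additive notation, satisfies N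
  -- x + S = S.
  fermat : ∀ x → N · x ≈ ε
  fermat x = ∙-cancelʳ (sum enum) (N · x) ε (begin
    N · x ∙ sum enum   ≈⟨ ∙-congʳ (≈-sym (sum-replicate N {x})) ⟩
    sum {N} (λ _ → x) ∙ sum enum   ≈⟨ ∑-distrib-+ (λ _ → x) enum ⟨
    sum (λ i → x ∙ enum i)   ≈⟨ sum-cong-≋ {N} (λ i → enum-index (x ∙ enum i)) ⟨
    sum (λ i → enum (index (x ∙ enum i)))     ≈⟨ sum-permute enum translation ⟨
    sum enum   ≈⟨ identityˡ _ ⟨
    ε ∙ sum enum   ∎)
    where
    cancel : ∀ x y i → x ∙ y ≈ ε → index (x ∙ enum (index (y ∙ enum i))) ≡ i
    cancel x y i xy≈ε = ≡.trans (index-cong (begin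
      x ∙ enum (index (y ∙ enum i))   ≈⟨ ∙-congˡ (enum-index _) ⟩
      x ∙ (y ∙ enum i)   ≈⟨ assoc _ _ _ ⟨
      x ∙ y ∙ enum i   ≈⟨ ∙-congʳ xy≈ε ⟩
      ε ∙ enum i   ≈⟨ identityˡ _ ⟩
      enum i   ∎)) (index-enum i)
    translation : Perm.Permutation N N
    translation = Perm.permutation (λ i → index (x ∙ enum i)) (λ i → index (x ⁻¹ ∙ enum i))
      (λ i → cancel x (x ⁻¹) i (inverseʳ x)) (λ i → cancel (x ⁻¹) x i (inverseˡ x))

  module _ (e : ℕ) where
    infix 4 _~_
    _~_ : Carrier → Carrier → Set (c ⊔ ℓ)
    x ~ y = ∃[ z ] x ≈ y ∙ e · z

    ~-sym : ∀ {x y} → x ~ y → y ~ x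
    ~-sym = AbelianGroup.sym (G /powers e)

    ~-trans : ∀ {x y z} → x ~ y → y ~ z → x ~ z
    ~-trans = AbelianGroup.trans (G /powers e)

    _~?_ : ∀ x y → Dec (x ~ y)
    x ~? y = map′ (λ (i , eq) → enum i , eq)
      (λ (z , eq) → index z , ≈-trans eq (∙-congˡ (×-congʳ e (≈-sym (enum-index z)))))
      (Fin.any? (λ i → x ≈? (y ∙ e · enum i)))

    private
      -- A class modulo e-th powers is represented by its member of least index, so equivalent
      -- representatives coincide.
      IsLeast : Fin N → Set (c ⊔ ℓ)
      IsLeast i = ∀ j → j Fin.< i → ¬ enum j ~ enum i

      isLeast? : ∀ i → Dec (IsLeast i)
      isLeast? i = Fin.all? λ j → implication (j Fin.<? i) (enum j ~? enum i)
        where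
        implication : ∀ {a b} {A : Set a} {B : Set b} → Dec A → Dec B → Dec (A → ¬ B)
        implication (no ¬a) _       = yes (λ a → ⊥-elim (¬a a))
        implication (yes a) (no ¬b) = yes (λ _ → ¬b)
        implication (yes a) (yes b) = no (λ h → h a b)

      image? : ∀ i → Dec (ε ~ enum i)
      image? i = ε ~? enum i

      kernel? : ∀ i → Dec (e · enum i ≈ ε)
      kernel? i = (e · enum i) ≈? ε

      module C = Listing (listing isLeast?)
      module I = Listing (listing image?)
      module K = Listing (listing kernel?)

      least : ∀ x → ∃[ i ] IsLeast i × enum i ~ x
      -- The first index equivalent to x is found as the smallest counterexample to inequivalence;
      -- the index of x itself shows that there is one.
      least x = from (Fin.¬∀⟶∃¬-smallest N (λ j → ¬ enum j ~ x) (λ j → ¬? (enum j ~? x))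
        (λ none → none (index x) (ε , ≈-trans (enum-index x) (≈-sym (≈-trans (∙-congˡ (·-ε e)) (identityʳ x))))))
        where
        from : (∃[ i ] ¬ ¬ enum i ~ x × ((j : Fin.Fin′ i) → ¬ enum (Fin.inject j) ~ x)) → ∃[ i ] IsLeast i × enum i ~ x
        from (i , ¬¬i~x , below) = i , (λ j j<i j~i → below (fromℕ< j<i)
            (≡.subst (λ j → enum j ~ x) (Fin.toℕ-injective (≡.sym (≡.trans (Fin.toℕ-inject (fromℕ< j<i)) (Fin.toℕ-fromℕ< j<i)))) (~-trans j~i i~x))) , i~x
          where
          i~x = decidable-stable (enum i ~? x) ¬¬i~x

      least-unique : ∀ {i j} → IsLeast i → IsLeast j → enum i ~ enum j → i ≡ j
      least-unique {i} {j} li lj i~j with Fin.<-cmp i j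
      ... | tri< i<j _ _ = ⊥-elim (lj i i<j i~j)
      ... | tri≈ _ i≡j _ = i≡j
      ... | tri> _ _ j<i = ⊥-elim (li j j<i (~-sym i~j))

      representative : Fin C.size → Carrier
      representative a = enum (C.element a)

      abstract
        class : Carrier → Fin C.size
        class x = proj₁ (C.position (proj₁ (proj₂ (least x))))

        class-~ : ∀ x → representative (class x) ~ x
        class-~ x = ≡.subst (λ i → enum i ~ x) (≡.sym (proj₂ (C.position (proj₁ (proj₂ (least x)))))) (proj₂ (proj₂ (least x)))

      representative-injective : ∀ {a b} → representative a ~ representative b → a ≡ b
      representative-injective {a} {b} r = C.injective (least-unique (C.member a) (C.member b) r)

      class-representative : ∀ a → class (representative a) ≡ a
      class-representative a = representative-injective (class-~ (representative a))

      class-cong : ∀ {x y} → x ~ y → class x ≡ class y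
      class-cong {x} {y} x~y = representative-injective (~-trans (class-~ x) (~-trans x~y (~-sym (class-~ y))))

      class-injective : ∀ {x y} → class x ≡ class y → x ~ y
      class-injective {x} {y} eq = ~-trans (~-sym (class-~ x)) (≡.subst (λ a → representative a ~ y) (≡.sym eq) (class-~ y))

      im : Fin I.size → Carrier
      im b = enum (I.element b)

      abstract
        root : ∀ b → ∃[ r ] im b ≈ e · r
        root b with z , eq ← ~-sym (I.member b) = z , ≈-trans eq (identityˡ _)

        im-position : ∀ r → ∃[ b ] im b ≈ e · r
        im-position r = proj₁ (found r) , ≈-trans (reflexive (≡.cong enum (proj₂ (found r)))) (enum-index _)
          where
          found : ∀ r → ∃[ b ] I.element b ≡ index (e · r)
          found r = I.position (~-sym (r , ≈-trans (enum-index (e · r)) (≈-sym (identityˡ _))))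

      ker : Fin K.size → Carrier
      ker k = enum (K.element k)

      abstract
        ker-position : ∀ {x} → e · x ≈ ε → ∃[ k ] ker k ≈ x
        ker-position {x} ex≈ε = proj₁ found , ≈-trans (reflexive (≡.cong enum (proj₂ found))) (enum-index x)
          where
          found : ∃[ k ] K.element k ≡ index x
          found = K.position (≈-trans (×-congʳ e (enum-index x)) ex≈ε)

      -- A product of a representative and an e-th power determines the representative, through its
      -- class, and then the e-th power by cancellation.
      |C||I|≤N : C.size ℕ.* I.size ℕ.≤ N
      |C||I|≤N = Fin.injective⇒≤ {f = f} f-injective
        where
        f : Fin (C.size ℕ.* I.size) → Fin N
        f p = index (representative (proj₁ (Fin.remQuot I.size p)) ∙ im (proj₂ (Fin.remQuot {C.size} I.size p)))
        pair-injective : ∀ {a b} {a′ b′} → representative a ∙ im b ≈ representative a′ ∙ im b′ → a ≡ a′ × b ≡ b′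
        pair-injective {a} {b} {a′} {b′} eq = a≡a′ , I.injective (enum-injective (∙-cancelˡ (representative a) (im b) (im b′)
            (≈-trans eq (reflexive (≡.cong (λ a → representative a ∙ im b′) (≡.sym a≡a′))))))
          where
          a≡a′ : a ≡ a′
          a≡a′ = representative-injective (~-trans (~-sym (absorb b)) (~-trans (≈⇒~ eq) (absorb b′)))
            where
            ≈⇒~ : ∀ {x y} → x ≈ y → x ~ y
            ≈⇒~ {x} {y} x≈y = proj₁ r , ≈-trans x≈y (proj₂ r)
              where
              r : y ~ y
              r = AbelianGroup.refl (G /powers e)
            absorb : ∀ {a} b → representative a ∙ im b ~ representative a
            absorb b = proj₁ (root b) , ∙-congˡ (proj₂ (root b))
        f-injective : ∀ {p p′} → f p ≡ f p′ → p ≡ p′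
        f-injective {p} {p′} eq = ≡.trans (≡.sym (Fin.combine-remQuot {C.size} I.size p))
          (≡.trans (≡.cong₂ Fin.combine (proj₁ same) (proj₂ same)) (Fin.combine-remQuot {C.size} I.size p′))
          where
          same = pair-injective (≈-trans (≈-sym (enum-index _)) (≈-trans (reflexive (≡.cong enum eq)) (enum-index _)))

      N≤|C||I| : N ℕ.≤ C.size ℕ.* I.size
      N≤|C||I| = Fin.injective⇒≤ {f = λ i → Fin.combine (class (enum i)) (part i)} λ {i} {j} eq → enum-injective (begin
          enum i   ≈⟨ proj₂ (factor i) ⟩
          representative (class (enum i)) ∙ im (part i) ≡⟨ ≡.cong₂ (λ a b → representative a ∙ im b)
              (Fin.combine-injectiveˡ (class (enum i)) (part i) (class (enum j)) (part j) eq)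
              (Fin.combine-injectiveʳ (class (enum i)) (part i) (class (enum j)) (part j) eq) ⟩
          representative (class (enum j)) ∙ im (part j) ≈⟨ proj₂ (factor j) ⟨
          enum j   ∎)
        where
        abstract
          factor : ∀ i → ∃[ b ] enum i ≈ representative (class (enum i)) ∙ im b
          factor i = from (~-sym (class-~ (enum i)))
            where
            from : enum i ~ representative (class (enum i)) → ∃[ b ] enum i ≈ representative (class (enum i)) ∙ im b
            from (z , eq) = proj₁ (im-position z) , ≈-trans eq (∙-congˡ (≈-sym (proj₂ (im-position z))))
        part : Fin N → Fin I.size
        part i = proj₁ (factor i)

      N≤|I||K| : N ℕ.≤ I.size ℕ.* K.size
      N≤|I||K| = Fin.injective⇒≤ {f = λ i → Fin.combine (b i) (proj₁ (k i))} λ {i} {j} eq → enum-injective (begin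
          enum i   ≈⟨ proj₂ (k i) ⟩
          proj₁ (root (b i)) ∙ ker (proj₁ (k i))  ≡⟨ ≡.cong₂ (λ b k → proj₁ (root b) ∙ ker k)
              (Fin.combine-injectiveˡ (b i) (proj₁ (k i)) (b j) (proj₁ (k j)) eq)
              (Fin.combine-injectiveʳ (b i) (proj₁ (k i)) (b j) (proj₁ (k j)) eq) ⟩
          proj₁ (root (b j)) ∙ ker (proj₁ (k j))  ≈⟨ proj₂ (k j) ⟨
          enum j   ∎)
        where
        b : Fin N → Fin I.size
        b i = proj₁ (im-position (enum i))
        abstract
          k : ∀ i → ∃[ k ] enum i ≈ proj₁ (root (b i)) ∙ ker k
          k i = quotient (≈-trans (≈-sym (proj₂ (root (b i)))) (proj₂ (im-position (enum i))))
            where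
            quotient : ∀ {r x} → e · r ≈ e · x → ∃[ k ] x ≈ r ∙ ker k
            quotient {r} {x} er≈ex = from (ker-position (∙-cancelˡ (e · r) _ _ (begin
                e · r ∙ e · (r ⁻¹ ∙ x)    ≈⟨ ×-distrib-+ r (r ⁻¹ ∙ x) e ⟨
                e · (r ∙ (r ⁻¹ ∙ x))      ≈⟨ ×-congʳ e (≈-sym (assoc _ _ _)) ⟩
                e · (r ∙ r ⁻¹ ∙ x)   ≈⟨ ×-congʳ e (≈-trans (∙-congʳ (inverseʳ r)) (identityˡ _)) ⟩
                e · x   ≈⟨ er≈ex ⟨
                e · r   ≈⟨ identityʳ _ ⟨
                e · r ∙ ε   ∎)))
              where
              from : ∃[ k ] ker k ≈ r ⁻¹ ∙ x → ∃[ k ] x ≈ r ∙ ker k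
              from (k , eq) = k , (begin
                x   ≈⟨ identityˡ _ ⟨
                ε ∙ x   ≈⟨ ∙-congʳ (inverseʳ r) ⟨
                r ∙ r ⁻¹ ∙ x   ≈⟨ assoc _ _ _ ⟩
                r ∙ (r ⁻¹ ∙ x)     ≈⟨ ∙-congˡ eq ⟨
                r ∙ ker k   ∎)

    module _ (0<e : 0 ℕ.< e) (bounded : ∀ n {m} (f : Fin m → Carrier) → (∀ {i j} → f i ≈ f j → i ≡ j) →
             (∀ i → suc n · f i ≈ ε) → m ℕ.≤ suc n) where
      private
        g = gcd N e

        bounded′ : ∀ n {m} → 0 ℕ.< n → (f : Fin m → Carrier) → (∀ {i j} → f i ≈ f j → i ≡ j) → (∀ i → n · f i ≈ ε) → m ℕ.≤ n
        bounded′ (suc n) _ = bounded n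

        multiple-ε : ∀ n {m x} → m · x ≈ ε → (n ℕ.* m) · x ≈ ε
        multiple-ε n {m} {x} eq = ≈-trans (≈-sym (×-assocˡ x n m)) (≈-trans (×-congʳ n eq) (·-ε n))

        g-killed : ∀ {x} → e · x ≈ ε → g · x ≈ ε
        g-killed {x} ex≈ε with ℕ.Bézout.identity (ℕ.gcd-GCD N e)
        ... | ℕ.Bézout.+- a b eq = begin
          g · x   ≈⟨ identityʳ _ ⟨
          g · x ∙ ε   ≈⟨ ∙-congˡ (multiple-ε b ex≈ε) ⟨
          g · x ∙ (b ℕ.* e) · x   ≈⟨ ×-homo-+ x g (b ℕ.* e) ⟨
          (g ℕ.+ b ℕ.* e) · x   ≡⟨ ≡.cong (_· x) eq ⟩
          (a ℕ.* N) · x   ≈⟨ multiple-ε a (fermat x) ⟩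
          ε   ∎
        ... | ℕ.Bézout.-+ a b eq = begin
          g · x   ≈⟨ identityʳ _ ⟨
          g · x ∙ ε   ≈⟨ ∙-congˡ (multiple-ε a (fermat x)) ⟨
          g · x ∙ (a ℕ.* N) · x   ≈⟨ ×-homo-+ x g (a ℕ.* N) ⟨
          (g ℕ.+ a ℕ.* N) · x   ≡⟨ ≡.cong (_· x) eq ⟩
          (b ℕ.* e) · x   ≈⟨ multiple-ε b ex≈ε ⟩
          ε   ∎

        0<N : 0 ℕ.< N
        0<N = ℕ.≤-<-trans ℕ.z≤n (Fin.toℕ<n (index ε))

        0<g : 0 ℕ.< g
        0<g = ℕ.n≢0⇒n>0 λ g≡0 → ℕ.<-irrefl (≡.sym (ℕ.gcd[m,n]≡0⇒n≡0 N g≡0)) 0<e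

        h = ℕ.quotient (ℕ.gcd[m,n]∣m N e)
        N≡hg : N ≡ h ℕ.* g
        N≡hg = ℕ._∣_.equality (ℕ.gcd[m,n]∣m N e)
        0<h : 0 ℕ.< h
        0<h = ℕ.n≢0⇒n>0 λ h≡0 → ℕ.<-irrefl (≡.sym (≡.trans N≡hg (≡.cong (ℕ._* g) h≡0))) 0<N

        |K|≤g : K.size ℕ.≤ g
        |K|≤g = bounded′ g 0<g ker (K.injective ∘ enum-injective) (λ k → g-killed (K.member k))

        |I|≤h : I.size ℕ.≤ h
        |I|≤h = bounded′ h 0<h im (I.injective ∘ enum-injective) λ b → begin
          h · im b   ≈⟨ ×-congʳ h (proj₂ (root b)) ⟩
          h · (e · proj₁ (root b))   ≈⟨ ×-assocˡ (proj₁ (root b)) h e ⟩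
          (h ℕ.* e) · proj₁ (root b)   ≡⟨ ≡.cong (_· proj₁ (root b)) he ⟩
          (e′ ℕ.* N) · proj₁ (root b)   ≈⟨ multiple-ε e′ (fermat (proj₁ (root b))) ⟩
          ε   ∎
          where
          e′ = ℕ.quotient (ℕ.gcd[m,n]∣n N e)
          he : h ℕ.* e ≡ e′ ℕ.* N
          he = ≡.trans (≡.cong (h ℕ.*_) (ℕ._∣_.equality (ℕ.gcd[m,n]∣n N e)))
            (≡.trans (S.solve 3 (λ h e g → h S.:* (e S.:* g) S.:= e S.:* (h S.:* g)) refl h e′ g) (≡.cong (e′ ℕ.*_) (≡.sym N≡hg)))
            where module S = ℕSolver.+-*-Solver

        |C|≡g : C.size ≡ g
        |C|≡g = ℕ.≤-antisym upper lower
          where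
          0<|I| : 0 ℕ.< I.size
          0<|I| = ℕ.n≢0⇒n>0 λ |I|≡0 → ℕ.<⇒≱ 0<N (≡.subst (N ℕ.≤_) (≡.trans (≡.cong (C.size ℕ.*_) |I|≡0) (ℕ.*-zeroʳ C.size)) N≤|C||I|)
          upper : C.size ℕ.≤ g
          upper = ℕ.*-cancelʳ-≤ C.size g I.size {{ℕ.>-nonZero 0<|I|}} (ℕ.≤-trans |C||I|≤N (ℕ.≤-trans N≤|I||K|
            (ℕ.≤-trans (ℕ.*-monoʳ-≤ I.size |K|≤g) (ℕ.≤-reflexive (ℕ.*-comm I.size g)))))
          lower : g ℕ.≤ C.size
          lower = ℕ.*-cancelʳ-≤ g C.size h {{ℕ.>-nonZero 0<h}} (ℕ.≤-trans (ℕ.≤-reflexive (≡.trans (ℕ.*-comm g h) (≡.sym N≡hg)))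
            (ℕ.≤-trans N≤|C||I| (ℕ.*-monoʳ-≤ C.size |I|≤h)))

      powerClasses : Bijection (AbelianGroup.setoid (G /powers e)) (≡.setoid (Fin (gcd N e)))
      powerClasses = record
        { to = λ x → Fin.cast |C|≡g (class x)
        ; cong = λ x~y → ≡.cong (Fin.cast |C|≡g) (class-cong x~y)
        ; bijective = (λ {x} {y} eq → class-injective (cast-injective eq)) , λ i → representative (Fin.cast (≡.sym |C|≡g) i) , λ {z} z~ →
            ≡.trans (≡.cong (Fin.cast |C|≡g) (≡.trans (class-cong z~) (class-representative _))) (Fin.cast-involutive |C|≡g (≡.sym |C|≡g) i)
        }
        where
        cast-injective : ∀ {i j} → Fin.cast |C|≡g i ≡ Fin.cast |C|≡g j → i ≡ j
        cast-injective {i} {j} eq = Fin.toℕ-injective (≡.trans (≡.sym (Fin.toℕ-cast |C|≡g i)) (≡.trans (≡.cong toℕ eq) (Fin.toℕ-cast |C|≡g j)))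

module FieldRoots {c ℓ} (k : CommutativeRing c ℓ) (isField : IsField k)
  (zero? : ∀ x → Dec (CommutativeRing._≈_ k x (CommutativeRing.0# k))) where
  open CommutativeRing k hiding (zero) renaming (refl to ≈-refl; sym to ≈-sym; trans to ≈-trans)
  open IsField isField
  open Exp semiring using (_^_)
  open AbelianGroupProps +-abelianGroup using (x∙y⁻¹≈ε⇒x≈y)
  open IntegerCoefficientSolver k
  open SetoidReasoning setoid

  private
    horner : ∀ {n} → Vec Carrier n → Carrier → Carrier
    horner []      x = 0#
    horner (a ∷ p) x = a + x * horner p x

    -- The quotient of p - p(r) by T - r.
    deflate : ∀ {n} → Carrier → Vec Carrier (suc n) → Vec Carrier n
    deflate r (a ∷ [])        = []
    deflate r (a ∷ p@(_ ∷ _)) = horner p r ∷ deflate r p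

    deflate-last : ∀ {n} r (p : Vec Carrier (suc (suc n))) → Vec.last (deflate r p) ≈ Vec.last p
    deflate-last r (a ∷ b ∷ [])          = ≈-trans (+-congˡ (zeroʳ r)) (+-identityʳ b)
    deflate-last r (a ∷ p@(_ ∷ _ ∷ _)) = deflate-last r p

    horner-deflate : ∀ {n} r (p : Vec Carrier (suc n)) x → horner p x - horner p r ≈ (x - r) * horner (deflate r p) x
    horner-deflate r (a ∷ [])        x = begin
      (a + x * 0#) - (a + r * 0#)   ≈⟨ +-cong (+-congˡ (zeroʳ x)) (-‿cong (+-congˡ (zeroʳ r))) ⟩
      (a + 0#) - (a + 0#)   ≈⟨ -‿inverseʳ (a + 0#) ⟩
      0#   ≈⟨ zeroʳ (x - r) ⟨
      (x - r) * 0#   ∎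
    horner-deflate r (a ∷ p@(_ ∷ _)) x = begin
      (a + x * P x) - (a + r * P r)   ≈⟨ solve 5 (λ a x r X R → (a :+ x :* X) :- (a :+ r :* R) := (x :- r) :* R :+ x :* (X :- R)) ≈-refl a x r (P x) (P r) ⟩
      (x - r) * P r + x * (P x - P r)   ≈⟨ +-congˡ (*-congˡ (horner-deflate r p x)) ⟩
      (x - r) * P r + x * ((x - r) * Q)   ≈⟨ solve 4 (λ x r R Q → (x :- r) :* R :+ x :* ((x :- r) :* Q) := (x :- r) :* (R :+ x :* Q)) ≈-refl x r (P r) Q ⟩
      (x - r) * (P r + x * Q)   ∎
      where
      P = horner p
      Q = horner (deflate r p) x

    integral : ∀ {x y} → ¬ x ≈ 0# → x * y ≈ 0# → y ≈ 0#
    integral {x} {y} x≉0 xy≈0 with x⁻¹ , xx⁻¹≈1 ← inverse x x≉0 = begin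
      y   ≈⟨ *-identityˡ y ⟨
      1# * y   ≈⟨ *-congʳ xx⁻¹≈1 ⟨
      x * x⁻¹ * y      ≈⟨ solve 3 (λ x i y → x :* i :* y := i :* (x :* y)) ≈-refl x x⁻¹ y ⟩
      x⁻¹ * (x * y)    ≈⟨ *-congˡ xy≈0 ⟩
      x⁻¹ * 0#   ≈⟨ zeroʳ x⁻¹ ⟩
      0#   ∎

    few-roots : ∀ {n m} (p : Vec Carrier (suc n)) → ¬ Vec.last p ≈ 0# → (f : Fin m → Carrier) →
                (∀ {i j} → f i ≈ f j → i ≡ j) → (∀ i → horner p (f i) ≈ 0#) → m ℕ.≤ n
    few-roots {m = zero}             p        _    f inj root = ℕ.z≤n
    few-roots {zero}  {suc m} (a ∷ []) last≉0 f inj root =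
      ⊥-elim (last≉0 (≈-trans (≈-sym (≈-trans (+-congˡ (zeroʳ _)) (+-identityʳ a))) (root zero)))
    few-roots {suc n} {suc m} p        last≉0 f inj root = ℕ.s≤s (few-roots (deflate r p)
      (λ e → last≉0 (≈-trans (≈-sym (deflate-last r p)) e)) (f ∘ suc) (λ e → Fin.suc-injective (inj e))
      λ i → integral (λ e → Fin.0≢1+n (≡.sym (inj (x∙y⁻¹≈ε⇒x≈y (f (suc i)) r e))))
        (≈-trans (≈-sym (horner-deflate r p (f (suc i)))) (≈-trans (+-cong (root (suc i)) (-‿cong (root zero))) (-‿inverseʳ 0#))))
      where r = f zero

    monomial : ∀ n → Vec Carrier (suc n)
    monomial zero    = 1# ∷ []
    monomial (suc n) = 0# ∷ monomial n

    horner-monomial : ∀ n x → horner (monomial n) x ≈ x ^ n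
    horner-monomial zero    x = ≈-trans (+-congˡ (zeroʳ x)) (+-identityʳ 1#)
    horner-monomial (suc n) x = ≈-trans (+-identityˡ _) (*-congˡ (horner-monomial n x))

    last-monomial : ∀ n a → Vec.last (a ∷ monomial n) ≡ 1#
    last-monomial zero    a = refl
    last-monomial (suc n) a = last-monomial n 0#

  few-roots-of-unity : ∀ n {m} (f : Fin m → Carrier) → (∀ {i j} → f i ≈ f j → i ≡ j) →
                       (∀ i → f i ^ suc n ≈ 1#) → m ℕ.≤ suc n
  few-roots-of-unity n f inj root = few-roots (- 1# ∷ monomial n) (λ e → 1≉0 (≈-trans (reflexive (≡.sym (last-monomial n (- 1#)))) e)) f inj
    λ i → ≈-trans (+-congˡ (≈-trans (*-congˡ (horner-monomial n (f i))) (root i))) (-‿inverseˡ 1#)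

module FiniteFieldUnits {c ℓ} (k : CommutativeRing c ℓ) (isField : IsField k) where
  open CommutativeRing k hiding (zero) renaming (refl to ≈-refl; sym to ≈-sym; trans to ≈-trans)
  open IsField isField
  open Exp semiring using (_^_)
  open PowerIdentities k

  private
    inverse-≉0 : ∀ {x y} → x * y ≈ 1# → ¬ y ≈ 0#
    inverse-≉0 {x} e y≈0 = 1≉0 (≈-trans (≈-sym e) (≈-trans (*-congˡ y≈0) (zeroʳ x)))

    *-≉0 : ∀ {x y} → ¬ x ≈ 0# → ¬ y ≈ 0# → ¬ x * y ≈ 0#
    *-≉0 {x} {y} x≉0 y≉0 xy≈0 with x⁻¹ , xx⁻¹≈1 ← inverse x x≉0 =
      y≉0 (≈-trans (≈-sym (*-identityˡ y)) (≈-trans (*-congʳ (≈-trans (≈-sym xx⁻¹≈1) (*-comm x x⁻¹)))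
        (≈-trans (*-assoc x⁻¹ x y) (≈-trans (*-congˡ xy≈0) (zeroʳ x⁻¹)))))

    inv : ∀ {x} → ¬ x ≈ 0# → Carrier
    inv {x} x≉0 = proj₁ (inverse x x≉0)

    inv-inverse : ∀ {x} (x≉0 : ¬ x ≈ 0#) → x * inv x≉0 ≈ 1#
    inv-inverse {x} x≉0 = proj₂ (inverse x x≉0)

  units : AbelianGroup (c ⊔ ℓ) ℓ
  units = record
    { Carrier = ∃[ x ] ¬ x ≈ 0#
    ; _≈_     = λ x y → proj₁ x ≈ proj₁ y
    ; _∙_     = λ x y → proj₁ x * proj₁ y , *-≉0 (proj₂ x) (proj₂ y)
    ; ε       = 1# , 1≉0
    ; _⁻¹     = λ x → inv (proj₂ x) , inverse-≉0 (inv-inverse (proj₂ x))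
    ; isAbelianGroup = record
      { isGroup = record
        { isMonoid = record
          { isSemigroup = record
            { isMagma = record
              { isEquivalence = record { refl = ≈-refl ; sym = ≈-sym ; trans = ≈-trans }
              ; ∙-cong = *-cong }
            ; assoc = λ _ _ _ → *-assoc _ _ _ }
          ; identity = (λ _ → *-identityˡ _) , (λ _ → *-identityʳ _) }
        ; inverse = (λ x → ≈-trans (*-comm _ _) (inv-inverse (proj₂ x))) , (λ x → inv-inverse (proj₂ x))
        ; ⁻¹-cong = λ {x} {y} e → inverse-unique (inv-inverse (proj₂ x)) (≈-trans (*-congʳ e) (inv-inverse (proj₂ y))) }
      ; comm = λ _ _ → *-comm _ _ } }

  private
    module U = AbelianGroup units
  open CMonMult U.commutativeMonoid using () renaming (_×_ to _·_)

  ·-^ : ∀ n x → proj₁ (n · x) ≡ proj₁ x ^ n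
  ·-^ zero    x = refl
  ·-^ (suc n) x = ≡.cong (proj₁ x *_) (·-^ n x)

  powerClasses : ∀ {q} → HasCardinality setoid q → ∀ e → 0 ℕ.< e →
                 Bijection (AbelianGroup.setoid (units /powers e)) (≡.setoid (Fin (gcd (q ∸ 1) e)))
  powerClasses {zero}  card e 0<e with () ← Bijection.to card 0#
  powerClasses {suc q} card e 0<e = FinitePowerClasses.powerClasses units q enum index
    (λ {x} {y} → index-cong {x} {y}) enum-index index-enum e 0<e
    λ n f inj root → FieldRoots.few-roots-of-unity k isField zero? n (proj₁ ∘ f) inj
      (λ i → ≈-trans (reflexive (≡.sym (·-^ (suc n) (f i)))) (root i))
    where
    module B = Bijection card
    zero? : ∀ x → Dec (x ≈ 0#)
    zero? x = map′ B.injective B.cong (B.to x Fin.≟ B.to 0#)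
    element : Fin (suc q) → Carrier
    element i = proj₁ (B.surjective i)
    to-element : ∀ i → B.to (element i) ≡ i
    to-element i = proj₂ (B.surjective i) ≈-refl
    enum : Fin q → U.Carrier
    enum i = element (punchIn (B.to 0#) i) , λ e → Fin.punchInᵢ≢i (B.to 0#) i (≡.trans (≡.sym (to-element _)) (B.cong e))
    to≢ : ∀ x → ¬ x ≈ 0# → ¬ B.to 0# ≡ B.to x
    to≢ x x≉0 e = x≉0 (B.injective (≡.sym e))
    index : U.Carrier → Fin q
    index (x , x≉0) = punchOut (to≢ x x≉0)
    index-cong : ∀ {x y} → x U.≈ y → index x ≡ index y
    index-cong {x , _} {y , _} e = Fin.punchOut-cong (B.to 0#) (B.cong e)
    enum-index : ∀ x → enum (index x) U.≈ x
    enum-index (x , x≉0) = B.injective (≡.trans (to-element _) (Fin.punchIn-punchOut (to≢ x x≉0)))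
    index-enum : ∀ i → index (enum i) ≡ i
    index-enum i = ≡.trans (Fin.punchOut-cong (B.to 0#) {i≢k = λ e → Fin.punchInᵢ≢i (B.to 0#) i (≡.sym e)} (to-element (punchIn (B.to 0#) i)))
      (Fin.punchOut-punchIn (B.to 0#))

module ResidueUnits {c ℓ} (K : DiscretelyValuedField c ℓ) where
  private
    module KF = DiscretelyValuedField K
    module K = CommutativeRing KF.ring
    module v = Valuation KF.ring KF.valuation
    k = residueField K
    module k = CommutativeRing k

  private
    ≈0⇒1≤v : ∀ x → x k.≈ k.0# → 1ℤ v.≤ᵛ proj₁ x
    ≈0⇒1≤v x = v.≤ᵛ-resp (K.trans (K.+-congˡ (RingProps.-0#≈0# (CommutativeRing.ring KF.ring))) (K.+-identityʳ _))

    1≤v⇒≈0 : ∀ x → 1ℤ v.≤ᵛ proj₁ x → x k.≈ k.0#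
    1≤v⇒≈0 x = v.≤ᵛ-resp (K.sym (K.trans (K.+-congˡ (RingProps.-0#≈0# (CommutativeRing.ring KF.ring))) (K.+-identityʳ _)))

  residue-cong : ∀ x y → proj₁ x K.≈ proj₁ y → x k.≈ y
  residue-cong x y e = v.≤ᵛ-0 (K.trans (K.+-congʳ e) (K.-‿inverseʳ _))

  unit-v : ∀ {x} → ¬ x k.≈ k.0# → v.v (proj₁ x) ≡ fin 0ℤ
  unit-v {x} x≉0 = v.≤ᵛ-exact (proj₂ x) (x≉0 ∘ 1≤v⇒≈0 x)

  v-unit : ∀ {x} (vx : v.v x ≡ fin 0ℤ) → ¬ (x , v.v≡⇒≤ᵛ vx) k.≈ k.0#
  v-unit {x} vx e = v.1+n≰ᵛ vx (≈0⇒1≤v (x , v.v≡⇒≤ᵛ vx) e)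

  inverse-v : ∀ {x y m} → x K.* y K.≈ K.1# → v.v x ≡ fin m → v.v y ≡ fin (ℤ.- m)
  inverse-v {x} {y} {m} xy≈1 vx = from (v.v-finite {y} λ y≈0 → v.1≉0 (K.trans (K.sym xy≈1) (K.trans (K.*-congˡ y≈0) (K.zeroʳ x))))
    where
    from : ∃[ n ] v.v y ≡ fin n → v.v y ≡ fin (ℤ.- m)
    from (n , vy) = ≡.trans vy (≡.cong fin (AbelianGroup.uniqueʳ-⁻¹ ℤ.+-0-abelianGroup m n
      (fin-injective (≡.trans (≡.sym (v.v≡* vx vy)) (≡.trans (v.v-cong xy≈1) v.v1)))))

  residue-isField : IsField k
  residue-isField = record
    { 1≉0 = λ e → v.1+n≰ᵛ v.v1 (≈0⇒1≤v k.1# e)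
    ; inverse = λ x x≉0 → from x (unit-v {x} x≉0) }
    where
    from : ∀ x → v.v (proj₁ x) ≡ fin 0ℤ → ∃[ y ] x k.* y k.≈ k.1#
    from x vx = invert (KF.inverse (proj₁ x) (v.v≡fin⇒≉0 vx))
      where
      invert : ∃[ y ] proj₁ x K.* y K.≈ K.1# → ∃[ y ] x k.* y k.≈ k.1#
      invert (y , xy≈1) = (y , v.v≡⇒≤ᵛ (inverse-v xy≈1 vx)) , residue-cong (x k.* (y , v.v≡⇒≤ᵛ (inverse-v xy≈1 vx))) k.1# xy≈1

  residue-× : ∀ n → proj₁ (Mult._×_ k.semiring n k.1#) ≡ Mult._×_ K.semiring n K.1#
  residue-× zero    = refl
  residue-× (suc n) = ≡.cong (K.1# K.+_) (residue-× n)

  residue-^ : ∀ x n → proj₁ (Exp._^_ k.semiring x n) ≡ Exp._^_ K.semiring (proj₁ x) n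
  residue-^ x zero    = refl
  residue-^ x (suc n) = ≡.cong (proj₁ x K.*_) (residue-^ x n)

  characteristic : ∀ {p} → HasCharacteristic k p → ∀ d → ¬ p ℕ.∣ d → v.v (Mult._×_ K.semiring d K.1#) ≡ fin 0ℤ
  characteristic char d p∤d = ≡.subst (λ x → v.v x ≡ fin 0ℤ) (residue-× d)
    (unit-v {Mult._×_ k.semiring d k.1#} (λ e → p∤d (Equivalence.to (char d) e)))

module UniformiserClasses {c ℓ} (K : DiscretelyValuedField c ℓ) (complete : IsComplete K) (e-1 : ℕ)
  (v[e]≡0 : DiscretelyValuedField.v K (Mult._×_ (CommutativeRing.semiring (DiscretelyValuedField.ring K)) (suc e-1) (DiscretelyValuedField.1# K)) ≡ fin 0ℤ)
  {q : ℕ} (card : HasCardinality (CommutativeRing.setoid (residueField K)) q) where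
  private
    e = suc e-1
    g = gcd (q ∸ 1) e
    module KF = DiscretelyValuedField K
    module K = CommutativeRing KF.ring
    module v = Valuation KF.ring KF.valuation
    k = residueField K
    module k = CommutativeRing k
    module H = Hensel K complete
  open ResidueUnits K
  open Exp K.semiring using (_^_)
  open FiniteFieldUnits k residue-isField using (units; ·-^; powerClasses)
  private
    module U = AbelianGroup units
    module Q = AbelianGroup (units /powers e)
    module B = Bijection (powerClasses card e (ℕ.s≤s ℕ.z≤n))
    open IntegerCoefficientSolver KF.ring
    open CMonMult U.commutativeMonoid using () renaming (_×_ to _·_)

    π₀ = proj₁ (v.onto 1ℤ)
    v-π₀ : v.v π₀ ≡ fin 1ℤ
    v-π₀ = proj₂ (v.onto 1ℤ)
    ρ = proj₁ (KF.inverse π₀ (v.v≡fin⇒≉0 v-π₀))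
    π₀ρ≈1 : π₀ K.* ρ K.≈ K.1#
    π₀ρ≈1 = proj₂ (KF.inverse π₀ (v.v≡fin⇒≉0 v-π₀))

    unit-of : ∀ {x} → v.v x ≡ fin 0ℤ → U.Carrier
    unit-of {x} vx = (x , v.v≡⇒≤ᵛ vx) , v-unit vx

    v-quotient : ∀ {x} → v.v x ≡ fin 1ℤ → v.v (x K.* ρ) ≡ fin 0ℤ
    v-quotient vx = v.v≡* vx (inverse-v π₀ρ≈1 v-π₀)

    lift-· : ∀ n (z : U.Carrier) → proj₁ (proj₁ (n · z)) ≡ proj₁ (proj₁ z) ^ n
    lift-· n z = ≡.trans (≡.cong proj₁ (·-^ n z)) (residue-^ (proj₁ z) n)

  infix 4 _≈_mod-e-th-powers
  _≈_mod-e-th-powers : K.Carrier → K.Carrier → Set (c ⊔ ℓ)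
  x ≈ y mod-e-th-powers = ∃[ z ] ¬ z K.≈ K.0# × x K.≈ y K.* z ^ e

  class : ∀ {x} → v.v x ≡ fin 1ℤ → Fin g
  class vx = B.to (unit-of (v-quotient vx))

  class-cong : ∀ {x y} (vx : v.v x ≡ fin 1ℤ) (vy : v.v y ≡ fin 1ℤ) → x ≈ y mod-e-th-powers → class vx ≡ class vy
  class-cong {x} {y} vx vy (z , z≉0 , x≈yz^e) = B.cong (unit-of v-z ,
      residue-cong (proj₁ (unit-of (v-quotient vx))) (proj₁ (unit-of (v-quotient vy) U.∙ e · unit-of v-z))
        (K.trans (K.*-congʳ x≈yz^e) (K.trans (solve 3 (λ y z r → y :* z :* r := y :* r :* z) K.refl y (z ^ e) ρ)
          (K.*-congˡ (K.reflexive (≡.sym (lift-· e (unit-of v-z))))))))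
    where
    v-z : v.v z ≡ fin 0ℤ
    v-z = from (v.v-finite z≉0)
      where
      from : ∃[ n ] v.v z ≡ fin n → v.v z ≡ fin 0ℤ
      from (n , vz) = ≡.trans vz (≡.cong fin (ℤ.*-cancelˡ-≡ (+ e) n 0ℤ (≡.trans
        (AbelianGroupProps.∙-cancelˡ ℤ.+-0-abelianGroup 1ℤ (+ e ℤ.* n) 0ℤ
          (fin-injective (≡.trans (≡.sym (v.v≡* vy (v.v-^ e vz))) (≡.trans (≡.sym (v.v-cong x≈yz^e)) vx)))) (≡.sym (ℤ.*-zeroʳ (+ e))))))

  class-injective : ∀ {x y} (vx : v.v x ≡ fin 1ℤ) (vy : v.v y ≡ fin 1ℤ) → class vx ≡ class vy → x ≈ y mod-e-th-powers
  class-injective {x} {y} vx vy eq = from (B.injective eq)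
    where
    from : unit-of (v-quotient vx) Q.≈ unit-of (v-quotient vy) → x ≈ y mod-e-th-powers
    from (z , x≈yz^e) = fromLift (proj₁ (proj₁ z)) (unit-v {proj₁ z} (proj₂ z))
        (v.≤ᵛ-resp (K.+-congˡ (K.-‿cong (K.*-congˡ (K.reflexive (lift-· e z))))) x≈yz^e)
      where
      fromLift : ∀ z → v.v z ≡ fin 0ℤ → 1ℤ v.≤ᵛ x K.* ρ K.- (y K.* ρ) K.* z ^ e → x ≈ y mod-e-th-powers
      fromLift z vz close = fromInverse (KF.inverse w (v.v≡fin⇒≉0 v-w))
        where
        w = (y K.* ρ) K.* z ^ e
        v-w : v.v w ≡ fin 0ℤ
        v-w = ≡.trans (v.v≡* (v-quotient vy) (v.v-^ e vz)) (≡.cong fin (≡.trans (ℤ.+-identityˡ _) (ℤ.*-zeroʳ (+ e))))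
        fromInverse : ∃[ w⁻¹ ] w K.* w⁻¹ K.≈ K.1# → x ≈ y mod-e-th-powers
        fromInverse (w⁻¹ , ww⁻¹≈1) = fromRoot (H.1-unit-root e v[e]≡0 {x K.* ρ K.* w⁻¹} 1-unit)
          where
          1-unit : 1ℤ v.≤ᵛ x K.* ρ K.* w⁻¹ K.- K.1#
          1-unit = v.≤ᵛ-resp (K.trans (solve 3 (λ a w i → (a :- w) :* i := a :* i :- w :* i) K.refl (x K.* ρ) w w⁻¹) (K.+-congˡ (K.-‿cong ww⁻¹≈1)))
            (v.≤ᵛ-* {1ℤ} {0ℤ} close (v.v≡⇒≤ᵛ (inverse-v ww⁻¹≈1 v-w)))
          fromRoot : ∃[ t ] t ^ e K.≈ x K.* ρ K.* w⁻¹ → x ≈ y mod-e-th-powers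
          fromRoot (t , t^e≈) = z K.* t , zt≉0 , x≈
            where
            open SetoidReasoning K.setoid
            x≈ : x K.≈ y K.* (z K.* t) ^ e
            x≈ = K.sym (begin
              y K.* (z K.* t) ^ e   ≈⟨ K.*-congˡ (CommExp.^-distrib-* K.commutativeSemiring z t e) ⟩
              y K.* (z ^ e K.* t ^ e)   ≈⟨ K.*-congˡ (K.*-congˡ t^e≈) ⟩
              y K.* (z ^ e K.* (x K.* ρ K.* w⁻¹))   ≈⟨ solve 5 (λ y z x r i → y :* (z :* (x :* r :* i)) := x :* (((y :* r) :* z) :* i)) K.refl y (z ^ e) x ρ w⁻¹ ⟩
              x K.* (w K.* w⁻¹)   ≈⟨ K.*-congˡ ww⁻¹≈1 ⟩
              x K.* K.1#   ≈⟨ K.*-identityʳ x ⟩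
              x   ∎)
            zt≉0 : ¬ z K.* t K.≈ K.0#
            zt≉0 zt≈0 = v.v≡fin⇒≉0 vx (K.trans x≈ (K.trans (K.*-congˡ (K.trans (K.*-congʳ zt≈0) (K.zeroˡ _))) (K.zeroʳ y)))

  class-surjective : ∀ i → ∃[ x ] Σ (v.v x ≡ fin 1ℤ) λ vx → class vx ≡ i
  class-surjective i = from (B.surjective i)
    where
    from : (∃[ u ] (∀ {z} → z Q.≈ u → B.to z ≡ i)) → ∃[ x ] Σ (v.v x ≡ fin 1ℤ) λ vx → class vx ≡ i
    from (u , hits) = a K.* π₀ , v-x , hits (U.ε , same)
      where
      a = proj₁ (proj₁ u)
      v-x : v.v (a K.* π₀) ≡ fin 1ℤ
      v-x = v.v≡* (unit-v {proj₁ u} (proj₂ u)) v-π₀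
      1^ : ∀ n → K.1# ^ n K.≈ K.1#
      1^ = PowerIdentities.1^ KF.ring
      same : proj₁ (unit-of (v-quotient v-x)) k.≈ proj₁ (u U.∙ e · U.ε)
      same = residue-cong (proj₁ (unit-of (v-quotient v-x))) (proj₁ (u U.∙ e · U.ε))
        (K.trans (K.*-assoc a π₀ ρ) (K.*-congˡ (K.trans π₀ρ≈1 (K.sym (K.trans (K.reflexive (lift-· e U.ε)) (1^ e))))))

module Correspondence {c ℓ} (K : DiscretelyValuedField c ℓ) (complete : IsComplete K) (e-1 : ℕ)
  (v[d]≡0 : ∀ d → d ℕ.∣ suc e-1 →
    DiscretelyValuedField.v K (Mult._×_ (CommutativeRing.semiring (DiscretelyValuedField.ring K)) d (DiscretelyValuedField.1# K)) ≡ fin 0ℤ) where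
  private
    e = suc e-1
    module KF = DiscretelyValuedField K
    module K = CommutativeRing KF.ring
    module v = Valuation KF.ring KF.valuation
    module G = AbelianGroup (K^×/K^×ᵉ K e)
    module H = AbelianGroup (unitGroup K)
  open Lines K e-1
  open Exp K.semiring using (_^_)

  private
    L : ∀ {π} → v.v π ≡ fin 1ℤ → TotallyRamifiedExtension K e
    L {π} vπ = RadicalAlgebra.totallyRamified K e-1 π vπ λ d d∣e d≈0 → v.v≡fin⇒≉0 (v[d]≡0 d d∣e) d≈0

    v[e]≡0 = v[d]≡0 e ℕ.∣-refl

    Root : TotallyRamifiedExtension K e → K.Carrier → Set (c ⊔ ℓ)
    Root M π = ∃[ μ ] Algebra._≈_ A (Exp._^_ (Algebra.semiring A) μ e) (Algebra.ι A π)
      where A = TotallyRamifiedExtension.algebra M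

    infix 4 _≅ᵀ_
    _≅ᵀ_ : TotallyRamifiedExtension K e → TotallyRamifiedExtension K e → Set (c ⊔ ℓ)
    M ≅ᵀ N = TotallyRamifiedExtension.algebra M ≅ TotallyRamifiedExtension.algebra N

    root-L : ∀ {π} (vπ : v.v π ≡ fin 1ℤ) → Root (L vπ) π
    root-L {π} vπ = Polynomial.T KF.ring , RadicalAlgebra.T^e≈π K e-1 π

    root⇒≅L : ∀ M {π} (vπ : v.v π ≡ fin 1ℤ) → Root M π → L vπ ≅ᵀ M
    root⇒≅L M {π} vπ (μ , μ^e≈π) = TotallyTame.root⇒≅ K e-1 M {π} {μ} vπ μ^e≈π

    transport-root : ∀ M N {π} → M ≅ᵀ N → Root M π → Root N π
    transport-root M N {π} f (μ , μ^e≈π) = f.to μ , B.trans (B.sym (to-^ e)) (B.trans (F.⟦⟧-cong μ^e≈π) (f.to-ι π))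
      where
      module A = Algebra (TotallyRamifiedExtension.algebra M)
      module B = Algebra (TotallyRamifiedExtension.algebra N)
      module f = _≅_ f
      module F = IsRingIsomorphism f.isRingIsomorphism
      to-^ : ∀ n → f.to (Exp._^_ A.semiring μ n) B.≈ Exp._^_ B.semiring (f.to μ) n
      to-^ zero    = F.1#-homo
      to-^ (suc n) = B.trans (F.*-homo μ _) (B.*-congˡ (to-^ n))

    rescale-root : ∀ M {π π′ z} → π′ K.≈ π K.* z ^ e → Root M π → Root M π′
    rescale-root M {π} {π′} {z} eq (μ , μ^e≈π) = μ A.* A.ι z , (begin
        Exp._^_ A.semiring (μ A.* A.ι z) e   ≈⟨ CommExp.^-distrib-* A.commutativeSemiring μ (A.ι z) e ⟩
        Exp._^_ A.semiring μ e A.* Exp._^_ A.semiring (A.ι z) e   ≈⟨ A.*-cong μ^e≈π (A.sym (ι-^ e)) ⟩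
        A.ι π A.* A.ι (z ^ e)   ≈⟨ ιH.*-homo π (z ^ e) ⟨
        A.ι (π K.* z ^ e)   ≈⟨ ιH.⟦⟧-cong eq ⟨
        A.ι π′   ∎)
      where
      module A = Algebra (TotallyRamifiedExtension.algebra M)
      module ιH = RingHomomorphism A.structure
      open SetoidReasoning A.setoid
      ι-^ : ∀ n → A.ι (z ^ n) A.≈ Exp._^_ A.semiring (A.ι z) n
      ι-^ zero    = ιH.1#-homo
      ι-^ (suc n) = A.trans (ιH.*-homo z _) (A.*-congˡ (ι-^ n))

    roots⇒power : ∀ M {π π′} → v.v π ≡ fin 1ℤ → v.v π′ ≡ fin 1ℤ → Root M π → Root M π′ →
                  ∃[ z ] ¬ z K.≈ K.0# × π K.≈ π′ K.* z ^ e
    roots⇒power M {π} {π′} vπ vπ′ (α , α^e) (β , β^e) =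
      TotallyTame.roots⇒power K e-1 M complete v[e]≡0 {π} {π′} {α} {β} vπ vπ′ α^e β^e

    uniformiser-root : ∀ M → ∃[ π ] v.v π ≡ fin 1ℤ × Root M π
    uniformiser-root M = TotallyTame.root-of-uniformiser K e-1 M complete v[e]≡0

    unit : ∀ {π} → v.v π ≡ fin 1ℤ → H.Carrier
    unit {π} vπ = π , v.v≡fin⇒≉0 vπ

  module _ (D : RamifiedLine K e) (ϖ : UniformiserIn K e D) where
    open UniformiserIn ϖ

    lineExtension : TotallyRamifiedExtension K e
    lineExtension = L v-π

    root⇒lineExtension≅ : ∀ M {x : H.Carrier} → v.v (proj₁ x) ≡ fin 1ℤ → RamifiedLine.Member D x → Root M (proj₁ x) → lineExtension ≅ᵀ M
    root⇒lineExtension≅ M {x} vx x∈D root = root⇒≅L M v-π (from (≈⇒power {π} {x} (uniformisers-≈ D {π} {x} v-π vx π∈D x∈D)))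
      where
      from : ∃[ z ] ¬ z K.≈ K.0# × proj₁ π K.≈ proj₁ x K.* z ^ e → Root M (proj₁ π)
      from (z , _ , eq) = rescale-root M eq root

  extension-of-line : RamifiedLine K e → TotallyRamifiedExtension K e
  extension-of-line D = lineExtension D (uniformiserIn K e D)

  lines↔extensions : Bijection (ramifiedLines K e) (totallyRamifiedExtensions K e)
  lines↔extensions = record
    { to = extension-of-line
    ; cong = λ {D} {D′} D≐D′ → cong D D′ (proj₂ D≐D′)
    ; bijective = (λ {D} {D′} f → injective D D′ f (≅-sym f)) , surjective }
    where
    cong : ∀ D D′ → (∀ {x} → RamifiedLine.Member D′ x → RamifiedLine.Member D x) → extension-of-line D ≅ᵀ extension-of-line D′
    cong D D′ D′⊆D = root⇒lineExtension≅ D (uniformiserIn K e D) (extension-of-line D′) {π} v-π (D′⊆D {π} π∈D) (root-L v-π)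
      where open UniformiserIn (uniformiserIn K e D′)
    included : ∀ D D′ → extension-of-line D ≅ᵀ extension-of-line D′ → ∀ {x} → RamifiedLine.Member D x → RamifiedLine.Member D′ x
    included D D′ f = line⊆ D D′ {ϖ.π} {ϖ′.π} ϖ.v-π ϖ.π∈D ϖ′.π∈D
      (from (roots⇒power (extension-of-line D′) ϖ.v-π ϖ′.v-π (transport-root (extension-of-line D) (extension-of-line D′) f (root-L ϖ.v-π)) (root-L ϖ′.v-π)))
      where
      module ϖ = UniformiserIn (uniformiserIn K e D)
      module ϖ′ = UniformiserIn (uniformiserIn K e D′)
      from : ∃[ z ] ¬ z K.≈ K.0# × proj₁ ϖ.π K.≈ proj₁ ϖ′.π K.* z ^ e → ϖ.π G.≈ ϖ′.π
      from (z , z≉0 , eq) = power⇒≈ {ϖ.π} {ϖ′.π} z z≉0 eq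
    injective : ∀ D D′ → extension-of-line D ≅ᵀ extension-of-line D′ → extension-of-line D′ ≅ᵀ extension-of-line D →
                RamifiedLine.Member D ≐ RamifiedLine.Member D′
    injective D D′ f f⁻¹ = (λ {x} → included D D′ f {x}) , (λ {x} → included D′ D f⁻¹ {x})
    surjective : ∀ M → ∃[ D ] (∀ {D′} → RamifiedLine.Member D′ ≐ RamifiedLine.Member D → extension-of-line D′ ≅ᵀ M)
    surjective M = from (uniformiser-root M)
      where
      from : ∃[ π ] v.v π ≡ fin 1ℤ × Root M π → ∃[ D ] (∀ {D′} → RamifiedLine.Member D′ ≐ RamifiedLine.Member D → extension-of-line D′ ≅ᵀ M)
      from (π , vπ , root) = generatedLine {unit vπ} vπ , λ {D′} (_ , ⊇) →
        root⇒lineExtension≅ D′ (uniformiserIn K e D′) M {unit vπ} vπ (⊇ {unit vπ} (generator∈generatedLine {unit vπ} vπ)) root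

  line-radical : (D : RamifiedLine K e) (ϖ : UniformiserIn K e D) →
    TotallyRamifiedExtension.algebra (Bijection.to lines↔extensions D) ≅ radicalAlgebra K e (proj₁ (UniformiserIn.π ϖ))
  line-radical D ϖ = root⇒lineExtension≅ D (uniformiserIn K e D) (L v-π) {π} v-π π∈D (root-L v-π)
    where open UniformiserIn ϖ

  cardinality : ∀ {q} → HasCardinality (CommutativeRing.setoid (residueField K)) q →
                HasCardinality (totallyRamifiedExtensions K e) (gcd (q ∸ 1) e)
  cardinality card = record
    { to = λ M → class (proj₁ (proj₂ (uniformiser-root M)))
    ; cong = λ {M} {N} f → cong M N f (uniformiser-root M) (uniformiser-root N)
    ; bijective = (λ {M} {N} → injective M N (uniformiser-root M) (uniformiser-root N)) , surjective }
    where
    open UniformiserClasses K complete e-1 v[e]≡0 card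
    Uniformised : TotallyRamifiedExtension K e → Set (c ⊔ ℓ)
    Uniformised M = ∃[ π ] v.v π ≡ fin 1ℤ × Root M π
    cong : ∀ M N → M ≅ᵀ N → ((_ , vπ , _) : Uniformised M) ((_ , vπ′ , _) : Uniformised N) → class vπ ≡ class vπ′
    cong M N f (π , vπ , root) (π′ , vπ′ , root′) = class-cong vπ vπ′ (roots⇒power N vπ vπ′ (transport-root M N f root) root′)
    injective : ∀ M N ((_ , vπ , _) : Uniformised M) ((_ , vπ′ , _) : Uniformised N) → class vπ ≡ class vπ′ → M ≅ᵀ N
    injective M N (π , vπ , root) (π′ , vπ′ , root′) eq = ≅-trans (≅-sym (root⇒≅L M vπ root))
        (from (class-injective vπ vπ′ eq))
      where
      from : ∃[ z ] ¬ z K.≈ K.0# × π K.≈ π′ K.* z ^ e → L vπ ≅ᵀ N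
      from (z , _ , eq) = root⇒≅L N vπ (rescale-root N eq root′)
    surjective : ∀ i → ∃[ M ] (∀ {N} → N ≅ᵀ M → class (proj₁ (proj₂ (uniformiser-root N))) ≡ i)
    surjective i = from (class-surjective i)
      where
      from : ∃[ x ] Σ (v.v x ≡ fin 1ℤ) (λ vx → class vx ≡ i) → ∃[ M ] (∀ {N} → N ≅ᵀ M → class (proj₁ (proj₂ (uniformiser-root N))) ≡ i)
      from (x , vx , refl) = L vx , λ {N} f → cong N (L vx) f (uniformiser-root N) (x , vx , root-L vx)

open import Data.Nat.Divisibility using (_∣_)

proposition5p1p1 : ∀ {c ℓ} (F : LocalField c ℓ) (p q e : ℕ) →
    let K = LocalField.valuedField F in
    HasCharacteristic (residueField K) p →
    HasCardinality (CommutativeRing.setoid (residueField K)) q →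
    0 < e →
    ¬ (p ∣ e) →
    (Σ (Bijection (ramifiedLines K e) (totallyRamifiedExtensions K e)) λ φ →
       (D : RamifiedLine K e) (ϖ : UniformiserIn K e D) →
       TotallyRamifiedExtension.algebra (Bijection.to φ D)
         ≅ radicalAlgebra K e (proj₁ (UniformiserIn.π ϖ)))
    × HasCardinality (totallyRamifiedExtensions K e) (gcd (q ∸ 1) e)
proposition5p1p1 F p q (suc e-1) char card _ p∤e = (lines↔extensions , line-radical) , cardinality card
  where
  K = LocalField.valuedField F
  open Correspondence K (LocalField.complete F) e-1
    (λ d d∣e → ResidueUnits.characteristic K char d (λ p∣d → p∤e (ℕ.∣-trans p∣d d∣e)))
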